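{- Let $(W(n))_{n\ge0}$ be a Somos 5 sequence with $W(0)W(1)\ne0$ and let $E/\mathbb{Q}$ be the associated elliptic curve. Let $\mathbf{P}=(P_1,P_2)$ and $\mathbf{Q}=(Q_1,Q_2)\in E(\mathbb{Q})^2$ be the associated rational points for the even and odd index terms of $(W(n))$, respectively. Let $p$ be an odd prime, with $E$ given by a Weierstrass equation with $p$-integral coefficients, such that $P_1,P_2,Q_1,Q_2$ modulo $p$ are nonsingular, $P_1,\ P_2,\ P_2\pm P_1,\ Q_1,\ Q_2,\ Q_2\pm Q_1\not\equiv\mathcal{O}\pmod p$, and the orders of $P_1$ and $Q_1$ modulo $p$ are greater than $3$. Assume further that $\mathrm{ord}_p\left(\frac{W(2)}{W(0)}\right)\ge0$, $\mathrm{ord}_p\left(\frac{W(3)}{W(1)}\right)\ge0$, $\mathrm{ord}_p(W(0))\ge0$ and $\mathrm{ord}_p(W(1))\ge 0$. Then there is a power $q=p^N$ ($N\ge1$) such that for all $m\ge1$ the limits $\lim_{i\to\infty}W(2mq^i)$ and $\lim_{i\to\infty}W(2mq^i+1)$ exist in $\mathbb{Z}_p$.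
   Context: A Somos 5 sequence is a sequence $(W(n))_{n\ge0}$ (here of rational numbers) satisfying $W(n)W(n-5)=\tau_1W(n-1)W(n-4)+\tau_2W(n-2)W(n-3)$ for all $n\ge5$, with constant parameters $\tau_1,\tau_2$. Associated curve and points. $E/\mathbb{Q}$ and $\mathbf{P},\mathbf{Q}\in E(\mathbb{Q})^2$ are associated to $(W(n))$ if they realize Hone's sigma-function solution: for some $z_1,z_2\in\mathbb{C}$ and a uniformization $\mathbb{C}/L\cong E(\mathbb{C})$, $P_1=Q_1$ is the image of $2z_1$, $P_2$ of $z_2$, $Q_2$ of $z_1+z_2$, and for all $n\ge1$ $$W(2n)=\alpha^n\beta\,\Psi_n(\mathbf{P}),\qquad W(2n+1)=\gamma^n\delta\,\Psi_n(\mathbf{Q}),$$ where $\alpha=W(2)/W(0)$, $\beta=W(0)$, $\gamma=W(3)/W(1)$, $\delta=W(1)$. Here $\Psi_n$ are the translated division polynomials: if $(P_1,P_2)$ correspond to $(w_1,w_2)\in\mathbb{C}^2$ then $\Psi_n(\mathbf{P})=\dfrac{\sigma(nw_1+w_2)}{\sigma(w_1)^{n^2-n}\sigma(w_1+w_2)^n\sigma(w_2)^{1-n}}$ ($\sigma$ the Weierstrass sigma function of $L$). Algebraically, for $E: y^2+a_1xy+a_3y=x^3+a_2x^2+a_4x+a_6$ and $P_i=(x_i,y_i)$ with $P_1,P_2,P_2\pm P_1\ne\mathcal{O}$, the $\Psi_n(\mathbf{P})$ are the specializations at $(E,\mathbf{P})$ of the universal expressions determined by $\Psi_{ -1}=x_1-x_2$,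 $\Psi_0=\Psi_1=1$, $\Psi_2=2x_1+x_2-\left(\frac{y_2-y_1}{x_2-x_1}\right)^2-a_1\frac{y_2-y_1}{x_2-x_1}+a_2$ and $\Psi_{m+2}\Psi_{m-2}=\beta_1^2\Psi_{m+1}\Psi_{m-1}-\beta_2\Psi_m^2$ ($m\in\mathbb{Z}$), $\beta_1=2y_1+a_1x_1+a_3$, $\beta_2=3x_1^4+b_2x_1^3+3b_4x_1^2+3b_6x_1+b_8$ ($b_i$ the usual Weierstrass quantities); with $a_i,x_i,y_i$ generic these lie in $\mathbb{Z}[a_1,a_2,a_3,a_4,a_6][x_1,y_1,x_2,y_2][(x_1-x_2)^{ -1}]$ modulo the two Weierstrass equations. Reduction. A point of $E(\mathbb{Q})$ is nonsingular modulo $p$ if it reduces to a nonsingular point of the reduced cubic over $\mathbb{F}_p$; its order modulo $p$ is its order in the group of nonsingular points; $\equiv\mathcal{O}\pmod p$ means that it reduces to $\mathcal{O}$. -}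

module Defs where

open import Algebra.Apartness.Bundles using (HeytingCommutativeRing; HeytingField)
open import Algebra.Bundles using (CommutativeRing; Semiring)
import Algebra.Definitions.RawSemiring as RawSemiringDefs
open import Data.Integer.Base as ℤ using (ℤ; +_; -[1+_]; 0ℤ; 1ℤ)
import Data.Integer.Divisibility.Signed as ℤ
import Data.Integer.Properties as ℤ
import Data.Integer.Tactic.RingSolver as ℤ-Solver
open import Data.Nat.Base as ℕ using (ℕ; zero; suc)
open import Data.Nat.Coprimality using (Coprime; coprime-Bézout)
import Data.Nat.Divisibility as ℕ
open import Data.Nat.GCD using (module Bézout)
open import Data.Nat.Primality using (Prime; prime⇒irreducible; ¬prime[1])
open import Data.Product.Base using (∃; ∃₂; ∃-syntax; _×_; _,_; proj₁; proj₂)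
open import Data.Rational.Base as ℚ using (ℚ; 0ℚ; ↥_; ↧_; ↧ₙ_)
import Data.Rational.Properties as ℚ
open import Data.Sum.Base using (_⊎_; inj₁; inj₂)
open import Data.Unit.Base using (⊤)
open import Function.Base using (_∘_)
open import Level using (0ℓ)
open import Relation.Binary.Definitions using (Decidable)
open import Relation.Binary.PropositionalEquality
  using (_≡_; _≢_; refl; sym; trans; cong; subst)
open import Relation.Nullary using (¬_; yes; no; contradiction)
open import Relation.Nullary.Decidable using (¬?; decidable-stable)

------------------------------------------------------------------------
-- Weierstrass curves

record WeierstrassCurve {c} (A : Set c) : Set c where
  field
    a₁ a₂ a₃ a₄ a₆ : A

data Point {c} (A : Set c) : Set c where
  ∞      : Point A
  affine : (x y : A) → Point A

module Weierstrass {c ℓ} (R : CommutativeRing c ℓ) where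
  open CommutativeRing R
  open RawSemiringDefs (Semiring.rawSemiring semiring)
    using (_^_) renaming (_×_ to infixr 7 _·_)

  module _ (E : WeierstrassCurve Carrier) where
    open WeierstrassCurve E

    b₂ b₄ b₆ b₈ Δ : Carrier
    b₂ = a₁ ^ 2 + 4 · a₂
    b₄ = 2 · a₄ + a₁ * a₃
    b₆ = a₃ ^ 2 + 4 · a₆
    b₈ = a₁ ^ 2 * a₆ + 4 · (a₂ * a₆) - a₁ * a₃ * a₄ + a₂ * a₃ ^ 2 - a₄ ^ 2
    Δ  = 9 · (b₂ * b₄ * b₆) - b₂ ^ 2 * b₈ - 8 · b₄ ^ 3 - 27 · b₆ ^ 2

    OnCurve : (x y : Carrier) → Set ℓ
    OnCurve x y =
      y ^ 2 + a₁ * x * y + a₃ * y ≈ x ^ 3 + a₂ * x ^ 2 + a₄ * x + a₆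

    -- The partial derivatives of y² + ⋯ - (x³ + ⋯), up to sign.
    ∂x ∂y : (x y : Carrier) → Carrier
    ∂x x y = 3 · x ^ 2 + 2 · (a₂ * x) + a₄ - a₁ * y
    ∂y x y = 2 · y + a₁ * x + a₃

    -- The coefficients of the Somos 4 recurrence; β₁ is the value of the
    -- second and β₂ that of the third division polynomial.
    β₁ β₂ : (x y : Carrier) → Carrier
    β₁ x y = 2 · y + a₁ * x + a₃
    β₂ x y = 3 · x ^ 4 + b₂ * x ^ 3 + 3 · (b₄ * x ^ 2) + 3 · (b₆ * x) + b₈

    _∋_ : Point Carrier → Set ℓ
    _∋_ ∞            = Level.Lift ℓ ⊤
    _∋_ (affine x y) = OnCurve x y

    Nonsingular : Point Carrier → Set ℓ
    Nonsingular ∞            = Level.Lift ℓ ⊤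
    Nonsingular (affine x y) =
      OnCurve x y × ¬ (∂x x y ≈ 0# × ∂y x y ≈ 0#)

-- The group law is given by formulas on all of Point Carrier; it is the
-- group law of the nonsingular points of E when restricted to them.
module GroupLaw {c ℓ₁ ℓ₂} (F : HeytingField c ℓ₁ ℓ₂)
                (_#?_ : Decidable (HeytingField._#_ F)) where
  open HeytingField F
  private
    R = HeytingCommutativeRing.commutativeRing heytingCommutativeRing
  open Weierstrass R public
  open RawSemiringDefs (Semiring.rawSemiring (CommutativeRing.semiring R)) using (_^_)

  -- 1 / (x - y)
  recip : ∀ {x y} → x # y → Carrier
  recip x#y = proj₁ (#⇒invertible x#y)

  module _ (E : WeierstrassCurve Carrier) where
    open WeierstrassCurve E

    negY : (x y : Carrier) → Carrier
    negY x y = - y - a₁ * x - a₃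

    neg : Point Carrier → Point Carrier
    neg ∞            = ∞
    neg (affine x y) = affine x (negY x y)

    -- The negative of the third intersection point of the curve with the
    -- line of slope s through (x₁ , y₁) and a point with abscissa x₂.
    thirdPoint : (s x₁ y₁ x₂ : Carrier) → Point Carrier
    thirdPoint s x₁ y₁ x₂ = affine x₃ (negY x₃ (s * (x₃ - x₁) + y₁))
      where x₃ = s ^ 2 + a₁ * s - a₂ - x₁ - x₂

    -- If x₁ ≈ x₂ and y₁ # negY x₂ y₂ then, on the curve, y₁ ≈ y₂ and
    -- y₁ - negY x₂ y₂ is the denominator 2y₁ + a₁x₁ + a₃ of the slope of the
    -- tangent line.
    add : Point Carrier → Point Carrier → Point Carrier
    add ∞ Q = Q
    add P ∞ = P
    add (affine x₁ y₁) (affine x₂ y₂) with x₁ #? x₂ | y₁ #? negY x₂ y₂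
    ... | yes x₁#x₂ | _     = thirdPoint ((y₁ - y₂) * recip x₁#x₂) x₁ y₁ x₂
    ... | no _      | yes d = thirdPoint (∂x E x₁ y₁ * recip d) x₁ y₁ x₂
    ... | no _      | no _  = ∞

    sub : Point Carrier → Point Carrier → Point Carrier
    sub P Q = add P (neg Q)

    mul : ℕ → Point Carrier → Point Carrier
    mul zero    P = ∞
    mul (suc n) P = add P (mul n P)

    HasOrder : Point Carrier → ℕ → Set c
    HasOrder P k =
      0 ℕ.< k × mul k P ≡ ∞ × (∀ j → 0 ℕ.< j → j ℕ.< k → mul j P ≢ ∞)

------------------------------------------------------------------------
-- The universal ring
--   ℤ[a₁,a₂,a₃,a₄,a₆][x₁,y₁,x₂,y₂][(x₁-x₂)⁻¹]
-- modulo the Weierstrass equations for (x₁,y₁) and (x₂,y₂), presented by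
-- generators and relations; δ stands for (x₁-x₂)⁻¹.

data Generator : Set where
  a₁ a₂ a₃ a₄ a₆ x₁ y₁ x₂ y₂ δ : Generator

infixl 6 _⊕_
infixl 7 _⊗_
infix  8 ⊝_
infix  4 _≋_

data Expr : Set where
  gen     : Generator → Expr
  𝟘 𝟙     : Expr
  _⊕_ _⊗_ : Expr → Expr → Expr
  ⊝_      : Expr → Expr

weierstrassˡ weierstrassʳ : (x y : Generator) → Expr
weierstrassˡ x y =
  gen y ⊗ gen y ⊕ gen a₁ ⊗ gen x ⊗ gen y ⊕ gen a₃ ⊗ gen y
weierstrassʳ x y =
  gen x ⊗ gen x ⊗ gen x ⊕ gen a₂ ⊗ (gen x ⊗ gen x) ⊕ gen a₄ ⊗ gen x ⊕ gen a₆

data _≋_ : Expr → Expr → Set where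
  curve₁   : weierstrassˡ x₁ y₁ ≋ weierstrassʳ x₁ y₁
  curve₂   : weierstrassˡ x₂ y₂ ≋ weierstrassʳ x₂ y₂
  inverse  : gen δ ⊗ (gen x₁ ⊕ ⊝ gen x₂) ≋ 𝟙

  ≋-refl   : ∀ {s} → s ≋ s
  ≋-sym    : ∀ {s t} → s ≋ t → t ≋ s
  ≋-trans  : ∀ {s t u} → s ≋ t → t ≋ u → s ≋ u
  ⊕-cong   : ∀ {s t u v} → s ≋ t → u ≋ v → s ⊕ u ≋ t ⊕ v
  ⊗-cong   : ∀ {s t u v} → s ≋ t → u ≋ v → s ⊗ u ≋ t ⊗ v
  ⊝-cong   : ∀ {s t} → s ≋ t → ⊝ s ≋ ⊝ t
  ⊕-assoc  : ∀ s t u → s ⊕ t ⊕ u ≋ s ⊕ (t ⊕ u)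
  ⊕-comm   : ∀ s t → s ⊕ t ≋ t ⊕ s
  ⊕-idˡ    : ∀ s → 𝟘 ⊕ s ≋ s
  ⊕-invˡ   : ∀ s → ⊝ s ⊕ s ≋ 𝟘
  ⊗-assoc  : ∀ s t u → s ⊗ t ⊗ u ≋ s ⊗ (t ⊗ u)
  ⊗-comm   : ∀ s t → s ⊗ t ≋ t ⊗ s
  ⊗-idˡ    : ∀ s → 𝟙 ⊗ s ≋ s
  ⊗-distʳ  : ∀ s t u → (t ⊕ u) ⊗ s ≋ t ⊗ s ⊕ u ⊗ s

universalRing : CommutativeRing 0ℓ 0ℓ
universalRing = record
  { Carrier = Expr ; _≈_ = _≋_ ; _+_ = _⊕_ ; _*_ = _⊗_ ; -_ = ⊝_
  ; 0# = 𝟘 ; 1# = 𝟙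
  ; isCommutativeRing = record
    { isRing = record
      { +-isAbelianGroup = record
        { isGroup = record
          { isMonoid = record
            { isSemigroup = record
              { isMagma = record
                { isEquivalence = record
                  { refl = ≋-refl ; sym = ≋-sym ; trans = ≋-trans }
                ; ∙-cong = ⊕-cong
                }
              ; assoc = ⊕-assoc
              }
            ; identity = ⊕-idˡ , λ s → ≋-trans (⊕-comm s 𝟘) (⊕-idˡ s)
            }
          ; inverse = ⊕-invˡ , λ s → ≋-trans (⊕-comm s (⊝ s)) (⊕-invˡ s)
          ; ⁻¹-cong = ⊝-cong
          }
        ; comm = ⊕-comm
        }
      ; *-cong = ⊗-cong
      ; *-assoc = ⊗-assoc
      ; *-identity = ⊗-idˡ , λ s → ≋-trans (⊗-comm s 𝟙) (⊗-idˡ s)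
      ; distrib =
          (λ s t u → ≋-trans (⊗-comm s (t ⊕ u))
                       (≋-trans (⊗-distʳ s t u)
                         (⊕-cong (⊗-comm t s) (⊗-comm u s))))
        , ⊗-distʳ
      }
    ; *-comm = ⊗-comm
    }
  }

universalCurve : WeierstrassCurve Expr
universalCurve = record
  { a₁ = gen a₁ ; a₂ = gen a₂ ; a₃ = gen a₃ ; a₄ = gen a₄ ; a₆ = gen a₆ }

module Universal where
  private
    module U = CommutativeRing universalRing
    module C = Weierstrass universalRing
  open RawSemiringDefs (Semiring.rawSemiring U.semiring)
    using (_^_) renaming (_×_ to infixr 7 _·_)

  -- slope = (y₂-y₁)/(x₂-x₁)
  slope β₁ β₂ : Expr
  slope = (gen y₁ U.- gen y₂) ⊗ gen δ
  β₁    = C.β₁ universalCurve (gen x₁) (gen y₁)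
  β₂    = C.β₂ universalCurve (gen x₁) (gen y₁)

  -- The universal Ψₘ, m ∈ ℤ. The universal ring is a localised polynomial ring
  -- (eliminate a₆ and a₄), hence a domain, and the recurrence determines the
  -- Ψₘ in it uniquely.
  record TranslatedDivisionPolynomials : Set where
    field
      Ψ     : ℤ → Expr
      Ψ₋₁   : Ψ (ℤ.- 1ℤ) ≋ gen x₁ U.- gen x₂
      Ψ₀    : Ψ (+ 0) ≋ 𝟙
      Ψ₁    : Ψ (+ 1) ≋ 𝟙
      Ψ₂    : Ψ (+ 2) ≋
                2 · gen x₁ ⊕ gen x₂ U.- slope ^ 2 U.- gen a₁ ⊗ slope ⊕ gen a₂
      somos : ∀ m → Ψ (m ℤ.+ + 2) ⊗ Ψ (m ℤ.- + 2) ≋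
                β₁ ^ 2 ⊗ (Ψ (m ℤ.+ + 1) ⊗ Ψ (m ℤ.- + 1)) U.- β₂ ⊗ Ψ m ^ 2

open Universal public using (TranslatedDivisionPolynomials)

module Evaluation {c ℓ} (R : CommutativeRing c ℓ) where
  open CommutativeRing R hiding (refl; sym; trans)

  module _ (ρ : Generator → Carrier) where

    eval : Expr → Carrier
    eval (gen v) = ρ v
    eval 𝟘       = 0#
    eval 𝟙       = 1#
    eval (s ⊕ t) = eval s + eval t
    eval (s ⊗ t) = eval s * eval t
    eval (⊝ s)   = - eval s

    eval-cong : eval (weierstrassˡ x₁ y₁) ≈ eval (weierstrassʳ x₁ y₁) →
                eval (weierstrassˡ x₂ y₂) ≈ eval (weierstrassʳ x₂ y₂) →
                ρ δ * (ρ x₁ - ρ x₂) ≈ 1# →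
                ∀ {s t} → s ≋ t → eval s ≈ eval t
    eval-cong h₁ h₂ h₃ = go
      where
      go : ∀ {s t} → s ≋ t → eval s ≈ eval t
      go curve₁          = h₁
      go curve₂          = h₂
      go inverse         = h₃
      go ≋-refl          = CommutativeRing.refl R
      go (≋-sym e)       = CommutativeRing.sym R (go e)
      go (≋-trans e f)   = CommutativeRing.trans R (go e) (go f)
      go (⊕-cong e f)    = +-cong (go e) (go f)
      go (⊗-cong e f)    = *-cong (go e) (go f)
      go (⊝-cong e)      = -‿cong (go e)
      go (⊕-assoc s t u) = +-assoc (eval s) (eval t) (eval u)
      go (⊕-comm s t)    = +-comm (eval s) (eval t)
      go (⊕-idˡ s)       = +-identityˡ (eval s)
      go (⊕-invˡ s)      = -‿inverseˡ (eval s)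
      go (⊗-assoc s t u) = *-assoc (eval s) (eval t) (eval u)
      go (⊗-comm s t)    = *-comm (eval s) (eval t)
      go (⊗-idˡ s)       = *-identityˡ (eval s)
      go (⊗-distʳ s t u) = distribʳ (eval s) (eval t) (eval u)

-- Specialisation at (E , P₁ , P₂).
module Specialisation {c ℓ₁ ℓ₂} (F : HeytingField c ℓ₁ ℓ₂)
                      (_#?_ : Decidable (HeytingField._#_ F))
                      (E : WeierstrassCurve (HeytingField.Carrier F)) where
  open HeytingField F
  open GroupLaw F _#?_
  open Evaluation (HeytingCommutativeRing.commutativeRing heytingCommutativeRing)

  -- For P₁ and P₂ on E this says that P₁, P₂, P₂ ± P₁ are not ∞.
  data Admissible : Point Carrier → Point Carrier → Set (c Level.⊔ ℓ₁ Level.⊔ ℓ₂) where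
    admissible : ∀ {x₁ y₁ x₂ y₂} → OnCurve E x₁ y₁ → OnCurve E x₂ y₂ → x₁ # x₂ →
                 Admissible (affine x₁ y₁) (affine x₂ y₂)

  valuation : ∀ {P₁ P₂} → Admissible P₁ P₂ → Generator → Carrier
  valuation (admissible _ _ _) a₁ = WeierstrassCurve.a₁ E
  valuation (admissible _ _ _) a₂ = WeierstrassCurve.a₂ E
  valuation (admissible _ _ _) a₃ = WeierstrassCurve.a₃ E
  valuation (admissible _ _ _) a₄ = WeierstrassCurve.a₄ E
  valuation (admissible _ _ _) a₆ = WeierstrassCurve.a₆ E
  valuation (admissible {x₁ = x} _ _ _) x₁ = x
  valuation (admissible {y₁ = y} _ _ _) y₁ = y
  valuation (admissible {x₂ = x} _ _ _) x₂ = x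
  valuation (admissible {y₂ = y} _ _ _) y₂ = y
  valuation (admissible _ _ x₁#x₂) δ = recip x₁#x₂

  specialise : ∀ {P₁ P₂} → Admissible P₁ P₂ → Expr → Carrier
  specialise adm = eval (valuation adm)

------------------------------------------------------------------------
-- The field 𝔽ₚ, as ℤ with congruence modulo p

module ResidueField {p : ℕ} (p-prime : Prime p) where

  infix 4 _≈ₚ_ _#ₚ_

  _≈ₚ_ _#ₚ_ : ℤ → ℤ → Set
  x ≈ₚ y = + p ℤ.∣ x ℤ.- y
  x #ₚ y = ¬ x ≈ₚ y

  _≈ₚ?_ : Decidable _≈ₚ_
  x ≈ₚ? y = + p ℤ.∣? (x ℤ.- y)

  _#ₚ?_ : Decidable _#ₚ_
  x #ₚ? y = ¬? (x ≈ₚ? y)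

  private
    ≡⇒≈ : ∀ {x y} → x ≡ y → x ≈ₚ y
    ≡⇒≈ {x} refl = subst (+ p ℤ.∣_) (sym (ℤ.+-inverseʳ x)) (ℤ.divides 0ℤ refl)

    ≈-sym : ∀ {x y} → x ≈ₚ y → y ≈ₚ x
    ≈-sym {x} {y} h = subst (+ p ℤ.∣_) (eq x y) (ℤ.∣m⇒∣-m h)
      where eq : ∀ x y → ℤ.- (x ℤ.- y) ≡ y ℤ.- x
            eq = ℤ-Solver.solve-∀

    ≈-trans : ∀ {x y z} → x ≈ₚ y → y ≈ₚ z → x ≈ₚ z
    ≈-trans {x} {y} {z} h k = subst (+ p ℤ.∣_) (eq x y z) (ℤ.∣m∣n⇒∣m+n h k)
      where eq : ∀ x y z → (x ℤ.- y) ℤ.+ (y ℤ.- z) ≡ x ℤ.- z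
            eq = ℤ-Solver.solve-∀

    +-cong : ∀ {x y u v} → x ≈ₚ y → u ≈ₚ v → x ℤ.+ u ≈ₚ y ℤ.+ v
    +-cong {x} {y} {u} {v} h k =
      subst (+ p ℤ.∣_) (eq x y u v) (ℤ.∣m∣n⇒∣m+n h k)
      where eq : ∀ x y u v → (x ℤ.- y) ℤ.+ (u ℤ.- v) ≡ x ℤ.+ u ℤ.- (y ℤ.+ v)
            eq = ℤ-Solver.solve-∀

    *-cong : ∀ {x y u v} → x ≈ₚ y → u ≈ₚ v → x ℤ.* u ≈ₚ y ℤ.* v
    *-cong {x} {y} {u} {v} h k =
      subst (+ p ℤ.∣_) (eq x y u v)
        (ℤ.∣m∣n⇒∣m+n (ℤ.∣n⇒∣m*n u h) (ℤ.∣n⇒∣m*n y k))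
      where eq : ∀ x y u v →
                 u ℤ.* (x ℤ.- y) ℤ.+ y ℤ.* (u ℤ.- v) ≡ x ℤ.* u ℤ.- y ℤ.* v
            eq = ℤ-Solver.solve-∀

    -‿cong : ∀ {x y} → x ≈ₚ y → ℤ.- x ≈ₚ ℤ.- y
    -‿cong {x} {y} h = subst (+ p ℤ.∣_) (eq x y) (ℤ.∣m⇒∣-m h)
      where eq : ∀ x y → ℤ.- (x ℤ.- y) ≡ ℤ.- x ℤ.- ℤ.- y
            eq = ℤ-Solver.solve-∀

  commutativeRing : CommutativeRing 0ℓ 0ℓ
  commutativeRing = record
    { Carrier = ℤ ; _≈_ = _≈ₚ_ ; _+_ = ℤ._+_ ; _*_ = ℤ._*_ ; -_ = ℤ.-_
    ; 0# = 0ℤ ; 1# = 1ℤ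
    ; isCommutativeRing = record
      { isRing = record
        { +-isAbelianGroup = record
          { isGroup = record
            { isMonoid = record
              { isSemigroup = record
                { isMagma = record
                  { isEquivalence = record
                    { refl = λ {x} → ≡⇒≈ {x} refl
                    ; sym = λ {x} {y} → ≈-sym {x} {y}
                    ; trans = λ {x} {y} {z} → ≈-trans {x} {y} {z}
                    }
                  ; ∙-cong = λ {x} {y} {u} {v} → +-cong {x} {y} {u} {v}
                  }
                ; assoc = λ x y z → ≡⇒≈ (ℤ.+-assoc x y z)
                }
              ; identity = (λ x → ≡⇒≈ (ℤ.+-identityˡ x))
                         , (λ x → ≡⇒≈ (ℤ.+-identityʳ x))
              }
            ; inverse = (λ x → ≡⇒≈ (ℤ.+-inverseˡ x))
                      , (λ x → ≡⇒≈ (ℤ.+-inverseʳ x))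
            ; ⁻¹-cong = λ {x} {y} → -‿cong {x} {y}
            }
          ; comm = λ x y → ≡⇒≈ (ℤ.+-comm x y)
          }
        ; *-cong = λ {x} {y} {u} {v} → *-cong {x} {y} {u} {v}
        ; *-assoc = λ x y z → ≡⇒≈ (ℤ.*-assoc x y z)
        ; *-identity = (λ x → ≡⇒≈ (ℤ.*-identityˡ x))
                     , (λ x → ≡⇒≈ (ℤ.*-identityʳ x))
        ; distrib = (λ x y z → ≡⇒≈ (ℤ.*-distribˡ-+ x y z))
                  , (λ x y z → ≡⇒≈ (ℤ.*-distribʳ-+ x y z))
        }
      ; *-comm = λ x y → ≡⇒≈ (ℤ.*-comm x y)
      }
    }

  private
    p∤1 : ¬ + p ℤ.∣ 1ℤ
    p∤1 h with refl ← ℕ.∣1⇒≡1 (ℤ.∣⇒∣ᵤ h) = ¬prime[1] p-prime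

    coprime : ∀ n → ¬ p ℕ.∣ n → Coprime p n
    coprime n p∤n (d∣p , d∣n) with prime⇒irreducible p-prime d∣p
    ... | inj₁ d≡1  = d≡1
    ... | inj₂ refl = contradiction d∣n p∤n

    inverseℕ : ∀ n → ¬ p ℕ.∣ n → ∃[ y ] y ℤ.* + n ≈ₚ 1ℤ
    inverseℕ n p∤n with coprime-Bézout (coprime n p∤n)
    ... | Bézout.+- u v eq = ℤ.- + v , ℤ.divides (ℤ.- + u) (go (lift eq))
      where
      lift : 1 ℕ.+ v ℕ.* n ≡ u ℕ.* p → 1ℤ ℤ.+ + v ℤ.* + n ≡ + u ℤ.* + p
      lift e = trans (cong (λ z → 1ℤ ℤ.+ z) (sym (ℤ.pos-* v n)))
                     (trans (cong +_ e) (ℤ.pos-* u p))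
      rearrange : ∀ v n → ℤ.- v ℤ.* n ℤ.- 1ℤ ≡ ℤ.- (1ℤ ℤ.+ v ℤ.* n)
      rearrange = ℤ-Solver.solve-∀
      go : 1ℤ ℤ.+ + v ℤ.* + n ≡ + u ℤ.* + p →
           ℤ.- + v ℤ.* + n ℤ.- 1ℤ ≡ ℤ.- + u ℤ.* + p
      go e = trans (rearrange (+ v) (+ n))
                   (trans (cong ℤ.-_ e) (ℤ.neg-distribˡ-* (+ u) (+ p)))
    ... | Bézout.-+ u v eq = + v , ℤ.divides (+ u) (go (lift eq))
      where
      lift : 1 ℕ.+ u ℕ.* p ≡ v ℕ.* n → 1ℤ ℤ.+ + u ℤ.* + p ≡ + v ℤ.* + n
      lift e = trans (cong (λ z → 1ℤ ℤ.+ z) (sym (ℤ.pos-* u p)))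
                     (trans (cong +_ e) (ℤ.pos-* v n))
      rearrange : ∀ z → 1ℤ ℤ.+ z ℤ.- 1ℤ ≡ z
      rearrange = ℤ-Solver.solve-∀
      go : 1ℤ ℤ.+ + u ℤ.* + p ≡ + v ℤ.* + n →
           + v ℤ.* + n ℤ.- 1ℤ ≡ + u ℤ.* + p
      go e = trans (cong (ℤ._- 1ℤ) (sym e)) (rearrange (+ u ℤ.* + p))

  inverse-mod : ∀ x → ¬ + p ℤ.∣ x → ∃[ y ] y ℤ.* x ≈ₚ 1ℤ
  inverse-mod (+ n) p∤x = inverseℕ n (p∤x ∘ ℤ.∣ᵤ⇒∣)
  inverse-mod -[1+ n ] p∤x with inverseℕ (suc n) (p∤x ∘ ℤ.∣ᵤ⇒∣)
  ... | y , h = ℤ.- y , subst (_≈ₚ 1ℤ) (eq y (+ suc n)) h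
    where eq : ∀ y n → y ℤ.* n ≡ ℤ.- y ℤ.* ℤ.- n
          eq = ℤ-Solver.solve-∀

  field𝔽ₚ : HeytingField 0ℓ 0ℓ 0ℓ
  field𝔽ₚ = record
    { Carrier = ℤ ; _≈_ = _≈ₚ_ ; _#_ = _#ₚ_ ; _+_ = ℤ._+_ ; _*_ = ℤ._*_
    ; -_ = ℤ.-_ ; 0# = 0ℤ ; 1# = 1ℤ
    ; isHeytingField = record
      { isHeytingCommutativeRing = record
        { isCommutativeRing = CommutativeRing.isCommutativeRing commutativeRing
        ; isApartnessRelation = record
          { irrefl  = λ x≈y x#y → x#y x≈y
          ; sym     = λ {x} {y} x#y → x#y ∘ ≈-sym {y} {x}
          ; cotrans = λ {x} {y} → cotrans {x} {y}
          }
        ; #⇒invertible = λ {x} {y} x#y → invertible (x ℤ.- y) (inverse-mod (x ℤ.- y) x#y)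
        ; invertible⇒# = λ {x} {y} (u , h , _) x≈y →
            p∤1 (ℤ.∣m+n∣m⇒∣n (subst (+ p ℤ.∣_) (neg-eq (u ℤ.* (x ℤ.- y))) (ℤ.∣m⇒∣-m h))
                             (ℤ.∣m⇒∣-m (ℤ.∣n⇒∣m*n u x≈y)))
        }
      ; tight = λ x y → decidable-stable (x ≈ₚ? y) , λ x≈y x#y → x#y x≈y
      }
    }
    where
    neg-eq : ∀ z → ℤ.- (z ℤ.- 1ℤ) ≡ ℤ.- z ℤ.+ 1ℤ
    neg-eq = ℤ-Solver.solve-∀

    invertible : ∀ x → ∃[ y ] y ℤ.* x ≈ₚ 1ℤ →
                 ∃[ y ] y ℤ.* x ≈ₚ 1ℤ × x ℤ.* y ≈ₚ 1ℤ
    invertible x (y , h) = y , h , subst (_≈ₚ 1ℤ) (ℤ.*-comm y x) h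

    cotrans : ∀ {x y} → x #ₚ y → ∀ z → x #ₚ z ⊎ z #ₚ y
    cotrans {x} {y} x#y z with x ≈ₚ? z
    ... | no x#z  = inj₁ x#z
    ... | yes x≈z = inj₂ λ z≈y → x#y (≈-trans {x} {z} {y} x≈z z≈y)

------------------------------------------------------------------------
-- p-adic valuation and reduction modulo p

infix 4 _^_∥_ _≤ord[_]_ _⟶[_]_

_^_∥_ : (p e n : ℕ) → Set
p ^ e ∥ n = p ℕ.^ e ℕ.∣ n × ¬ p ℕ.^ suc e ℕ.∣ n

-- ord p (r) = v, for r ≢ 0.
HasOrd : (p : ℕ) → ℚ → ℤ → Set
HasOrd p r v =
  ∃₂ λ e f → p ^ e ∥ ℤ.∣ ↥ r ∣ × p ^ f ∥ ↧ₙ r × v ≡ + e ℤ.- + f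

-- k ≤ ord p (r), where ord p (0) = +∞.
_≤ord[_]_ : ℤ → ℕ → ℚ → Set
k ≤ord[ p ] r = r ≡ 0ℚ ⊎ ∃ λ v → HasOrd p r v × k ℤ.≤ v

IsIntegral : ℕ → ℚ → Set
IsIntegral p r = ¬ p ℕ.∣ ↧ₙ r

record IntegralCurve (p : ℕ) (E : WeierstrassCurve ℚ) : Set where
  private module E = WeierstrassCurve E
  field
    a₁-integral : IsIntegral p E.a₁
    a₂-integral : IsIntegral p E.a₂
    a₃-integral : IsIntegral p E.a₃
    a₄-integral : IsIntegral p E.a₄
    a₆-integral : IsIntegral p E.a₆

module Overℚ where
  private
    _≢?_ : Decidable {A = ℚ} _≢_
    x ≢? y = ¬? (x ℚ.≟ y)
  open GroupLaw ℚ.heytingField _≢?_ public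
  open Specialisation ℚ.heytingField _≢?_ public

module Mod {p : ℕ} (p-prime : Prime p) where
  open ResidueField p-prime
  open GroupLaw field𝔽ₚ _#ₚ?_ public

  reduce : (r : ℚ) → IsIntegral p r → ℤ
  reduce r int = ↥ r ℤ.* proj₁ (inverse-mod (↧ r) (int ∘ ℤ.∣⇒∣ᵤ))

  reduceCurve : ∀ {E} → IntegralCurve p E → WeierstrassCurve ℤ
  reduceCurve {E} int = record
    { a₁ = reduce E.a₁ a₁-integral
    ; a₂ = reduce E.a₂ a₂-integral
    ; a₃ = reduce E.a₃ a₃-integral
    ; a₄ = reduce E.a₄ a₄-integral
    ; a₆ = reduce E.a₆ a₆-integral
    }
    where module E = WeierstrassCurve E
          open IntegralCurve int

  -- For a point of a curve with p-integral coefficients the two coordinates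
  -- are both p-integral or both not, and in the latter case it reduces to ∞.
  reducePoint : Point ℚ → Point ℤ
  reducePoint ∞ = ∞
  reducePoint (affine x y) with p ℕ.∣? ↧ₙ x | p ℕ.∣? ↧ₙ y
  ... | no x-int | no y-int = affine (reduce x x-int) (reduce y y-int)
  ... | _        | _        = ∞

------------------------------------------------------------------------
-- p-adic integers, as inverse limit of the ℤ/pᵏ, and p-adic limits

record ℤₚ (p : ℕ) : Set where
  field
    residue  : ℕ → ℤ
    coherent : ∀ k → + (p ℕ.^ k) ℤ.∣ residue (suc k) ℤ.- residue k

-- The limit of w is a: since a - residue a k ∈ pᵏℤₚ, the condition on i says
-- that w i - a has valuation at least k.
_⟶[_]_ : (ℕ → ℚ) → (p : ℕ) → ℤₚ p → Set
w ⟶[ p ] a =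
  ∀ k → ∃[ I ] ∀ i → I ℕ.≤ i →
    + k ≤ord[ p ] (w i ℚ.- (ℤₚ.residue a k ℚ./ 1))

LimitExistsInℤₚ : (p : ℕ) → (ℕ → ℚ) → Set
LimitExistsInℤₚ p w = ∃[ a ] w ⟶[ p ] a

------------------------------------------------------------------------
-- Somos 5 sequences

IsSomos5 : (ℕ → ℚ) → Set
IsSomos5 W = ∃₂ λ τ₁ τ₂ → ∀ n →
  W (5 ℕ.+ n) ℚ.* W n ≡
    τ₁ ℚ.* W (4 ℕ.+ n) ℚ.* W (1 ℕ.+ n) ℚ.+ τ₂ ℚ.* W (3 ℕ.+ n) ℚ.* W (2 ℕ.+ n)

module Somos5 (W : ℕ → ℚ) (W₀W₁≢0 : W 0 ℚ.* W 1 ≢ 0ℚ) where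
  private instance
    W₀-nonZero : ℚ.NonZero (W 0)
    W₀-nonZero = ℚ.≢-nonZero {W 0} λ W₀≡0 →
      W₀W₁≢0 (trans (cong (ℚ._* W 1) W₀≡0) (ℚ.*-zeroˡ (W 1)))
    W₁-nonZero : ℚ.NonZero (W 1)
    W₁-nonZero = ℚ.≢-nonZero {W 1} λ W₁≡0 →
      W₀W₁≢0 (trans (cong (W 0 ℚ.*_) W₁≡0) (ℚ.*-zeroʳ (W 0)))

  α β γ δ′ : ℚ
  α  = W 2 ℚ.÷ W 0
  β  = W 0
  γ  = W 3 ℚ.÷ W 1
  δ′ = W 1

  open RawSemiringDefs ℚ.+-*-rawSemiring
    using (_^_)

  -- Z is the point with parameter z₁. It is rational, being Q₂ - P₂. The values
  -- Ψₙ are taken on the given Weierstrass equation: under a change of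
  -- coordinates of scale u they are multiplied by a power of u with
  -- exponent ± (n² - n).
  record IsAssociated (𝚿 : TranslatedDivisionPolynomials)
                      (E : WeierstrassCurve ℚ) (P₁ P₂ Q₁ Q₂ : Point ℚ) : Set where
    open TranslatedDivisionPolynomials 𝚿 using (Ψ)
    open Overℚ
    field
      P-admissible : Admissible E P₁ P₂
      Q-admissible : Admissible E Q₁ Q₂
      Z            : Point ℚ
      Z∈E          : E ∋ Z
      P₁≡2Z        : P₁ ≡ add E Z Z
      Q₁≡P₁        : Q₁ ≡ P₁
      Q₂≡Z+P₂      : Q₂ ≡ add E Z P₂
      even-terms   : ∀ n → 1 ℕ.≤ n →
        W (2 ℕ.* n) ≡ α ^ n ℚ.* β ℚ.* specialise E P-admissible (Ψ (+ n))
      odd-terms    : ∀ n → 1 ℕ.≤ n →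
        W (2 ℕ.* n ℕ.+ 1) ≡ γ ^ n ℚ.* δ′ ℚ.* specialise E Q-admissible (Ψ (+ n))

{-# OPTIONS --safe #-}

-- Put ψₙ = Ψₙ(𝐏). It is p-integral because x₁ - x₂ is a p-unit: otherwise the
-- integrality of P₂ ± P₁ would force 2P₁ ≡ 𝒪. Besides the Somos 4 relation it
-- satisfies a Somos 5 relation, since by Somos 4 the quotient
--   (ψₙ₊₃ ψₙ₋₂ - β₂ ψₙ₊₂ ψₙ₋₁) / (ψₙ₊₁ ψₙ)
-- does not depend on n. As ψₙ may vanish, this is first proved for pairs of
-- points arbitrarily close p-adically to 𝐏 whose ψₙ are all positive. The order
-- of P₁ makes β₂ a p-unit (β₂ measures x(2P₁) - x(P₁)), and then Somos 4 shows
-- that ψₙ and ψₙ₊₁ are never both divisible by p.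
--
-- Hence five consecutive terms determine the next one modulo p, by Somos 4 or by
-- Somos 5, and by pigeonhole the sequence is eventually periodic modulo p. If it
-- has period T modulo pᵏ, the differences (ψ(n + T) - ψ(n)) / pᵏ obey modulo p
-- the linearised recurrence, so they are eventually periodic too, with a period
-- dividing a number M that depends on p only. Taking T divisible by M and summing
-- p of the differences gives period p T modulo pᵏ⁺¹. So pᵏM is an eventual period
-- modulo pᵏ⁺¹, and if M divides pˢ(pᴺ - 1) then ψₙ converges along n = m qⁱ with
-- q = pᴺ. The same applies to αⁿψₙ when α is a p-unit; otherwise αⁿ tends to 0.

module Submission where

open import Defs
open import Data.Integer.Base using (0ℤ)
open import Data.Nat.Base using (ℕ; _+_; _*_; _^_; _≤_; _<_)
open import Data.Nat.Primality using (Prime)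
open import Data.Product.Base using (∃-syntax; _×_)
open import Data.Rational.Base using (ℚ; 0ℚ)
import Data.Rational.Base as ℚ
open import Relation.Binary.PropositionalEquality using (_≡_; _≢_)

open import Algebra.Apartness.Bundles using (HeytingField)
open import Algebra.Bundles using (CommutativeRing)
open import Data.Fin.Base using (Fin; toℕ; fromℕ<; combine; funToFin; finToFun)
open import Data.Fin.Patterns
import Data.Fin.Properties as Fin
open import Data.Integer.Base as ℤ using (ℤ; +_; -[1+_]; 1ℤ; ∣_∣)
import Data.Integer.DivMod as ℤ
import Data.Integer.Divisibility.Signed as ℤ
import Data.Integer.Properties as ℤ
import Data.Integer.Tactic.RingSolver as ℤ-Solver
open import Data.Nat.Base as ℕ using (zero; suc; _!)
import Data.Nat.Coprimality as Coprimality
import Data.Nat.Divisibility as ℕ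
import Data.Nat.DivMod as ℕ
open import Data.Nat.Primality using (euclidsLemma; prime⇒nonZero; prime⇒nonTrivial)
import Data.Nat.Properties as ℕ
import Data.Nat.Tactic.RingSolver as ℕ-Solver
open import Data.Product.Base using (_,_; proj₁; proj₂)
open import Data.Rational.Base using (mkℚ; 1ℚ; ↥_; ↧_; ↧ₙ_)
import Data.Rational.Properties as ℚ
import Data.Rational.Solver as ℚ-Poly
import Data.Rational.Unnormalised.Base as ℚᵘ
import Data.Rational.Unnormalised.Properties as ℚᵘ
open import Algebra.Definitions.RawSemiring ℚ.+-*-rawSemiring using () renaming (_^_ to _^ℚ_)
open import Algebra.Properties.Group ℚ.+-0-group using (∙-cancelˡ)
open import Data.Sum.Base using (_⊎_; inj₁; inj₂; [_,_]′)
open import Function.Base using (_∘_)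
open import Level using (0ℓ)
open import Relation.Binary.PropositionalEquality
  using (refl; sym; trans; cong; cong₂; subst; subst₂; module ≡-Reasoning)
open import Relation.Nullary using (¬_; Dec; yes; no; contradiction)
open import Relation.Nullary.Decidable using (dec⇒maybe)
open import Tactic.RingSolver using (solve-∀)
open import Tactic.RingSolver.Core.AlmostCommutativeRing
  using (AlmostCommutativeRing; fromCommutativeRing)

-- Rational arithmetic by cross-multiplication.

ℚ-ring : AlmostCommutativeRing 0ℓ 0ℓ
ℚ-ring = fromCommutativeRing ℚ.+-*-commutativeRing (λ x → dec⇒maybe (0ℚ ℚ.≟ x))

*-cross : ∀ {r s t} → r ℚ.* s ≡ t → ↥ r ℤ.* ↥ s ℤ.* ↧ t ≡ ↥ t ℤ.* (↧ r ℤ.* ↧ s)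
*-cross {r@record{}} {s@record{}} {t@record{}} eq =
  ℚᵘ.drop-*≡* (ℚᵘ.≃-trans (ℚᵘ.≃-sym (ℚ.toℚᵘ-homo-* r s)) (ℚ.toℚᵘ-cong eq))

*-cross⁻¹ : ∀ {r s t} → ↥ r ℤ.* ↥ s ℤ.* ↧ t ≡ ↥ t ℤ.* (↧ r ℤ.* ↧ s) → r ℚ.* s ≡ t
*-cross⁻¹ {r@record{}} {s@record{}} {t@record{}} eq =
  ℚ.toℚᵘ-injective (ℚᵘ.≃-trans (ℚ.toℚᵘ-homo-* r s) (ℚᵘ.*≡* eq))

-- Built with `mkℚ` rather than `z / 1`, so that numerator and denominator compute without
-- normalisation by a gcd.
ι : ℤ → ℚ
ι z = mkℚ z 0 (Coprimality.sym (Coprimality.1-coprimeTo ∣ z ∣))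

/1≡ι : ∀ z → z ℚ./ 1 ≡ ι z
/1≡ι z = ℚ.↥p/↧p≡p (ι z)

ι-+ : ∀ x y → ι (x ℤ.+ y) ≡ ι x ℚ.+ ι y
ι-+ x y = ℚ.toℚᵘ-injective (ℚᵘ.≃-sym (ℚᵘ.≃-trans (ℚ.toℚᵘ-homo-+ (ι x) (ι y))
  (ℚᵘ.*≡* (eq x y))))
  where eq : ∀ x y → (x ℤ.* 1ℤ ℤ.+ y ℤ.* 1ℤ) ℤ.* 1ℤ ≡ (x ℤ.+ y) ℤ.* 1ℤ
        eq = ℤ-Solver.solve-∀

ι-* : ∀ x y → ι (x ℤ.* y) ≡ ι x ℚ.* ι y
ι-* x y = sym (*-cross⁻¹ {ι x} {ι y} {ι (x ℤ.* y)} refl)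

ι-neg : ∀ x → ι (ℤ.- x) ≡ ℚ.- ι x
ι-neg (+ zero)  = refl
ι-neg (+ suc n) = refl
ι-neg -[1+ n ]  = refl

-- The localisation of ℤ at p and its congruences modulo powers of p.

module Localisation {p : ℕ} (p-prime : Prime p) where

  private instance
    p≢0 = prime⇒nonZero p-prime

  -- Euclid's lemma strips off one factor `p` of `m` at a time.
  prime-power-cancelʳ : ∀ k {m n} → ¬ p ℕ.∣ n → p ℕ.^ k ℕ.∣ m ℕ.* n → p ℕ.^ k ℕ.∣ m
  prime-power-cancelʳ zero    _   _ = ℕ.1∣ _
  prime-power-cancelʳ (suc k) {m} {n} p∤n h
    with euclidsLemma m n p-prime (ℕ.∣-trans (ℕ.m∣m*n (p ℕ.^ k)) h)
  ... | inj₂ p∣n = contradiction p∣n p∤n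
  ... | inj₁ (ℕ.divides-refl q) =
    subst (p ℕ.^ suc k ℕ.∣_) (ℕ.*-comm p q)
      (ℕ.*-monoʳ-∣ p (prime-power-cancelʳ k p∤n
        (ℕ.*-cancelˡ-∣ p (subst (p ℕ.* p ℕ.^ k ℕ.∣_) eq h))))
    where
    eq : q ℕ.* p ℕ.* n ≡ p ℕ.* (q ℕ.* n)
    eq = trans (cong (ℕ._* n) (ℕ.*-comm q p)) (ℕ.*-assoc p q n)

  private
    -- The unreduced denominator `↧ r * ↧ s` is `↧ t` times the gcd `g` cancelled in normalising. A
    -- prime dividing `↧ t` therefore divides one of the two denominators.
    ↧-product : ∀ {r s} t g → ↧ t ℤ.* g ≡ ↧ r ℤ.* ↧ s →
                IsIntegral p r → IsIntegral p s → IsIntegral p t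
    ↧-product {r} {s} t g eq hr hs p∣t =
      [ hr , hs ]′ (euclidsLemma (↧ₙ r) (↧ₙ s) p-prime
        (subst (p ℕ.∣_)
          (trans (sym (ℤ.abs-* (↧ t) g)) (trans (cong ∣_∣ eq) (ℤ.abs-* (↧ r) (↧ s))))
          (ℕ.∣m⇒∣m*n ∣ g ∣ p∣t)))

  integral-+ : ∀ r s → IsIntegral p r → IsIntegral p s → IsIntegral p (r ℚ.+ s)
  integral-+ r s = ↧-product {r} {s} (r ℚ.+ s) _ (ℚ.↧-+ r s)

  integral-* : ∀ r s → IsIntegral p r → IsIntegral p s → IsIntegral p (r ℚ.* s)
  integral-* r s = ↧-product {r} {s} (r ℚ.* s) _ (ℚ.↧-* r s)

  integral-neg : ∀ r → IsIntegral p r → IsIntegral p (ℚ.- r)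
  integral-neg r h = subst (λ d → ¬ p ℕ.∣ ∣ d ∣) (sym (ℚ.↧-neg r)) h

  p∤1 : ¬ p ℕ.∣ 1
  p∤1 h with refl ← ℕ.∣1⇒≡1 h with () ← ℕ.nonTrivial⇒≢1 {{prime⇒nonTrivial p-prime}} refl

  record ℤ₍ₚ₎ : Set where
    -- With η-equality a ⊞ b and a ⊠ b would unfold and unification would fail
    -- to recover a and b.
    no-eta-equality
    constructor _⟨_⟩
    field
      val      : ℚ
      integral : IsIntegral p val
  open ℤ₍ₚ₎ public

  infixl 6 _⊞_
  infixl 7 _⊠_

  _⊞_ _⊠_ : ℤ₍ₚ₎ → ℤ₍ₚ₎ → ℤ₍ₚ₎
  val      (a ⊞ b) = val a ℚ.+ val b
  integral (a ⊞ b) = integral-+ (val a) (val b) (integral a) (integral b)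
  val      (a ⊠ b) = val a ℚ.* val b
  integral (a ⊠ b) = integral-* (val a) (val b) (integral a) (integral b)

  ⊟_ : ℤ₍ₚ₎ → ℤ₍ₚ₎
  val      (⊟ a) = ℚ.- val a
  integral (⊟ a) = integral-neg (val a) (integral a)

  int : ℤ → ℤ₍ₚ₎
  int z = ι z ⟨ p∤1 ⟩

  P : ℕ → ℚ
  P k = ι (+ (p ℕ.^ k))

  P-+ : ∀ j k → P (j ℕ.+ k) ≡ P j ℚ.* P k
  P-+ j k = trans (cong (ι ∘ +_) (ℕ.^-distribˡ-+-* p j k))
    (trans (cong ι (ℤ.pos-* (p ℕ.^ j) (p ℕ.^ k))) (ι-* (+ (p ℕ.^ j)) (+ (p ℕ.^ k))))

  infix 4 _≡_[_]

  -- The quotient is kept as data because the divided differences of a sequence are later studied as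
  -- a sequence in their own right.
  record _≡_[_] (a b : ℤ₍ₚ₎) (k : ℕ) : Set where
    constructor cong-by
    field
      quotient : ℤ₍ₚ₎
      equation : val a ≡ val b ℚ.+ P k ℚ.* val quotient
  open _≡_[_] public

  ≡⇒≡[] : ∀ {a b k} → val a ≡ val b → a ≡ b [ k ]
  ≡⇒≡[] {k = k} eq = cong-by (int 0ℤ) (trans eq (lem _ (P k)))
    where lem : ∀ b P → b ≡ b ℚ.+ P ℚ.* 0ℚ
          lem = solve-∀ ℚ-ring

  []-refl : ∀ {a k} → a ≡ a [ k ]
  []-refl = ≡⇒≡[] refl

  []-sym : ∀ {a b k} → a ≡ b [ k ] → b ≡ a [ k ]
  []-sym {a} {b} {k} (cong-by t eq) = cong-by (⊟ t)
    (trans (lem (val b) (P k) (val t)) (cong (ℚ._+ P k ℚ.* ℚ.- val t) (sym eq)))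
    where lem : ∀ b P t → b ≡ b ℚ.+ P ℚ.* t ℚ.+ P ℚ.* ℚ.- t
          lem = solve-∀ ℚ-ring

  []-trans : ∀ {a b c k} → a ≡ b [ k ] → b ≡ c [ k ] → a ≡ c [ k ]
  []-trans {a} {b} {c} {k} (cong-by t eq) (cong-by s eq′) = cong-by (s ⊞ t)
    (trans eq (trans (cong (ℚ._+ P k ℚ.* val t) eq′) (lem (val c) (P k) (val s) (val t))))
    where lem : ∀ c P s t → c ℚ.+ P ℚ.* s ℚ.+ P ℚ.* t ≡ c ℚ.+ P ℚ.* (s ℚ.+ t)
          lem = solve-∀ ℚ-ring

  ⊞-cong : ∀ {a b c d k} → a ≡ b [ k ] → c ≡ d [ k ] → a ⊞ c ≡ b ⊞ d [ k ]
  ⊞-cong {a} {b} {c} {d} {k} (cong-by t eq) (cong-by s eq′) = cong-by (t ⊞ s)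
    (trans (cong₂ ℚ._+_ eq eq′) (lem (val b) (val d) (P k) (val t) (val s)))
    where lem : ∀ b d P t s → b ℚ.+ P ℚ.* t ℚ.+ (d ℚ.+ P ℚ.* s) ≡ b ℚ.+ d ℚ.+ P ℚ.* (t ℚ.+ s)
          lem = solve-∀ ℚ-ring

  ⊠-cong : ∀ {a b c d k} → a ≡ b [ k ] → c ≡ d [ k ] → a ⊠ c ≡ b ⊠ d [ k ]
  ⊠-cong {a} {b} {c} {d} {k} (cong-by t eq) (cong-by s eq′) = cong-by (t ⊠ c ⊞ b ⊠ s)
    (trans (cong (ℚ._* val c) eq)
      (trans (lem (val b) (val c) (P k) (val t))
        (trans (cong (λ z → val b ℚ.* z ℚ.+ P k ℚ.* (val t ℚ.* val c)) eq′)
          (lem′ (val b) (val c) (val d) (P k) (val t) (val s)))))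
    where
    lem : ∀ b c P t → (b ℚ.+ P ℚ.* t) ℚ.* c ≡ b ℚ.* c ℚ.+ P ℚ.* (t ℚ.* c)
    lem = solve-∀ ℚ-ring
    lem′ : ∀ b c d P t s → b ℚ.* (d ℚ.+ P ℚ.* s) ℚ.+ P ℚ.* (t ℚ.* c)
                         ≡ b ℚ.* d ℚ.+ P ℚ.* (t ℚ.* c ℚ.+ b ℚ.* s)
    lem′ = solve-∀ ℚ-ring

  ⊟-cong : ∀ {a b k} → a ≡ b [ k ] → ⊟ a ≡ ⊟ b [ k ]
  ⊟-cong {a} {b} {k} (cong-by t eq) = cong-by (⊟ t)
    (trans (cong ℚ.-_ eq) (lem (val b) (P k) (val t)))
    where lem : ∀ b P t → ℚ.- (b ℚ.+ P ℚ.* t) ≡ ℚ.- b ℚ.+ P ℚ.* ℚ.- t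
          lem = solve-∀ ℚ-ring

  []-weaken : ∀ {a b} j {k} → a ≡ b [ j ℕ.+ k ] → a ≡ b [ j ]
  []-weaken {a} {b} j {k} (cong-by t eq) = cong-by (int (+ (p ℕ.^ k)) ⊠ t)
    (trans eq (cong (val b ℚ.+_) (trans (cong (ℚ._* val t) (P-+ j k)) (ℚ.*-assoc (P j) (P k) (val t)))))

  infix 4 _≢0
  𝟎 𝟏 : ℤ₍ₚ₎
  𝟎 = int 0ℤ
  𝟏 = int 1ℤ

  -- Clearing denominators in `a = pᵏ t` leaves an equation of integers in which the denominator of
  -- `t` is prime to `p` and can be cancelled.
  ∣numerator : ∀ {a k} → a ≡ 𝟎 [ k ] → p ℕ.^ k ℕ.∣ ∣ ↥ (val a) ∣
  ∣numerator {a} {k} (cong-by t eq) = prime-power-cancelʳ k (integral t)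
    (subst (p ℕ.^ k ℕ.∣_) (trans (sym (ℤ.abs-* (+ (p ℕ.^ k) ℤ.* ↥ val t) (↧ val a)))
       (trans (cong ∣_∣ cross)
         (trans (ℤ.abs-* (↥ val a) (1ℤ ℤ.* ↧ val t)) (cong (λ z → ∣ ↥ val a ∣ ℕ.* ∣ z ∣) (ℤ.*-identityˡ (↧ val t))))))
       (ℕ.∣m⇒∣m*n (↧ₙ val a) (subst (p ℕ.^ k ℕ.∣_) (sym (ℤ.abs-* (+ (p ℕ.^ k)) (↥ val t)))
          (ℕ.m∣m*n ∣ ↥ val t ∣))))
    where
    cross : + (p ℕ.^ k) ℤ.* ↥ val t ℤ.* ↧ val a ≡ ↥ val a ℤ.* (1ℤ ℤ.* ↧ val t)
    cross = *-cross {P k} {val t} {val a} (sym (trans eq (ℚ.+-identityˡ _)))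

  private
    divide-by-p : ∀ r → IsIntegral p r → p ℕ.∣ ∣ ↥ r ∣ → ∃[ t ] r ≡ P 1 ℚ.* val t
    divide-by-p (mkℚ n d-1 c) h p∣n with ℤ.∣ᵤ⇒∣ {+ p} {n} p∣n
    ... | ℤ.divides q refl = mkℚ q d-1 cop ⟨ h ⟩ ,
            sym (*-cross⁻¹ {P 1} {mkℚ q d-1 cop} {mkℚ (q ℤ.* + p) d-1 c}
              (trans (cong (λ z → + z ℤ.* q ℤ.* + suc d-1) (ℕ.^-identityʳ p)) (lem (+ p) q (+ suc d-1))))
      where
      cop : Coprimality.Coprime ∣ q ∣ (suc d-1)
      cop (i∣q , i∣d) = Coprimality.recompute c
        (ℕ.∣-trans i∣q (subst (∣ q ∣ ℕ.∣_) (sym (ℤ.abs-* q (+ p))) (ℕ.m∣m*n p)) , i∣d)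
      lem : ∀ p q d → p ℤ.* q ℤ.* d ≡ q ℤ.* p ℤ.* (1ℤ ℤ.* d)
      lem = ℤ-Solver.solve-∀

  numerator∣ : ∀ {a} → p ℕ.∣ ∣ ↥ (val a) ∣ → a ≡ 𝟎 [ 1 ]
  numerator∣ {a} p∣n with divide-by-p (val a) (integral a) p∣n
  ... | t , eq = cong-by t (trans eq (sym (ℚ.+-identityˡ (P 1 ℚ.* val t))))

  _≡0? : ∀ a → Dec (a ≡ 𝟎 [ 1 ])
  a ≡0? with p ℕ.∣? ∣ ↥ (val a) ∣
  ... | yes d = yes (numerator∣ d)
  ... | no ¬d = no λ h → ¬d (subst (ℕ._∣ ∣ ↥ (val a) ∣) (ℕ.^-identityʳ p) (∣numerator h))

  _≢0 : ℤ₍ₚ₎ → Set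
  a ≢0 = ¬ a ≡ 𝟎 [ 1 ]

  unit-inverse : ∀ a → a ≢0 → ∃[ u ] val u ℚ.* val a ≡ 1ℚ
  unit-inverse a a≢0 = invert (val a) (a≢0 ∘ numerator∣)
    where
    invert : ∀ r → ¬ p ℕ.∣ ∣ ↥ r ∣ → ∃[ u ] val u ℚ.* r ≡ 1ℚ
    invert   (mkℚ (+ zero)  d c) p∤r = contradiction (p ℕ.∣0) p∤r
    invert r@(mkℚ (+ suc n) d c) p∤r = ((ℚ.1/ r) ⟨ p∤r ⟩) , ℚ.*-inverseˡ r
    invert r@(mkℚ -[1+ n ]  d c) p∤r = ((ℚ.1/ r) ⟨ p∤r ⟩) , ℚ.*-inverseˡ r

  ⊠-cancelʳ : ∀ {a b c k} → c ≢0 → a ⊠ c ≡ b ⊠ c [ k ] → a ≡ b [ k ]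
  ⊠-cancelʳ {a} {b} {c} {k} c≢0 h with unit-inverse c c≢0
  ... | u , uc≡1 = []-trans (≡⇒≡[] (lem a)) ([]-trans (⊠-cong h ([]-refl {u})) (≡⇒≡[] (sym (lem b))))
    where
    assoc : ∀ a c u → a ℚ.* (u ℚ.* c) ≡ a ℚ.* c ℚ.* u
    assoc = solve-∀ ℚ-ring
    lem : ∀ a → val a ≡ val (a ⊠ c ⊠ u)
    lem a = trans (sym (ℚ.*-identityʳ (val a)))
              (trans (cong (val a ℚ.*_) (sym uc≡1)) (assoc (val a) (val c) (val u)))

  ≡0-product : ∀ {a b} → a ⊠ b ≡ 𝟎 [ 1 ] → b ≢0 → a ≡ 𝟎 [ 1 ]
  ≡0-product {a} {b} h b≢0 = ⊠-cancelʳ b≢0 ([]-trans h (≡⇒≡[] (sym (ℚ.*-zeroˡ (val b)))))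

  𝟏≢0 : 𝟏 ≢0
  𝟏≢0 h = p∤1 (subst (ℕ._∣ 1) (ℕ.^-identityʳ p) (∣numerator h))

  open ResidueField p-prime using (inverse-mod)
  open Mod p-prime using (reduce)

  ≡[]-fromℤ : ∀ {x y k} → + (p ℕ.^ k) ℤ.∣ x ℤ.- y → int x ≡ int y [ k ]
  ≡[]-fromℤ {x} {y} {k} (ℤ.divides q eq) = cong-by (int q)
    (trans (cong ι (trans (lem x y) (cong (λ z → y ℤ.+ z) (trans eq (ℤ.*-comm q _)))))
      (trans (ι-+ y _) (cong (ι y ℚ.+_) (ι-* (+ (p ℕ.^ k)) q))))
    where lem : ∀ x y → x ≡ y ℤ.+ (x ℤ.- y)
          lem = ℤ-Solver.solve-∀

  ≡[]-toℤ : ∀ {x y k} → int x ≡ int y [ k ] → + (p ℕ.^ k) ℤ.∣ x ℤ.- y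
  ≡[]-toℤ {x} {y} {k} h = ℤ.∣ᵤ⇒∣ (∣numerator {int (x ℤ.- y)} ([]-trans (≡⇒≡[] (trans (ι-+ x (ℤ.- y)) (cong (ι x ℚ.+_) (ι-neg y))))
     ([]-trans (⊞-cong h ([]-refl {⊟ int y})) (≡⇒≡[] (ℚ.+-inverseʳ (ι y))))))

  -- `reduce` multiplies the numerator by an inverse `y` of the denominator modulo `p`, and
  -- `r * ι (y * ↧ r)` is exactly `ι (↥ r * y)`. So the claim is `y * ↧ r ≡ 1` multiplied by `r`.
  reduce-≡ : ∀ a (h : IsIntegral p (val a)) → int (reduce (val a) h) ≡ a [ 1 ]
  reduce-≡ a h with inverse-mod (↧ val a) (h ∘ ℤ.∣⇒∣ᵤ)
  ... | y , yd≈1 = []-sym ([]-trans (≡⇒≡[] (sym (ℚ.*-identityʳ r)))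
    ([]-trans (⊠-cong ([]-refl {a}) ([]-sym (≡[]-fromℤ {k = 1}
        (subst (λ z → + z ℤ.∣ y ℤ.* ↧ r ℤ.- 1ℤ) (sym (ℕ.^-identityʳ p)) yd≈1))))
      (≡⇒≡[] (*-cross⁻¹ {r} {ι (y ℤ.* ↧ r)} {ι (↥ r ℤ.* y)} (lem (↥ r) y (↧ r))))))
    where
    r : ℚ
    r = val a
    lem : ∀ n y d → n ℤ.* (y ℤ.* d) ℤ.* 1ℤ ≡ n ℤ.* y ℤ.* (d ℤ.* 1ℤ)
    lem = ℤ-Solver.solve-∀

-- Eventual periodicity of deterministic processes.

module _ {_∼_ : ℕ → ℕ → Set} (∼-refl : ∀ {n} → n ∼ n)
         (∼-trans : ∀ {l m n} → l ∼ m → m ∼ n → l ∼ n) where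

  -- The relation is left abstract since the iteration is applied to windows of residues, to divided
  -- differences and to values modulo a power of `p`.
  iterate-period : ∀ {N T} → (∀ n → N ℕ.≤ n → (n ℕ.+ T) ∼ n) →
                   ∀ j n → N ℕ.≤ n → (n ℕ.+ j ℕ.* T) ∼ n
  iterate-period h zero n N≤n = subst (_∼ n) (sym (ℕ.+-identityʳ n)) ∼-refl
  iterate-period {T = T} h (suc j) n N≤n = ∼-trans
    (subst (_∼ (n ℕ.+ j ℕ.* T)) (lem n T (j ℕ.* T)) (h (n ℕ.+ j ℕ.* T) (ℕ.≤-trans N≤n (ℕ.m≤m+n n _))))
    (iterate-period h j n N≤n)
    where lem : ∀ n T s → n ℕ.+ s ℕ.+ T ≡ n ℕ.+ (T ℕ.+ s)
          lem = ℕ-Solver.solve-∀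

  -- By the pigeonhole principle a deterministic process with X states has a
  -- period d ≤ X, and d divides X !.
  deterministic⇒periodic : ∀ {X} (state : ℕ → Fin X) →
    (∀ {m n} → state m ≡ state n → m ∼ n) → (∀ {m n} → m ∼ n → suc m ∼ suc n) →
    (∀ {m n} → m ∼ n → n ∼ m) →
    ∀ n → X ℕ.≤ n → (n ℕ.+ X !) ∼ n
  deterministic⇒periodic {X} state sound step ∼-sym n X≤n
    with Fin.pigeonhole (ℕ.n<1+n X) (state ∘ toℕ)
  ... | i , j , i<j , eq
    with ℕ.m≤n⇒∃[o]m+o≡n i<j
  ... | e , si+e≡j = subst (λ t → (n ℕ.+ t) ∼ n) (sym (ℕ._∣_.equality d∣X!))
      (iterate-period {toℕ i} {suc e} period (ℕ._∣_.quotient d∣X!) n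
        (ℕ.≤-trans (ℕ.<⇒≤ i<X) X≤n))
    where
    i+d≡j : toℕ i ℕ.+ suc e ≡ toℕ j
    i+d≡j = trans (ℕ.+-suc (toℕ i) e) si+e≡j
    j≤X : toℕ j ℕ.≤ X
    j≤X = ℕ.≤-pred (Fin.toℕ<n j)
    i<X : toℕ i ℕ.< X
    i<X = ℕ.<-≤-trans i<j j≤X
    d∣X! : suc e ℕ.∣ X !
    d∣X! = ℕ.∣-trans (ℕ.m∣m*n (e !))
      (ℕ.m≤n⇒m!∣n! (ℕ.≤-trans (ℕ.m≤n+m (suc e) (toℕ i)) (ℕ.≤-trans (ℕ.≤-reflexive i+d≡j) j≤X)))
    shift : ∀ s → (s ℕ.+ toℕ j) ∼ (s ℕ.+ toℕ i)
    shift zero    = ∼-sym (sound eq)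
    shift (suc s) = step (shift s)
    period : ∀ m → toℕ i ℕ.≤ m → (m ℕ.+ suc e) ∼ m
    period m i≤m = subst₂ _∼_
      (trans (cong (m ℕ.∸ toℕ i ℕ.+_) (sym i+d≡j))
        (trans (sym (ℕ.+-assoc (m ℕ.∸ toℕ i) (toℕ i) (suc e))) (cong (ℕ._+ suc e) (ℕ.m∸n+n≡m i≤m))))
      (ℕ.m∸n+n≡m i≤m) (shift (m ℕ.∸ toℕ i))

-- Eventual periods of Somos sequences modulo powers of p.

module Dynamics {p : ℕ} (p-prime : Prime p) where
  open Localisation p-prime
  open Mod p-prime using (reduce)

  private instance
    p≢0 = prime⇒nonZero p-prime

  -- `reduce` yields an unbounded integer representative; its remainder is one of finitely many
  -- states.
  residueClass : ℤ₍ₚ₎ → Fin p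
  residueClass a = fromℕ< (ℤ.n%ℕd<d (reduce (val a) (integral a)) p)

  residueClass-sound : ∀ {a b} → residueClass a ≡ residueClass b → a ≡ b [ 1 ]
  residueClass-sound {a} {b} eq = []-trans ([]-sym (reduce-≡ a (integral a)))
    ([]-trans (≡[]-fromℤ (subst (λ q → + q ℤ.∣ x ℤ.- y) (sym (ℕ.^-identityʳ p))
        (ℤ.divides (x ℤ./ℕ p ℤ.- y ℤ./ℕ p) x-y)))
      (reduce-≡ b (integral b)))
    where
    x y : ℤ
    x = reduce (val a) (integral a)
    y = reduce (val b) (integral b)
    lem : ∀ r u v p → r ℤ.+ u ℤ.* p ℤ.- (r ℤ.+ v ℤ.* p) ≡ (u ℤ.- v) ℤ.* p
    lem = ℤ-Solver.solve-∀
    x%p≡y%p : x ℤ.%ℕ p ≡ y ℤ.%ℕ p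
    x%p≡y%p = trans (sym (Fin.toℕ-fromℕ< (ℤ.n%ℕd<d x p)))
      (trans (cong toℕ eq) (Fin.toℕ-fromℕ< (ℤ.n%ℕd<d y p)))
    x-y : x ℤ.- y ≡ (x ℤ./ℕ p ℤ.- y ℤ./ℕ p) ℤ.* + p
    x-y = trans (cong₂ ℤ._-_ (ℤ.a≡a%ℕn+[a/ℕn]*n x p)
            (trans (ℤ.a≡a%ℕn+[a/ℕn]*n y p) (cong (λ r → + r ℤ.+ y ℤ./ℕ p ℤ.* + p) (sym x%p≡y%p))))
          (lem (+ (x ℤ.%ℕ p)) (x ℤ./ℕ p) (y ℤ./ℕ p) (+ p))

  Window : (ℕ → ℤ₍ₚ₎) → ℕ → ℕ → Set
  Window x m n = x m ≡ x n [ 1 ] × x (1 ℕ.+ m) ≡ x (1 ℕ.+ n) [ 1 ] × x (2 ℕ.+ m) ≡ x (2 ℕ.+ n) [ 1 ] ×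
                 x (3 ℕ.+ m) ≡ x (3 ℕ.+ n) [ 1 ] × x (4 ℕ.+ m) ≡ x (4 ℕ.+ n) [ 1 ]

  Window-refl : ∀ {x m} → Window x m m
  Window-refl = []-refl , []-refl , []-refl , []-refl , []-refl

  Window-sym : ∀ {x m n} → Window x m n → Window x n m
  Window-sym (h₀ , h₁ , h₂ , h₃ , h₄) = []-sym h₀ , []-sym h₁ , []-sym h₂ , []-sym h₃ , []-sym h₄

  Window-trans : ∀ {x l m n} → Window x l m → Window x m n → Window x l n
  Window-trans (h₀ , h₁ , h₂ , h₃ , h₄) (k₀ , k₁ , k₂ , k₃ , k₄) =
    []-trans h₀ k₀ , []-trans h₁ k₁ , []-trans h₂ k₂ , []-trans h₃ k₃ , []-trans h₄ k₄

  windowClass : (ℕ → ℤ₍ₚ₎) → ℕ → Fin (p ℕ.^ 5)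
  windowClass x n = funToFin {5} λ i → residueClass (x (toℕ i ℕ.+ n))

  windowClass-sound : ∀ {x m n} → windowClass x m ≡ windowClass x n → Window x m n
  windowClass-sound {x} {m} {n} eq = at 0F , at 1F , at 2F , at 3F , at 4F
    where
    classes : ℕ → Fin 5 → Fin p
    classes n i = residueClass (x (toℕ i ℕ.+ n))
    at : (i : Fin 5) → x (toℕ i ℕ.+ m) ≡ x (toℕ i ℕ.+ n) [ 1 ]
    at i = residueClass-sound (trans (sym (Fin.finToFun-funToFin (classes m) i))
      (trans (cong (λ c → finToFun {p} {5} c i) eq) (Fin.finToFun-funToFin (classes n) i)))

  -- The common shape of the right-hand sides of Somos 4, where `v = w`, and Somos 5.
  bilinear : (a b z u v w : ℤ₍ₚ₎) → ℤ₍ₚ₎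
  bilinear a b z u v w = a ⊠ (z ⊠ u) ⊞ b ⊠ (v ⊠ w)

  -- With both relations available, `units` always leaves an invertible divisor for computing the
  -- next term. The relations compare values only, because elements of `ℤ₍ₚ₎` also carry integrality
  -- proofs.
  record IsSomos (x : ℕ → ℤ₍ₚ₎) (a b c d : ℤ₍ₚ₎) : Set where
    field
      somos₄ : ∀ n → val (x (4 ℕ.+ n) ⊠ x n) ≡
        val (bilinear a b (x (3 ℕ.+ n)) (x (1 ℕ.+ n)) (x (2 ℕ.+ n)) (x (2 ℕ.+ n)))
      somos₅ : ∀ n → val (x (5 ℕ.+ n) ⊠ x n) ≡
        val (bilinear c d (x (4 ℕ.+ n)) (x (1 ℕ.+ n)) (x (3 ℕ.+ n)) (x (2 ℕ.+ n)))
      units  : ∀ n → x n ≢0 ⊎ x (1 ℕ.+ n) ≢0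

  shift : ∀ {x a b c d} s → IsSomos x a b c d → IsSomos (λ n → x (n ℕ.+ s)) a b c d
  shift s S = record { somos₄ = λ n → somos₄ (n ℕ.+ s) ; somos₅ = λ n → somos₅ (n ℕ.+ s)
                     ; units = λ n → units (n ℕ.+ s) }
    where open IsSomos S

  bilinear-cong : ∀ {a b z u v w z′ u′ v′ w′} →
    z ≡ z′ [ 1 ] → u ≡ u′ [ 1 ] → v ≡ v′ [ 1 ] → w ≡ w′ [ 1 ] →
    bilinear a b z u v w ≡ bilinear a b z′ u′ v′ w′ [ 1 ]
  bilinear-cong hz hu hv hw =
    ⊞-cong (⊠-cong []-refl (⊠-cong hz hu)) (⊠-cong []-refl (⊠-cong hv hw))

  divide-cong : ∀ {x x′ y y′ r r′} → y ≢0 → y ≡ y′ [ 1 ] → r ≡ r′ [ 1 ] →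
    x ⊠ y ≡ r [ 1 ] → x′ ⊠ y′ ≡ r′ [ 1 ] → x ≡ x′ [ 1 ]
  divide-cong y≢0 hy hr h h′ = ⊠-cancelʳ y≢0
    ([]-trans h ([]-trans hr ([]-trans ([]-sym h′) (⊠-cong []-refl ([]-sym hy)))))

  -- The derivative of the relation x y = a z u + b v w.
  tangent : (a b x z u v w y˙ z˙ u˙ v˙ w˙ : ℤ₍ₚ₎) → ℤ₍ₚ₎
  tangent a b x z u v w y˙ z˙ u˙ v˙ w˙ =
    a ⊠ (z˙ ⊠ u ⊞ z ⊠ u˙) ⊞ b ⊠ (v˙ ⊠ w ⊞ v ⊠ w˙) ⊞ ⊟ (x ⊠ y˙)

  tangent-cong : ∀ {a b x z u v w y˙ z˙ u˙ v˙ w˙ x′ z′ u′ v′ w′ y˙′ z˙′ u˙′ v˙′ w˙′} →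
    x ≡ x′ [ 1 ] → z ≡ z′ [ 1 ] → u ≡ u′ [ 1 ] → v ≡ v′ [ 1 ] → w ≡ w′ [ 1 ] →
    y˙ ≡ y˙′ [ 1 ] → z˙ ≡ z˙′ [ 1 ] → u˙ ≡ u˙′ [ 1 ] → v˙ ≡ v˙′ [ 1 ] → w˙ ≡ w˙′ [ 1 ] →
    tangent a b x z u v w y˙ z˙ u˙ v˙ w˙ ≡ tangent a b x′ z′ u′ v′ w′ y˙′ z˙′ u˙′ v˙′ w˙′ [ 1 ]
  tangent-cong x z u v w y˙ z˙ u˙ v˙ w˙ =
    ⊞-cong (⊞-cong (⊠-cong []-refl (⊞-cong (⊠-cong z˙ u) (⊠-cong z u˙)))
                   (⊠-cong []-refl (⊞-cong (⊠-cong v˙ w) (⊠-cong v w˙))))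
           (⊟-cong (⊠-cong x y˙))

  P-inverse : ∀ k → ∃[ Q ] Q ℚ.* P k ≡ 1ℚ
  P-inverse k with p ℕ.^ k | ℕ.m^n≢0 p k
  ... | suc n | _ = ℚ.1/ ι (+ suc n) , ℚ.*-inverseˡ (ι (+ suc n))

  P-cancelˡ : ∀ k r s → P k ℚ.* r ≡ P k ℚ.* s → r ≡ s
  P-cancelˡ k r s eq with P-inverse k
  ... | Q , QP≡1 = trans (expand r) (trans (cong (Q ℚ.*_) eq) (sym (expand s)))
    where
    expand : ∀ r → r ≡ Q ℚ.* (P k ℚ.* r)
    expand r = trans (sym (ℚ.*-identityˡ r)) (trans (cong (ℚ._* r) (sym QP≡1)) (ℚ.*-assoc Q (P k) r))

  private
    -- Subtracting the unperturbed relation and dividing by `P` leaves the derivative together with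
    -- `P` times the quadratic part in the increments.
    tangent-ℚ : ∀ {P} → (∀ r s → P ℚ.* r ≡ P ℚ.* s → r ≡ s) →
      ∀ {a b x y z u v w} x˙ y˙ z˙ u˙ v˙ w˙ →
      x ℚ.* y ≡ a ℚ.* (z ℚ.* u) ℚ.+ b ℚ.* (v ℚ.* w) →
      (x ℚ.+ P ℚ.* x˙) ℚ.* (y ℚ.+ P ℚ.* y˙) ≡
        a ℚ.* ((z ℚ.+ P ℚ.* z˙) ℚ.* (u ℚ.+ P ℚ.* u˙)) ℚ.+ b ℚ.* ((v ℚ.+ P ℚ.* v˙) ℚ.* (w ℚ.+ P ℚ.* w˙)) →
      x˙ ℚ.* y ≡
        a ℚ.* (z˙ ℚ.* u ℚ.+ z ℚ.* u˙) ℚ.+ b ℚ.* (v˙ ℚ.* w ℚ.+ v ℚ.* w˙) ℚ.+ ℚ.- (x ℚ.* y˙)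
        ℚ.+ P ℚ.* (a ℚ.* (z˙ ℚ.* u˙) ℚ.+ b ℚ.* (v˙ ℚ.* w˙) ℚ.+ ℚ.- (x˙ ℚ.* y˙))
    tangent-ℚ {P} P-cancelˡ {a} {b} {x} {y} {z} {u} {v} {w} x˙ y˙ z˙ u˙ v˙ w˙ eq eq⁺ =
      P-cancelˡ _ _ (∙-cancelˡ (x ℚ.* y) _ _ (begin
        x ℚ.* y ℚ.+ P ℚ.* (x˙ ℚ.* y)
          ≡⟨ lhs P x y x˙ y˙ ⟩
        (x ℚ.+ P ℚ.* x˙) ℚ.* (y ℚ.+ P ℚ.* y˙) ℚ.+ ℚ.- (P ℚ.* (x ℚ.* y˙ ℚ.+ P ℚ.* (x˙ ℚ.* y˙)))
          ≡⟨ cong (ℚ._+ ℚ.- (P ℚ.* (x ℚ.* y˙ ℚ.+ P ℚ.* (x˙ ℚ.* y˙)))) eq⁺ ⟩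
        a ℚ.* ((z ℚ.+ P ℚ.* z˙) ℚ.* (u ℚ.+ P ℚ.* u˙)) ℚ.+ b ℚ.* ((v ℚ.+ P ℚ.* v˙) ℚ.* (w ℚ.+ P ℚ.* w˙))
          ℚ.+ ℚ.- (P ℚ.* (x ℚ.* y˙ ℚ.+ P ℚ.* (x˙ ℚ.* y˙)))
          ≡⟨ rhs P a b x z u v w x˙ y˙ z˙ u˙ v˙ w˙ ⟩
        a ℚ.* (z ℚ.* u) ℚ.+ b ℚ.* (v ℚ.* w) ℚ.+ P ℚ.* r
          ≡⟨ cong (ℚ._+ P ℚ.* r) eq ⟨
        x ℚ.* y ℚ.+ P ℚ.* r ∎))
      where
      open ≡-Reasoning
      r : ℚ
      r = a ℚ.* (z˙ ℚ.* u ℚ.+ z ℚ.* u˙) ℚ.+ b ℚ.* (v˙ ℚ.* w ℚ.+ v ℚ.* w˙) ℚ.+ ℚ.- (x ℚ.* y˙)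
        ℚ.+ P ℚ.* (a ℚ.* (z˙ ℚ.* u˙) ℚ.+ b ℚ.* (v˙ ℚ.* w˙) ℚ.+ ℚ.- (x˙ ℚ.* y˙))
      lhs : ∀ P x y x˙ y˙ → x ℚ.* y ℚ.+ P ℚ.* (x˙ ℚ.* y) ≡
        (x ℚ.+ P ℚ.* x˙) ℚ.* (y ℚ.+ P ℚ.* y˙) ℚ.+ ℚ.- (P ℚ.* (x ℚ.* y˙ ℚ.+ P ℚ.* (x˙ ℚ.* y˙)))
      lhs = solve-∀ ℚ-ring
      rhs : ∀ P a b x z u v w x˙ y˙ z˙ u˙ v˙ w˙ →
        a ℚ.* ((z ℚ.+ P ℚ.* z˙) ℚ.* (u ℚ.+ P ℚ.* u˙)) ℚ.+ b ℚ.* ((v ℚ.+ P ℚ.* v˙) ℚ.* (w ℚ.+ P ℚ.* w˙))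
          ℚ.+ ℚ.- (P ℚ.* (x ℚ.* y˙ ℚ.+ P ℚ.* (x˙ ℚ.* y˙))) ≡
        a ℚ.* (z ℚ.* u) ℚ.+ b ℚ.* (v ℚ.* w) ℚ.+ P ℚ.*
          (a ℚ.* (z˙ ℚ.* u ℚ.+ z ℚ.* u˙) ℚ.+ b ℚ.* (v˙ ℚ.* w ℚ.+ v ℚ.* w˙) ℚ.+ ℚ.- (x ℚ.* y˙)
           ℚ.+ P ℚ.* (a ℚ.* (z˙ ℚ.* u˙) ℚ.+ b ℚ.* (v˙ ℚ.* w˙) ℚ.+ ℚ.- (x˙ ℚ.* y˙)))
      rhs = solve-∀ ℚ-ring

  -- The quadratic part carries the factor `p ^ suc k` and so vanishes modulo `p`; this is why the
  -- starting modulus is at least `p`.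
  tangent-relation : ∀ k {a b x y z u v w x⁺ y⁺ z⁺ u⁺ v⁺ w⁺} →
    val (x ⊠ y) ≡ val (bilinear a b z u v w) → val (x⁺ ⊠ y⁺) ≡ val (bilinear a b z⁺ u⁺ v⁺ w⁺) →
    (hx : x⁺ ≡ x [ suc k ]) (hy : y⁺ ≡ y [ suc k ]) (hz : z⁺ ≡ z [ suc k ])
    (hu : u⁺ ≡ u [ suc k ]) (hv : v⁺ ≡ v [ suc k ]) (hw : w⁺ ≡ w [ suc k ]) →
    quotient hx ⊠ y ≡ tangent a b x z u v w (quotient hy) (quotient hz) (quotient hu)
                        (quotient hv) (quotient hw) [ 1 ]
  tangent-relation k {a} {b} {x} {y} {z} {u} {v} {w} eq eq⁺ hx hy hz hu hv hw =
    []-weaken 1 {k} (cong-by (bilinear a b (t hz) (t hu) (t hv) (t hw) ⊞ ⊟ (t hx ⊠ t hy))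
      (tangent-ℚ {P (suc k)} (P-cancelˡ (suc k)) {val a} {val b} {val x} {val y} {val z} {val u} {val v} {val w}
        (val (t hx)) (val (t hy)) (val (t hz)) (val (t hu)) (val (t hv)) (val (t hw)) eq
        (trans (sym (cong₂ ℚ._*_ (equation hx) (equation hy)))
          (trans eq⁺ (cong₂ ℚ._+_ (cong (val a ℚ.*_) (cong₂ ℚ._*_ (equation hz) (equation hu)))
                                  (cong (val b ℚ.*_) (cong₂ ℚ._*_ (equation hv) (equation hw))))))))
    where
    t : ∀ {a b} → a ≡ b [ suc k ] → ℤ₍ₚ₎
    t = quotient

  module _ {x : ℕ → ℤ₍ₚ₎} {a b c d : ℤ₍ₚ₎} (S : IsSomos x a b c d) where
    open IsSomos S

    -- Somos 5 at `m` and Somos 4 at `1 + m` both produce the term of index `5 + m`, with divisors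
    -- `x m` and `x (1 + m)`. By `units` one of these is invertible modulo `p`.
    next-determined : ∀ {m n} → Window x m n → x (5 ℕ.+ m) ≡ x (5 ℕ.+ n) [ 1 ]
    next-determined {m} {n} (h₀ , h₁ , h₂ , h₃ , h₄) with units m
    ... | inj₁ u₀ = divide-cong u₀ h₀ (bilinear-cong {c} {d} h₄ h₁ h₃ h₂) (≡⇒≡[] (somos₅ m)) (≡⇒≡[] (somos₅ n))
    ... | inj₂ u₁ = divide-cong u₁ h₁ (bilinear-cong {a} {b} h₄ h₂ h₃ h₃) (≡⇒≡[] (somos₄ (suc m))) (≡⇒≡[] (somos₄ (suc n)))

    -- Two solutions congruent modulo pᵏ, k ≥ 1: modulo p the difference divided
    -- by pᵏ obeys the linearised recurrence.
    module _ {y : ℕ → ℤ₍ₚ₎} (S′ : IsSomos y a b c d) {k} (h : ∀ n → y n ≡ x n [ suc k ]) where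
      private
        module S′ = IsSomos S′
        w : ℕ → ℤ₍ₚ₎
        w n = quotient (h n)

      tangent-determined : ∀ {m n} → Window x m n → Window w m n → w (5 ℕ.+ m) ≡ w (5 ℕ.+ n) [ 1 ]
      tangent-determined {m} {n} H@(h₀ , h₁ , h₂ , h₃ , h₄) (k₀ , k₁ , k₂ , k₃ , k₄) with units m
      ... | inj₁ u₀ = divide-cong u₀ h₀
        (tangent-cong (next-determined H) h₄ h₁ h₃ h₂ k₀ k₄ k₁ k₃ k₂) (rel m) (rel n)
        where
        rel : ∀ n → w (5 ℕ.+ n) ⊠ x n ≡ tangent c d (x (5 ℕ.+ n)) (x (4 ℕ.+ n)) (x (1 ℕ.+ n)) (x (3 ℕ.+ n)) (x (2 ℕ.+ n))
                          (w n) (w (4 ℕ.+ n)) (w (1 ℕ.+ n)) (w (3 ℕ.+ n)) (w (2 ℕ.+ n)) [ 1 ]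
        rel n = tangent-relation k (somos₅ n) (S′.somos₅ n)
          (h (5 ℕ.+ n)) (h n) (h (4 ℕ.+ n)) (h (1 ℕ.+ n)) (h (3 ℕ.+ n)) (h (2 ℕ.+ n))
      ... | inj₂ u₁ = divide-cong u₁ h₁
        (tangent-cong (next-determined H) h₄ h₂ h₃ h₃ k₁ k₄ k₂ k₃ k₃) (rel m) (rel n)
        where
        rel : ∀ n → w (5 ℕ.+ n) ⊠ x (1 ℕ.+ n) ≡ tangent a b (x (5 ℕ.+ n)) (x (4 ℕ.+ n)) (x (2 ℕ.+ n)) (x (3 ℕ.+ n)) (x (3 ℕ.+ n))
                          (w (1 ℕ.+ n)) (w (4 ℕ.+ n)) (w (2 ℕ.+ n)) (w (3 ℕ.+ n)) (w (3 ℕ.+ n)) [ 1 ]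
        rel n = tangent-relation k (somos₄ (suc n)) (S′.somos₄ (suc n))
          (h (5 ℕ.+ n)) (h (1 ℕ.+ n)) (h (4 ℕ.+ n)) (h (2 ℕ.+ n)) (h (3 ℕ.+ n)) (h (3 ℕ.+ n))

  -- A joint state consists of five residues of the sequence and five of its divided differences.
  -- The count depends on `p` alone, so `states !` can serve every sequence and every modulus.
  states : ℕ
  states = p ℕ.^ 5 ℕ.* p ℕ.^ 5

  joint-period : ∀ (x w : ℕ → ℤ₍ₚ₎) →
    (∀ {m n} → Window x m n × Window w m n → x (5 ℕ.+ m) ≡ x (5 ℕ.+ n) [ 1 ]) →
    (∀ {m n} → Window x m n × Window w m n → w (5 ℕ.+ m) ≡ w (5 ℕ.+ n) [ 1 ]) →
    ∀ n → states ℕ.≤ n → Window x (n ℕ.+ states !) n × Window w (n ℕ.+ states !) n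
  joint-period x w hx hw = deterministic⇒periodic
    {λ m n → Window x m n × Window w m n}
    (Window-refl {x} , Window-refl {w})
    (λ (h , k) (h′ , k′) → Window-trans {x} h h′ , Window-trans {w} k k′)
    (λ n → combine (windowClass x n) (windowClass w n))
    (λ {m} {n} eq → windowClass-sound {x} (Fin.combine-injectiveˡ (windowClass x m) (windowClass w m) _ _ eq)
                  , windowClass-sound {w} (Fin.combine-injectiveʳ (windowClass x m) (windowClass w m) _ _ eq))
    (λ { hk@((_ , h₁ , h₂ , h₃ , h₄) , (_ , k₁ , k₂ , k₃ , k₄)) →
         (h₁ , h₂ , h₃ , h₄ , hx hk) , (k₁ , k₂ , k₃ , k₄ , hw hk) })
    (λ (h , k) → Window-sym {x} h , Window-sym {w} k)

  -- Taking the sequence itself as second component gives the same period `states !` that the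
  -- lifting step uses.
  period-mod-p : ∀ {x a b c d} → IsSomos x a b c d →
                 ∀ n → states ℕ.≤ n → x (n ℕ.+ states !) ≡ x n [ 1 ]
  period-mod-p {x} S n s≤n =
    proj₁ (proj₁ (joint-period x x (next-determined S ∘ proj₁) (next-determined S ∘ proj₁) n s≤n))

  scaled-cong : ∀ k {j t t′} → t ≡ t′ [ j ] → int (+ (p ℕ.^ k)) ⊠ t ≡ int (+ (p ℕ.^ k)) ⊠ t′ [ j ℕ.+ k ]
  scaled-cong k {j} {t} {t′} (cong-by s eq) = cong-by s
    (trans (cong (P k ℚ.*_) eq) (trans (lem (P k) (val t′) (P j) (val s))
      (cong (λ z → P k ℚ.* val t′ ℚ.+ z ℚ.* val s) (sym (P-+ j k)))))
    where lem : ∀ P t Q s → P ℚ.* (t ℚ.+ Q ℚ.* s) ≡ P ℚ.* t ℚ.+ Q ℚ.* P ℚ.* s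
          lem = solve-∀ ℚ-ring

  -- After p shifts by T the difference is a sum of p terms congruent modulo
  -- pᵏ⁺¹ and divisible by pᵏ.
  period-lift : ∀ k {x a b c d e} → IsSomos x a b c d → let T = e ℕ.* states ! in
    (∀ n → x (n ℕ.+ T) ≡ x n [ suc k ]) →
    ∀ n → states ℕ.≤ n → x (n ℕ.+ p ℕ.* T) ≡ x n [ 2 ℕ.+ k ]
  period-lift k {x} {e = e} S h n s≤n =
    []-trans (multiple p) ([]-trans (⊞-cong []-refl p-terms) (≡⇒≡[] (ℚ.+-identityʳ (val (x n)))))
    where
    T : ℕ
    T = e ℕ.* states !
    w : ℕ → ℤ₍ₚ₎
    w m = quotient (h m)
    w-period : ∀ j → w (n ℕ.+ j ℕ.* T) ≡ w n [ 1 ]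
    w-period j = subst (λ t → w (n ℕ.+ t) ≡ w n [ 1 ]) (ℕ.*-assoc j e (states !))
      (iterate-period {λ m n → w m ≡ w n [ 1 ]} []-refl []-trans
        -- The solution compared with `x` is its own shift by `T`, so the divided differences form
        -- the second component of the joint process.
        (λ m s≤m → proj₁ (proj₂ (joint-period x w (next-determined S ∘ proj₁)
           (λ (H , K) → tangent-determined S (shift T S) h H K) m s≤m)))
        (j ℕ.* e) n s≤n)
    term : ℤ₍ₚ₎
    term = int (+ (p ℕ.^ suc k)) ⊠ w n
    p-terms : int (+ p) ⊠ term ≡ 𝟎 [ 2 ℕ.+ k ]
    p-terms = cong-by (w n) (begin
      ι (+ p) ℚ.* (P (suc k) ℚ.* val (w n))     ≡⟨ ℚ.*-assoc (ι (+ p)) (P (suc k)) (val (w n)) ⟨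
      ι (+ p) ℚ.* P (suc k) ℚ.* val (w n)       ≡⟨ cong (ℚ._* val (w n)) (ι-* (+ p) (+ (p ℕ.^ suc k))) ⟨
      ι (+ p ℤ.* + (p ℕ.^ suc k)) ℚ.* val (w n) ≡⟨ cong (λ z → ι z ℚ.* val (w n)) (ℤ.pos-* p (p ℕ.^ suc k)) ⟨
      P (2 ℕ.+ k) ℚ.* val (w n)                 ≡⟨ ℚ.+-identityˡ _ ⟨
      0ℚ ℚ.+ P (2 ℕ.+ k) ℚ.* val (w n)          ∎)
      where open ≡-Reasoning
    multiple : ∀ j → x (n ℕ.+ j ℕ.* T) ≡ x n ⊞ int (+ j) ⊠ term [ 2 ℕ.+ k ]
    multiple zero = ≡⇒≡[] (trans (cong (val ∘ x) (ℕ.+-identityʳ n)) (lem (val (x n)) (val term)))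
      where lem : ∀ x t → x ≡ x ℚ.+ 0ℚ ℚ.* t
            lem = solve-∀ ℚ-ring
    multiple (suc j) = []-trans
      (≡⇒≡[] {b = x (n ℕ.+ j ℕ.* T) ⊞ int (+ (p ℕ.^ suc k)) ⊠ w (n ℕ.+ j ℕ.* T)}
        (trans (cong (val ∘ x) (lem n T (j ℕ.* T))) (equation (h (n ℕ.+ j ℕ.* T)))))
      ([]-trans (⊞-cong (multiple j) (scaled-cong (suc k) (w-period j)))
        (≡⇒≡[] (trans (lem′ (val (x n)) (ι (+ j)) (val term))
          (cong (λ z → val (x n) ℚ.+ z ℚ.* val term) (sym (ι-+ 1ℤ (+ j)))))))
      where
      lem : ∀ n T s → n ℕ.+ (T ℕ.+ s) ≡ n ℕ.+ s ℕ.+ T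
      lem = ℕ-Solver.solve-∀
      lem′ : ∀ x j t → x ℚ.+ j ℚ.* t ℚ.+ t ≡ x ℚ.+ (1ℚ ℚ.+ j) ℚ.* t
      lem′ = solve-∀ ℚ-ring

  -- `period-lift` wants a congruence valid at all indices, so it is applied to the sequence shifted
  -- past the previous threshold. Each lift then waits for another `states` terms until the divided
  -- differences become periodic.
  somos-period : ∀ k {x a b c d} → IsSomos x a b c d →
    ∀ n → suc k ℕ.* states ℕ.≤ n → x (n ℕ.+ p ℕ.^ k ℕ.* states !) ≡ x n [ suc k ]
  somos-period zero {x} S n s≤n = subst (λ t → x (n ℕ.+ t) ≡ x n [ 1 ]) (sym (ℕ.*-identityˡ (states !)))
    (period-mod-p S n (ℕ.≤-trans (ℕ.≤-reflexive (sym (ℕ.*-identityˡ states))) s≤n))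
  somos-period (suc k) {x} S n s≤n = subst₂ (λ m n → x m ≡ x n [ 2 ℕ.+ k ]) index r+s≡n
    (period-lift k {λ m → x (m ℕ.+ s)} {e = p ℕ.^ k} (shift s S)
      (λ m → subst (λ l → x l ≡ x (m ℕ.+ s) [ suc k ]) (swap m s _) (somos-period k S (m ℕ.+ s) (ℕ.m≤n+m s m)))
      r s≤r)
    where
    s r : ℕ
    s = suc k ℕ.* states
    r = n ℕ.∸ s
    r+s≡n : r ℕ.+ s ≡ n
    r+s≡n = ℕ.m∸n+n≡m (ℕ.≤-trans (ℕ.m≤n+m s states) s≤n)
    s≤r : states ℕ.≤ r
    s≤r = ℕ.m+n≤o⇒m≤o∸n states s≤n
    swap : ∀ m s t → m ℕ.+ s ℕ.+ t ≡ m ℕ.+ t ℕ.+ s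
    swap = ℕ-Solver.solve-∀
    lem : ∀ r p q f s → r ℕ.+ p ℕ.* (q ℕ.* f) ℕ.+ s ≡ r ℕ.+ s ℕ.+ p ℕ.* q ℕ.* f
    lem = ℕ-Solver.solve-∀
    index : r ℕ.+ p ℕ.* (p ℕ.^ k ℕ.* states !) ℕ.+ s ≡ n ℕ.+ p ℕ.^ suc k ℕ.* states !
    index = trans (lem r p (p ℕ.^ k) (states !) s) (cong (ℕ._+ p ℕ.^ suc k ℕ.* states !) r+s≡n)

-- Powers of p modulo an arbitrary period.

n<m^n : ∀ m n → 2 ℕ.≤ m → n ℕ.< m ℕ.^ n
n<m^n m zero    _   = ℕ.s≤s ℕ.z≤n
n<m^n m (suc n) 2≤m = begin-strict
  suc n                   ≤⟨ n<m^n m n 2≤m ⟩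
  m ℕ.^ n                 <⟨ ℕ.m<m+n (m ℕ.^ n) (ℕ.≤-trans (ℕ.s≤s ℕ.z≤n) (n<m^n m n 2≤m)) ⟩
  m ℕ.^ n ℕ.+ m ℕ.^ n     ≡⟨ cong (m ℕ.^ n ℕ.+_) (sym (ℕ.*-identityˡ (m ℕ.^ n))) ⟩
  2 ℕ.* m ℕ.^ n           ≤⟨ ℕ.*-monoˡ-≤ (m ℕ.^ n) 2≤m ⟩
  m ℕ.* m ℕ.^ n           ∎
  where open ℕ.≤-Reasoning

-- Two of the powers `p ^ 0`, ..., `p ^ T` agree modulo `T`. The offset `s` is there because `p`
-- need not be prime to `T`.
powers-repeat : ∀ p .{{_ : ℕ.NonZero p}} T .{{_ : ℕ.NonZero T}} →
  ∃[ s ] ∃[ N ] ∃[ c ] 1 ℕ.≤ N × p ℕ.^ (s ℕ.+ N) ≡ p ℕ.^ s ℕ.+ c ℕ.* T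
powers-repeat p T with Fin.pigeonhole (ℕ.n<1+n T) (λ i → fromℕ< (ℕ.m%n<n (p ℕ.^ toℕ i) T))
... | i , j , i<j , eq = s , N , ℕ._∣_.quotient T∣d , ℕ.m<n⇒0<n∸m i<j ,
      trans (cong (p ℕ.^_) s+N≡j) (trans (sym pˢ+d≡pʲ) (cong (p ℕ.^ s ℕ.+_) (ℕ._∣_.equality T∣d)))
  where
  s N d : ℕ
  s = toℕ i
  N = toℕ j ℕ.∸ toℕ i
  d = p ℕ.^ toℕ j ℕ.∸ p ℕ.^ s
  s+N≡j : s ℕ.+ N ≡ toℕ j
  s+N≡j = ℕ.m+[n∸m]≡n (ℕ.<⇒≤ i<j)
  pˢ+d≡pʲ : p ℕ.^ s ℕ.+ d ≡ p ℕ.^ toℕ j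
  pˢ+d≡pʲ = ℕ.m+[n∸m]≡n (ℕ.^-monoʳ-≤ p (ℕ.<⇒≤ i<j))
  remainders : p ℕ.^ s ℕ.% T ≡ p ℕ.^ toℕ j ℕ.% T
  remainders = trans (sym (Fin.toℕ-fromℕ< (ℕ.m%n<n (p ℕ.^ s) T)))
    (trans (cong toℕ eq) (Fin.toℕ-fromℕ< (ℕ.m%n<n (p ℕ.^ toℕ j) T)))
  u v : ℕ
  u = p ℕ.^ s ℕ./ T
  v = p ℕ.^ toℕ j ℕ./ T
  multiple : u ℕ.* T ℕ.+ d ≡ v ℕ.* T
  multiple = ℕ.+-cancelˡ-≡ (p ℕ.^ s ℕ.% T) _ _ (trans (sym (ℕ.+-assoc (p ℕ.^ s ℕ.% T) (u ℕ.* T) d))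
    (trans (cong (ℕ._+ d) (sym (ℕ.m≡m%n+[m/n]*n (p ℕ.^ s) T)))
      (trans pˢ+d≡pʲ (trans (ℕ.m≡m%n+[m/n]*n (p ℕ.^ toℕ j) T) (cong (ℕ._+ v ℕ.* T) (sym remainders))))))
  T∣d : T ℕ.∣ d
  T∣d = ℕ.∣m+n∣m⇒∣n (ℕ.divides v multiple) (ℕ.divides u refl)

-- Write `p ^ (N * i)` as `p ^ s * p ^ k * p ^ e`. Multiplication by `p ^ N` changes the factor
-- `p ^ s` by a multiple of `T`, and the factor `p ^ k` supplies the rest of the period.
power-step : ∀ {p s N c T} → p ℕ.^ (s ℕ.+ N) ≡ p ℕ.^ s ℕ.+ c ℕ.* T →
  ∀ k i → s ℕ.+ k ℕ.≤ N ℕ.* i →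
  ∃[ j ] (p ℕ.^ N) ℕ.^ suc i ≡ (p ℕ.^ N) ℕ.^ i ℕ.+ j ℕ.* (p ℕ.^ k ℕ.* T)
power-step {p} {s} {N} {c} {T} eq k i s+k≤Ni with ℕ.m≤n⇒∃[o]m+o≡n s+k≤Ni
... | e , s+k+e≡Ni = p ℕ.^ e ℕ.* c , (begin
    p ℕ.^ N ℕ.* (p ℕ.^ N) ℕ.^ i                        ≡⟨ cong (p ℕ.^ N ℕ.*_) split ⟩
    p ℕ.^ N ℕ.* (p ℕ.^ s ℕ.* p ℕ.^ k ℕ.* p ℕ.^ e)      ≡⟨ lem₁ (p ℕ.^ N) (p ℕ.^ s) (p ℕ.^ k) (p ℕ.^ e) ⟩
    p ℕ.^ s ℕ.* p ℕ.^ N ℕ.* (p ℕ.^ k ℕ.* p ℕ.^ e)      ≡⟨ cong (ℕ._* (p ℕ.^ k ℕ.* p ℕ.^ e)) (trans (sym (ℕ.^-distribˡ-+-* p s N)) eq) ⟩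
    (p ℕ.^ s ℕ.+ c ℕ.* T) ℕ.* (p ℕ.^ k ℕ.* p ℕ.^ e)    ≡⟨ lem₂ (p ℕ.^ s) c T (p ℕ.^ k) (p ℕ.^ e) ⟩
    p ℕ.^ s ℕ.* p ℕ.^ k ℕ.* p ℕ.^ e ℕ.+ p ℕ.^ e ℕ.* c ℕ.* (p ℕ.^ k ℕ.* T)
      ≡⟨ cong (ℕ._+ p ℕ.^ e ℕ.* c ℕ.* (p ℕ.^ k ℕ.* T)) split ⟨
    (p ℕ.^ N) ℕ.^ i ℕ.+ p ℕ.^ e ℕ.* c ℕ.* (p ℕ.^ k ℕ.* T) ∎)
  where
  open ≡-Reasoning
  split : (p ℕ.^ N) ℕ.^ i ≡ p ℕ.^ s ℕ.* p ℕ.^ k ℕ.* p ℕ.^ e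
  split = trans (ℕ.^-*-assoc p N i) (trans (cong (p ℕ.^_) (sym s+k+e≡Ni))
    (trans (ℕ.^-distribˡ-+-* p (s ℕ.+ k) e) (cong (ℕ._* p ℕ.^ e) (ℕ.^-distribˡ-+-* p s k))))
  lem₁ : ∀ n s k e → n ℕ.* (s ℕ.* k ℕ.* e) ≡ s ℕ.* n ℕ.* (k ℕ.* e)
  lem₁ = ℕ-Solver.solve-∀
  lem₂ : ∀ s c T k e → (s ℕ.+ c ℕ.* T) ℕ.* (k ℕ.* e) ≡ s ℕ.* k ℕ.* e ℕ.+ e ℕ.* c ℕ.* (k ℕ.* T)
  lem₂ = ℕ-Solver.solve-∀

-- Convergence in the p-adic integers.

module Limits {p : ℕ} (p-prime : Prime p) where
  open Localisation p-prime
  open Dynamics p-prime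

  private instance
    p≢0 = prime⇒nonZero p-prime

  2≤p : 2 ℕ.≤ p
  2≤p = ℕ.nonTrivial⇒n>1 p {{prime⇒nonTrivial p-prime}}

  []-weaken-≤ : ∀ {a b j k} → j ℕ.≤ k → a ≡ b [ k ] → a ≡ b [ j ]
  []-weaken-≤ {a} {b} {j} j≤k h with ℕ.m≤n⇒∃[o]m+o≡n j≤k
  ... | e , refl = []-weaken j {e} h

  exact-power : ∀ n .{{_ : ℕ.NonZero n}} → ∃[ e ] p ^ e ∥ n
  exact-power n = search n 0 (ℕ.+-identityʳ n) (ℕ.1∣ n)
    where
    search : ∀ fuel e → fuel ℕ.+ e ≡ n → p ℕ.^ e ℕ.∣ n → ∃[ e ] p ^ e ∥ n
    search fuel e eq h with p ℕ.^ suc e ℕ.∣? n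
    ... | no ¬h = e , h , ¬h
    -- Without fuel `e` equals `n`, and `p ^ n` cannot divide `n` because `n < p ^ n`.
    search zero e refl h | yes h′ =
      contradiction (ℕ.∣⇒≤ h) (ℕ.<⇒≱ (n<m^n p n 2≤p))
    search (suc fuel) e eq h | yes h′ = search fuel (suc e) (trans (ℕ.+-suc fuel e) eq) h′

  ≡0⇒≤ord : ∀ {a k} → a ≡ 𝟎 [ k ] → + k ≤ord[ p ] val a
  ≡0⇒≤ord {a} {k} h with ↥ val a ℤ.≟ 0ℤ
  ... | yes n≡0 = inj₁ (ℚ.↥p≡0⇒p≡0 (val a) n≡0)
  ... | no n≢0 with exact-power ∣ ↥ val a ∣ {{ℕ.≢-nonZero (n≢0 ∘ ℤ.∣i∣≡0⇒i≡0)}}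
  ... | e , (pᵉ∣ , pᵉ⁺¹∤) = inj₂ (+ e ℤ.- 0ℤ , (e , 0 , (pᵉ∣ , pᵉ⁺¹∤) ,
          (ℕ.1∣ _ , integral a ∘ subst (ℕ._∣ ↧ₙ val a) (ℕ.^-identityʳ p)) , refl) ,
        ℤ.≤-trans (ℤ.+≤+ k≤e) (ℤ.≤-reflexive (sym (ℤ.+-identityʳ (+ e)))))
    where
    k≤e : k ℕ.≤ e
    k≤e = ℕ.≮⇒≥ λ e<k → pᵉ⁺¹∤ (∣numerator ([]-weaken-≤ {a} e<k h))

  -- The expansion is built from its lowest digit: `reduce` gives it, and the recursion treats the
  -- quotient by `p`.
  representative : ∀ k a → ∃[ z ] int z ≡ a [ k ]
  representative zero a = 0ℤ , []-sym (cong-by a (lem (val a)))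
    where lem : ∀ a → a ≡ 0ℚ ℚ.+ 1ℚ ℚ.* a
          lem = solve-∀ ℚ-ring
  representative (suc k) a = first-digit ([]-sym (reduce-≡ a (integral a)))
    where
    π : ℤ₍ₚ₎
    π = int (+ (p ℕ.^ 1))
    first-digit : ∀ {x} → a ≡ int x [ 1 ] → ∃[ z ] int z ≡ a [ suc k ]
    first-digit {x} (cong-by t eq) = x ℤ.+ + (p ℕ.^ 1) ℤ.* z , []-sym
      ([]-trans (≡⇒≡[] {b = int x ⊞ π ⊠ t} eq)
        ([]-trans (⊞-cong ([]-refl {int x})
                          (subst (λ j → π ⊠ t ≡ π ⊠ int z [ j ]) (ℕ.+-comm k 1) (scaled-cong 1 {k} ([]-sym z≡t))))
          (≡⇒≡[] {int x ⊞ π ⊠ int z} {int (x ℤ.+ + (p ℕ.^ 1) ℤ.* z)}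
            (sym (trans (ι-+ x (+ (p ℕ.^ 1) ℤ.* z)) (cong (ι x ℚ.+_) (ι-* (+ (p ℕ.^ 1)) z)))))))
      where
      z : ℤ
      z = proj₁ (representative k t)
      z≡t : int z ≡ t [ k ]
      z≡t = proj₂ (representative k t)

  -- Consecutive terms suffice, since congruence modulo `p ^ k` is transitive: past `index k` the
  -- sequence is constant modulo `p ^ k`, and an integer in that class is the residue of the limit.
  limit-exists : ∀ (v : ℕ → ℤ₍ₚ₎) → (∀ k → ∃[ I ] ∀ i → I ℕ.≤ i → v (suc i) ≡ v i [ k ]) →
                 LimitExistsInℤₚ p (val ∘ v)
  limit-exists v cauchy = record { residue = residue ; coherent = coherent } , converges
    where
    index : ℕ → ℕ
    index k = proj₁ (cauchy k)
    stable : ∀ k j → v (j ℕ.+ index k) ≡ v (index k) [ k ]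
    stable k zero    = []-refl
    stable k (suc j) = []-trans (proj₂ (cauchy k) (j ℕ.+ index k) (ℕ.m≤n+m (index k) j)) (stable k j)
    residue : ℕ → ℤ
    residue k = proj₁ (representative k (v (index k)))
    approximates : ∀ k i → index k ℕ.≤ i → v i ≡ int (residue k) [ k ]
    approximates k i I≤i = []-trans (subst (λ j → v j ≡ v (index k) [ k ]) (ℕ.m∸n+n≡m I≤i) (stable k (i ℕ.∸ index k)))
      ([]-sym (proj₂ (representative k (v (index k)))))
    coherent : ∀ k → + (p ℕ.^ k) ℤ.∣ residue (suc k) ℤ.- residue k
    coherent k = ≡[]-toℤ ([]-trans
      ([]-sym ([]-weaken-≤ (ℕ.n≤1+n k) (approximates (suc k) i (ℕ.m≤n⊔m (index k) (index (suc k))))))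
      (approximates k i (ℕ.m≤m⊔n (index k) (index (suc k)))))
      where
      i : ℕ
      i = index k ℕ.⊔ index (suc k)
    converges : ∀ k → ∃[ I ] ∀ i → I ℕ.≤ i → + k ≤ord[ p ] (val (v i) ℚ.- (residue k ℚ./ 1))
    converges k = index k , λ i I≤i →
      subst (λ r → + k ≤ord[ p ] (val (v i) ℚ.- r)) (sym (/1≡ι (residue k)))
        (≡0⇒≤ord {v i ⊞ ⊟ int (residue k)} ([]-trans (⊞-cong (approximates k i I≤i) []-refl)
          (≡⇒≡[] (ℚ.+-inverseʳ (ι (residue k))))))

  pow : ℤ₍ₚ₎ → ℕ → ℤ₍ₚ₎
  pow a zero    = 𝟏
  pow a (suc n) = a ⊠ pow a n

  val-pow : ∀ a n → val (pow a n) ≡ val a ^ℚ n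
  val-pow a zero    = refl
  val-pow a (suc n) = cong (val a ℚ.*_) (val-pow a n)

  pow≢0 : ∀ {a} → a ≢0 → ∀ n → pow a n ≢0
  pow≢0 a≢0 zero    h = 𝟏≢0 h
  pow≢0 {a} a≢0 (suc n) h = a≢0 (≡0-product h (pow≢0 a≢0 n))

  pow≡0 : ∀ {a} → a ≡ 𝟎 [ 1 ] → ∀ n → pow a n ≡ 𝟎 [ n ]
  pow≡0 a≡0 zero = cong-by 𝟏 refl
  pow≡0 {a} (cong-by t eq) (suc n) = cong-by (t ⊠ quotient h) (begin
    val a ℚ.* val (pow a n)                      ≡⟨ cong₂ ℚ._*_ eq (equation h) ⟩
    (0ℚ ℚ.+ P 1 ℚ.* val t) ℚ.* (0ℚ ℚ.+ P n ℚ.* val (quotient h)) ≡⟨ lem (P 1) (val t) (P n) (val (quotient h)) ⟩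
    0ℚ ℚ.+ P 1 ℚ.* P n ℚ.* val (t ⊠ quotient h)  ≡⟨ cong (λ z → 0ℚ ℚ.+ z ℚ.* val (t ⊠ quotient h)) (P-+ 1 n) ⟨
    0ℚ ℚ.+ P (suc n) ℚ.* val (t ⊠ quotient h)    ∎)
    where
    open ≡-Reasoning
    h : pow a n ≡ 𝟎 [ n ]
    h = pow≡0 (cong-by t eq) n
    lem : ∀ P t Q s → (0ℚ ℚ.+ P ℚ.* t) ℚ.* (0ℚ ℚ.+ Q ℚ.* s) ≡ 0ℚ ℚ.+ P ℚ.* Q ℚ.* (t ℚ.* s)
    lem = solve-∀ ℚ-ring

  private
    rescale₄ : ∀ {a b t₀ t₁ t₂ t₃ t₄} α A →
      t₄ ℚ.* t₀ ≡ a ℚ.* (t₃ ℚ.* t₁) ℚ.+ b ℚ.* (t₂ ℚ.* t₂) →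
      (α ℚ.* (α ℚ.* (α ℚ.* (α ℚ.* A)))) ℚ.* t₄ ℚ.* (A ℚ.* t₀) ≡
      a ℚ.* ((α ℚ.* (α ℚ.* (α ℚ.* A))) ℚ.* t₃ ℚ.* (α ℚ.* A ℚ.* t₁)) ℚ.+
      b ℚ.* (α ℚ.* (α ℚ.* A) ℚ.* t₂ ℚ.* (α ℚ.* (α ℚ.* A) ℚ.* t₂))
    rescale₄ {a} {b} {t₀} {t₁} {t₂} {t₃} {t₄} α A eq = trans (l α A t₄ t₀)
      (trans (cong (λ z → α ℚ.* α ℚ.* α ℚ.* α ℚ.* A ℚ.* A ℚ.* z) eq) (r a b α A t₁ t₂ t₃))
      where
      l : ∀ α A y x → (α ℚ.* (α ℚ.* (α ℚ.* (α ℚ.* A)))) ℚ.* y ℚ.* (A ℚ.* x) ≡ α ℚ.* α ℚ.* α ℚ.* α ℚ.* A ℚ.* A ℚ.* (y ℚ.* x)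
      l = solve-∀ ℚ-ring
      r : ∀ a b α A x y z → α ℚ.* α ℚ.* α ℚ.* α ℚ.* A ℚ.* A ℚ.* (a ℚ.* (z ℚ.* x) ℚ.+ b ℚ.* (y ℚ.* y)) ≡
        a ℚ.* ((α ℚ.* (α ℚ.* (α ℚ.* A))) ℚ.* z ℚ.* (α ℚ.* A ℚ.* x)) ℚ.+
        b ℚ.* (α ℚ.* (α ℚ.* A) ℚ.* y ℚ.* (α ℚ.* (α ℚ.* A) ℚ.* y))
      r = solve-∀ ℚ-ring

    rescale₅ : ∀ {a b t₀ t₁ t₂ t₃ t₄ t₅} α A →
      t₅ ℚ.* t₀ ≡ a ℚ.* (t₄ ℚ.* t₁) ℚ.+ b ℚ.* (t₃ ℚ.* t₂) →
      (α ℚ.* (α ℚ.* (α ℚ.* (α ℚ.* (α ℚ.* A))))) ℚ.* t₅ ℚ.* (A ℚ.* t₀) ≡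
      a ℚ.* ((α ℚ.* (α ℚ.* (α ℚ.* (α ℚ.* A)))) ℚ.* t₄ ℚ.* (α ℚ.* A ℚ.* t₁)) ℚ.+
      b ℚ.* (α ℚ.* (α ℚ.* (α ℚ.* A)) ℚ.* t₃ ℚ.* (α ℚ.* (α ℚ.* A) ℚ.* t₂))
    rescale₅ {a} {b} {t₀} {t₁} {t₂} {t₃} {t₄} {t₅} α A eq = trans (l α A t₅ t₀)
      (trans (cong (λ z → α ℚ.* α ℚ.* α ℚ.* α ℚ.* α ℚ.* A ℚ.* A ℚ.* z) eq) (r a b α A t₁ t₂ t₃ t₄))
      where
      l : ∀ α A y x → (α ℚ.* (α ℚ.* (α ℚ.* (α ℚ.* (α ℚ.* A))))) ℚ.* y ℚ.* (A ℚ.* x) ≡ α ℚ.* α ℚ.* α ℚ.* α ℚ.* α ℚ.* A ℚ.* A ℚ.* (y ℚ.* x)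
      l = solve-∀ ℚ-ring
      r : ∀ a b α A x y z w → α ℚ.* α ℚ.* α ℚ.* α ℚ.* α ℚ.* A ℚ.* A ℚ.* (a ℚ.* (w ℚ.* x) ℚ.+ b ℚ.* (z ℚ.* y)) ≡
        a ℚ.* ((α ℚ.* (α ℚ.* (α ℚ.* (α ℚ.* A)))) ℚ.* w ℚ.* (α ℚ.* A ℚ.* x)) ℚ.+
        b ℚ.* (α ℚ.* (α ℚ.* (α ℚ.* A)) ℚ.* z ℚ.* (α ℚ.* (α ℚ.* A) ℚ.* y))
      r = solve-∀ ℚ-ring

  -- All products in a relation have the same index sum, `2n + 4` or `2n + 5`, so the powers of `α`
  -- form a common factor and the coefficients persist. That `α` is a unit preserves `units`.
  rescale : ∀ {x a b c d} α → α ≢0 → IsSomos x a b c d → IsSomos (λ n → pow α n ⊠ x n) a b c d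
  rescale {x} {a} {b} {c} {d} α α≢0 S = record
    { somos₄ = λ n → rescale₄ {val a} {val b} {val (x n)} {val (x (1 ℕ.+ n))} {val (x (2 ℕ.+ n))} {val (x (3 ℕ.+ n))} {val (x (4 ℕ.+ n))}
                          (val α) (val (pow α n)) (somos₄ n)
    ; somos₅ = λ n → rescale₅ {val c} {val d} {val (x n)} {val (x (1 ℕ.+ n))} {val (x (2 ℕ.+ n))} {val (x (3 ℕ.+ n))} {val (x (4 ℕ.+ n))}
                          {val (x (5 ℕ.+ n))} (val α) (val (pow α n)) (somos₅ n)
    ; units  = λ n → [ inj₁ ∘ unit n , inj₂ ∘ unit (suc n) ]′ (units n)
    }
    where
    open IsSomos S
    unit : ∀ n → x n ≢0 → (pow α n ⊠ x n) ≢0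
    unit n x≢0 h = pow≢0 α≢0 n (≡0-product h x≢0)

  -- `N` is quantified before the sequence, so that one `q` can serve the even and the odd terms.
  limit-along-powers : ∃[ N ] 1 ℕ.≤ N × (∀ {x a b c d} α β → IsSomos x a b c d → ∀ m → 1 ℕ.≤ m →
    LimitExistsInℤₚ p (λ i → let n = m ℕ.* (p ℕ.^ N) ℕ.^ i in val (pow α n ⊠ β ⊠ x n)))
  limit-along-powers with powers-repeat p (states !) {{states ℕ.!≢0}}
  ... | s , N , c , 1≤N , eq = N , 1≤N , λ α β S m 1≤m → limit-exists _ (cauchy α β S m 1≤m)
    where
    q : ℕ
    q = p ℕ.^ N
    2≤q : 2 ℕ.≤ q
    2≤q = ℕ.≤-trans 2≤p (ℕ.≤-trans (ℕ.≤-reflexive (sym (ℕ.^-identityʳ p))) (ℕ.^-monoʳ-≤ p 1≤N))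
    i≤mqⁱ : ∀ m i → 1 ℕ.≤ m → i ℕ.≤ m ℕ.* q ℕ.^ i
    i≤mqⁱ m i 1≤m = ℕ.≤-trans (ℕ.<⇒≤ (n<m^n q i 2≤q)) (ℕ.m≤n*m (q ℕ.^ i) m {{ℕ.>-nonZero 1≤m}})
    cauchy : ∀ {x a b c d} α β → IsSomos x a b c d → ∀ m → 1 ℕ.≤ m → ∀ k → ∃[ I ] ∀ i → I ℕ.≤ i →
      pow α (m ℕ.* q ℕ.^ suc i) ⊠ β ⊠ x (m ℕ.* q ℕ.^ suc i) ≡ pow α (m ℕ.* q ℕ.^ i) ⊠ β ⊠ x (m ℕ.* q ℕ.^ i) [ k ]
    cauchy {x} α β S m 1≤m k with α ≡0?
    -- Here `αⁿ` is divisible by `pⁿ`, and `n = m * q ^ i` is at least `i`.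
    ... | yes α≡0 = k , λ i k≤i → []-trans (vanishes (suc i) (ℕ.m≤n⇒m≤1+n k≤i)) ([]-sym (vanishes i k≤i))
      where
      vanishes : ∀ i → k ℕ.≤ i → pow α (m ℕ.* q ℕ.^ i) ⊠ β ⊠ x (m ℕ.* q ℕ.^ i) ≡ 𝟎 [ k ]
      vanishes i k≤i = []-trans (⊠-cong (⊠-cong
          ([]-weaken-≤ (ℕ.≤-trans k≤i (i≤mqⁱ m i 1≤m)) (pow≡0 α≡0 (m ℕ.* q ℕ.^ i))) []-refl) []-refl)
        (≡⇒≡[] (lem (val β) (val (x (m ℕ.* q ℕ.^ i)))))
        where lem : ∀ b x → 0ℚ ℚ.* b ℚ.* x ≡ 0ℚ
              lem = solve-∀ ℚ-ring
    -- The summand `s + k` makes the step from `m * q ^ i` to `m * q ^ suc i` a multiple of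
    -- `p ^ k * states !`; the summand `suc k * states` passes the preperiod.
    ... | no α≢0 = s ℕ.+ k ℕ.+ suc k ℕ.* states , bound
      where
      U : ℕ → ℤ₍ₚ₎
      U n = pow α n ⊠ x n
      swap : ∀ n → val (pow α n ⊠ β ⊠ x n) ≡ val (U n ⊠ β)
      swap n = lem (val (pow α n)) (val β) (val (x n))
        where lem : ∀ a b x → a ℚ.* b ℚ.* x ≡ a ℚ.* x ℚ.* b
              lem = solve-∀ ℚ-ring
      bound : ∀ i → s ℕ.+ k ℕ.+ suc k ℕ.* states ℕ.≤ i →
        pow α (m ℕ.* q ℕ.^ suc i) ⊠ β ⊠ x (m ℕ.* q ℕ.^ suc i) ≡ pow α (m ℕ.* q ℕ.^ i) ⊠ β ⊠ x (m ℕ.* q ℕ.^ i) [ k ]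
      bound i I≤i with power-step {p} {s} {N} {c} {states !} eq k i
                         (ℕ.≤-trans (ℕ.m≤m+n (s ℕ.+ k) _) (ℕ.≤-trans I≤i (ℕ.m≤n*m i N {{ℕ.>-nonZero 1≤N}})))
      ... | j , step = []-trans (≡⇒≡[] (swap (m ℕ.* q ℕ.^ suc i)))
        ([]-trans (⊠-cong ([]-weaken-≤ (ℕ.n≤1+n k) periodic) ([]-refl {β})) (≡⇒≡[] (sym (swap (m ℕ.* q ℕ.^ i)))))
        where
        n₀ : ℕ
        n₀ = m ℕ.* q ℕ.^ i
        lem : ∀ m j t q → m ℕ.* (q ℕ.+ j ℕ.* t) ≡ m ℕ.* q ℕ.+ m ℕ.* j ℕ.* t
        lem = ℕ-Solver.solve-∀
        periodic : U (m ℕ.* q ℕ.^ suc i) ≡ U n₀ [ suc k ]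
        periodic = subst (λ n → U n ≡ U n₀ [ suc k ])
          (sym (trans (cong (m ℕ.*_) step) (lem m j (p ℕ.^ k ℕ.* states !) (q ℕ.^ i))))
          (iterate-period {λ m n → U m ≡ U n [ suc k ]} []-refl []-trans
            (somos-period k (rescale α α≢0 S)) (m ℕ.* j) n₀
            (ℕ.≤-trans (ℕ.m≤n+m _ (s ℕ.+ k)) (ℕ.≤-trans I≤i (i≤mqⁱ m i 1≤m))))

-- The duplication formula.

module ℚ-Eval = Evaluation ℚ.+-*-commutativeRing

curveDefect tangentNumerator : Expr
curveDefect = weierstrassˡ x₁ y₁ ⊕ ⊝ weierstrassʳ x₁ y₁
tangentNumerator = Weierstrass.∂x universalRing universalCurve (gen x₁) (gen y₁)

three twelve : Expr
three  = 𝟙 ⊕ (𝟙 ⊕ 𝟙)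
twelve = three ⊕ (three ⊕ (three ⊕ three))

-- The duplication formula x(2P₁) - x₁ = - β₂ / β₁² with denominators cleared;
-- the multiple of the curve equation makes it an identity of polynomials.
duplicationForm : Expr
duplicationForm =
  Universal.β₁ ⊗ Universal.β₁ ⊗ (three ⊗ gen x₁ ⊕ gen a₂)
  ⊕ ⊝ (tangentNumerator ⊗ tangentNumerator) ⊕ ⊝ (gen a₁ ⊗ tangentNumerator ⊗ Universal.β₁)
  ⊕ ⊝ ((twelve ⊗ gen x₁ ⊕ Weierstrass.b₂ universalRing universalCurve) ⊗ curveDefect)

module _ where
  open ℚ-Poly.+-*-Solver

  private
    -- Expressions are reified in the syntax of the ring solver, which then expands the Weierstrass
    -- quantities itself.
    toPolynomial : ∀ {n} → (Generator → Polynomial n) → Expr → Polynomial n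
    toPolynomial σ (gen g) = σ g
    toPolynomial σ 𝟘       = con 0ℚ
    toPolynomial σ 𝟙       = con 1ℚ
    toPolynomial σ (s ⊕ t) = toPolynomial σ s :+ toPolynomial σ t
    toPolynomial σ (s ⊗ t) = toPolynomial σ s :* toPolynomial σ t
    toPolynomial σ (⊝ s)   = :- toPolynomial σ s

    assign : ∀ {n} (a b c d e x y : Polynomial n) → Generator → Polynomial n
    assign a b c d e x y a₁ = a
    assign a b c d e x y a₂ = b
    assign a b c d e x y a₃ = c
    assign a b c d e x y a₄ = d
    assign a b c d e x y a₆ = e
    assign a b c d e x y x₁ = x
    assign a b c d e x y y₁ = y
    assign a b c d e x y _  = con 0ℚ

  duplication-ℚ : ∀ ρ → ℚ-Eval.eval ρ Universal.β₂ ≡ ℚ-Eval.eval ρ duplicationForm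
  duplication-ℚ ρ = solve 7 (λ a b c d e x y → toPolynomial (assign a b c d e x y) Universal.β₂
                                      := toPolynomial (assign a b c d e x y) duplicationForm) refl
    (ρ a₁) (ρ a₂) (ρ a₃) (ρ a₄) (ρ a₆) (ρ x₁) (ρ y₁)

ι-injective : ∀ {x y} → ι x ≡ ι y → x ≡ y
ι-injective refl = refl

-- Reduction of expressions, and points of order two and three modulo p.

module Reduction {p : ℕ} (p-prime : Prime p) where
  open Localisation p-prime
  open ResidueField p-prime
  open Mod p-prime
  module 𝔽-Eval = Evaluation commutativeRing

  -- This is the source of the integrality of `Ψₙ`: a universal expression uses ring operations
  -- only, so integral values of the generators, `δ` included, are enough.
  evaluate : (Generator → ℤ₍ₚ₎) → Expr → ℤ₍ₚ₎
  evaluate ρ (gen g) = ρ g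
  evaluate ρ 𝟘       = 𝟎
  evaluate ρ 𝟙       = 𝟏
  evaluate ρ (s ⊕ t) = evaluate ρ s ⊞ evaluate ρ t
  evaluate ρ (s ⊗ t) = evaluate ρ s ⊠ evaluate ρ t
  evaluate ρ (⊝ s)   = ⊟ evaluate ρ s

  val-evaluate : ∀ ρ e → val (evaluate ρ e) ≡ ℚ-Eval.eval (val ∘ ρ) e
  val-evaluate ρ (gen g) = refl
  val-evaluate ρ 𝟘       = refl
  val-evaluate ρ 𝟙       = refl
  val-evaluate ρ (s ⊕ t) = cong₂ ℚ._+_ (val-evaluate ρ s) (val-evaluate ρ t)
  val-evaluate ρ (s ⊗ t) = cong₂ ℚ._*_ (val-evaluate ρ s) (val-evaluate ρ t)
  val-evaluate ρ (⊝ s)   = cong ℚ.-_ (val-evaluate ρ s)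

  evaluate-cong : ∀ {ρ ρ′ k} → (∀ g → ρ g ≡ ρ′ g [ k ]) → ∀ e → evaluate ρ e ≡ evaluate ρ′ e [ k ]
  evaluate-cong h (gen g) = h g
  evaluate-cong h 𝟘       = []-refl
  evaluate-cong h 𝟙       = []-refl
  evaluate-cong h (s ⊕ t) = ⊞-cong (evaluate-cong h s) (evaluate-cong h t)
  evaluate-cong h (s ⊗ t) = ⊠-cong (evaluate-cong h s) (evaluate-cong h t)
  evaluate-cong h (⊝ s)   = ⊟-cong (evaluate-cong h s)

  ι-eval : ∀ σ e → ι (𝔽-Eval.eval σ e) ≡ ℚ-Eval.eval (ι ∘ σ) e
  ι-eval σ (gen g) = refl
  ι-eval σ 𝟘       = refl
  ι-eval σ 𝟙       = refl
  ι-eval σ (s ⊕ t) = trans (ι-+ (𝔽-Eval.eval σ s) (𝔽-Eval.eval σ t)) (cong₂ ℚ._+_ (ι-eval σ s) (ι-eval σ t))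
  ι-eval σ (s ⊗ t) = trans (ι-* (𝔽-Eval.eval σ s) (𝔽-Eval.eval σ t)) (cong₂ ℚ._*_ (ι-eval σ s) (ι-eval σ t))
  ι-eval σ (⊝ s)   = trans (ι-neg (𝔽-Eval.eval σ s)) (cong ℚ.-_ (ι-eval σ s))

  evaluate-mod-p : ∀ {ρ σ} → (∀ g → int (σ g) ≡ ρ g [ 1 ]) → ∀ e → int (𝔽-Eval.eval σ e) ≡ evaluate ρ e [ 1 ]
  evaluate-mod-p {ρ} {σ} h e =
    []-trans (≡⇒≡[] (trans (ι-eval σ e) (sym (val-evaluate (int ∘ σ) e)))) (evaluate-cong h e)

  ≢0-mod-p : ∀ {ρ σ} → (∀ g → int (σ g) ≡ ρ g [ 1 ]) → ∀ e → ¬ 𝔽-Eval.eval σ e ≈ₚ 0ℤ → evaluate ρ e ≢0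
  ≢0-mod-p {ρ} {σ} h e ≉0 eq = ≉0 (subst (λ q → + q ℤ.∣ 𝔽-Eval.eval σ e ℤ.- 0ℤ) (ℕ.^-identityʳ p)
    (≡[]-toℤ ([]-trans (evaluate-mod-p h e) eq)))

  module _ (Ẽ : WeierstrassCurve ℤ) (x y : ℤ) where
    private
      module Ẽ = WeierstrassCurve Ẽ
      P₁ : Point ℤ
      P₁ = affine x y
      x≈x : ∀ x → x ≈ₚ x
      x≈x x = CommutativeRing.refl commutativeRing {x}

    add-opposite : ∀ {x′ y′} → x ≈ₚ x′ → y ≈ₚ negY Ẽ x′ y′ → add Ẽ P₁ (affine x′ y′) ≡ ∞
    add-opposite {x′} {y′} x≈ y≈ with x #ₚ? x′ | y #ₚ? negY Ẽ x′ y′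
    ... | yes x# | _      = contradiction x≈ x#
    ... | no _   | yes y# = contradiction y≈ y#
    ... | no _   | no _   = refl

    double : (d : y #ₚ negY Ẽ x y) → add Ẽ P₁ P₁ ≡ thirdPoint Ẽ (∂x Ẽ x y ℤ.* recip {y} {negY Ẽ x y} d) x y x
    double d with x #ₚ? x | y #ₚ? negY Ẽ x y
    ... | yes x# | _     = contradiction (x≈x x) x#
    ... | no _   | yes _ = refl
    ... | no _   | no ¬d = contradiction d ¬d

    y-negY≡β₁ : y ℤ.- negY Ẽ x y ≡ β₁ Ẽ x y
    y-negY≡β₁ = lem Ẽ.a₁ Ẽ.a₃ x y
      where lem : ∀ a c x y → y ℤ.- (ℤ.- y ℤ.- a ℤ.* x ℤ.- c) ≡ (y ℤ.+ (y ℤ.+ 0ℤ)) ℤ.+ a ℤ.* x ℤ.+ c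
            lem = ℤ-Solver.solve-∀

    β₁≈0⇒2P≡∞ : β₁ Ẽ x y ≈ₚ 0ℤ → mul Ẽ 2 P₁ ≡ ∞
    β₁≈0⇒2P≡∞ β₁≈0 = add-opposite (x≈x x)
      (subst (+ p ℤ.∣_) (trans (ℤ.+-identityʳ (β₁ Ẽ x y)) (sym y-negY≡β₁)) β₁≈0)

    valuation₁ : Generator → ℤ
    valuation₁ a₁ = Ẽ.a₁
    valuation₁ a₂ = Ẽ.a₂
    valuation₁ a₃ = Ẽ.a₃
    valuation₁ a₄ = Ẽ.a₄
    valuation₁ a₆ = Ẽ.a₆
    valuation₁ x₁ = x
    valuation₁ y₁ = y
    valuation₁ _  = 0ℤ

    -- The solver's identity over ℚ descends to integers because `ι` is injective and commutes with
    -- evaluation.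
    duplication-ℤ : 𝔽-Eval.eval valuation₁ Universal.β₂ ≡ 𝔽-Eval.eval valuation₁ duplicationForm
    duplication-ℤ = ι-injective (trans (ι-eval valuation₁ Universal.β₂)
      (trans (duplication-ℚ (ι ∘ valuation₁)) (sym (ι-eval valuation₁ duplicationForm))))

    -- By the duplication formula `2P` has the abscissa of `P`. The third point of the tangent then
    -- has the ordinate of `P` too, so its negative `2P` is `- P`.
    β₂≈0⇒3P≡∞ : OnCurve Ẽ x y → (d : y #ₚ negY Ẽ x y) → β₂ Ẽ x y ≈ₚ 0ℤ → mul Ẽ 3 P₁ ≡ ∞
    β₂≈0⇒3P≡∞ on d β₂≈0 = trans (cong (add Ẽ P₁) (double d)) (add-opposite x≈x₃ y≈)
      where
      r X s x₃ b κ D : ℤ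
      r = recip {y} {negY Ẽ x y} d
      X = ∂x Ẽ x y
      b = β₁ Ẽ x y
      s = X ℤ.* r
      x₃ = s ℤ.* (s ℤ.* 1ℤ) ℤ.+ Ẽ.a₁ ℤ.* s ℤ.- Ẽ.a₂ ℤ.- x ℤ.- x
      D = 𝔽-Eval.eval valuation₁ curveDefect
      κ = 𝔽-Eval.eval valuation₁ (twelve ⊗ gen x₁ ⊕ Weierstrass.b₂ universalRing universalCurve)
      rb≈1 : + p ℤ.∣ r ℤ.* b ℤ.- 1ℤ
      rb≈1 = subst (λ z → + p ℤ.∣ r ℤ.* z ℤ.- 1ℤ) y-negY≡β₁ (proj₁ (proj₂ (#⇒invertible {y} {negY Ẽ x y} d)))
        where open HeytingField field𝔽ₚ using (#⇒invertible)
      D≈0 : + p ℤ.∣ D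
      D≈0 = subst (+ p ℤ.∣_) (eq Ẽ.a₁ Ẽ.a₂ Ẽ.a₃ Ẽ.a₄ Ẽ.a₆ x y) on
        where
        eq : ∀ a b c d e x y →
          y ℤ.* (y ℤ.* 1ℤ) ℤ.+ a ℤ.* x ℤ.* y ℤ.+ c ℤ.* y ℤ.-
          (x ℤ.* (x ℤ.* (x ℤ.* 1ℤ)) ℤ.+ b ℤ.* (x ℤ.* (x ℤ.* 1ℤ)) ℤ.+ d ℤ.* x ℤ.+ e) ≡
          y ℤ.* y ℤ.+ a ℤ.* x ℤ.* y ℤ.+ c ℤ.* y ℤ.+
          ℤ.- (x ℤ.* x ℤ.* x ℤ.+ b ℤ.* (x ℤ.* x) ℤ.+ d ℤ.* x ℤ.+ e)
        eq = ℤ-Solver.solve-∀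
      -- The duplication formula multiplied by `r²`, where `r` inverts `β₁` modulo `p`. The three
      -- summands vanish modulo `p` by the hypothesis on `β₂`, by `r b ≡ 1` and by the curve
      -- equation.
      lem : ∀ a₁ a₂ x r X b κ D →
        x ℤ.- (X ℤ.* r ℤ.* (X ℤ.* r ℤ.* 1ℤ) ℤ.+ a₁ ℤ.* (X ℤ.* r) ℤ.- a₂ ℤ.- x ℤ.- x) ≡
        r ℤ.* r ℤ.* (b ℤ.* b ℤ.* ((1ℤ ℤ.+ (1ℤ ℤ.+ 1ℤ)) ℤ.* x ℤ.+ a₂) ℤ.+ ℤ.- (X ℤ.* X) ℤ.+ ℤ.- (a₁ ℤ.* X ℤ.* b) ℤ.+ ℤ.- (κ ℤ.* D) ℤ.- 0ℤ)
        ℤ.+ (a₁ ℤ.* X ℤ.* r ℤ.- (r ℤ.* b ℤ.+ 1ℤ) ℤ.* ((1ℤ ℤ.+ (1ℤ ℤ.+ 1ℤ)) ℤ.* x ℤ.+ a₂)) ℤ.* (r ℤ.* b ℤ.- 1ℤ)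
        ℤ.+ r ℤ.* r ℤ.* κ ℤ.* D
      lem = ℤ-Solver.solve-∀
      x≈x₃ : x ≈ₚ x₃
      x≈x₃ = subst (+ p ℤ.∣_) (sym (lem Ẽ.a₁ Ẽ.a₂ x r X b κ D))
        (ℤ.∣m∣n⇒∣m+n (ℤ.∣m∣n⇒∣m+n
          (ℤ.∣n⇒∣m*n (r ℤ.* r) (subst (λ z → + p ℤ.∣ z ℤ.- 0ℤ) duplication-ℤ β₂≈0))
          (ℤ.∣n⇒∣m*n (Ẽ.a₁ ℤ.* X ℤ.* r ℤ.- (r ℤ.* b ℤ.+ 1ℤ) ℤ.* ((1ℤ ℤ.+ (1ℤ ℤ.+ 1ℤ)) ℤ.* x ℤ.+ Ẽ.a₂)) rb≈1))
          (ℤ.∣n⇒∣m*n (r ℤ.* r ℤ.* κ) D≈0))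
      -- The two negations cancel to the ordinate `s (x₃ - x) + y` on the tangent line.
      y≈ : y ≈ₚ negY Ẽ x₃ (negY Ẽ x₃ (s ℤ.* (x₃ ℤ.- x) ℤ.+ y))
      y≈ = subst (+ p ℤ.∣_) (lem′ Ẽ.a₁ Ẽ.a₃ s x x₃ y) (ℤ.∣n⇒∣m*n s x≈x₃)
        where
        lem′ : ∀ a c s x z y → s ℤ.* (x ℤ.- z) ≡
          y ℤ.- (ℤ.- (ℤ.- (s ℤ.* (z ℤ.- x) ℤ.+ y) ℤ.- a ℤ.* z ℤ.- c) ℤ.- a ℤ.* z ℤ.- c)
        lem′ = ℤ-Solver.solve-∀

-- Integrality of slopes of chords.

module Slopes {p : ℕ} (p-prime : Prime p) where
  open Localisation p-prime
  open Mod p-prime using (reduce; reducePoint)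

  reducePoint-affine : ∀ {x y} → reducePoint (affine x y) ≢ ∞ →
    ∃[ x-int ] ∃[ y-int ] reducePoint (affine x y) ≡ affine (reduce x x-int) (reduce y y-int)
  reducePoint-affine {x} {y} h with p ℕ.∣? ↧ₙ x | p ℕ.∣? ↧ₙ y
  ... | no x-int | no y-int = x-int , y-int , refl
  ... | no _     | yes _    = contradiction refl h
  ... | yes _    | no _     = contradiction refl h
  ... | yes _    | yes _    = contradiction refl h

  private
    small-inverse : ∀ s → p ℕ.∣ ↧ₙ s → ∃[ r ] (val r ℚ.* s ≡ 1ℚ) × (r ≡ 𝟎 [ 1 ])
    small-inverse s p∣↧s = invert s (λ p∣n → not-both s (p∣n , p∣↧s)) p∣↧s
      where
      not-both : ∀ s → ¬ (p ℕ.∣ ∣ ↥ s ∣ × p ℕ.∣ ↧ₙ s)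
      not-both (mkℚ n d c) h = p∤1 (ℕ.∣-reflexive (Coprimality.recompute c h))
      invert : ∀ s → ¬ p ℕ.∣ ∣ ↥ s ∣ → p ℕ.∣ ↧ₙ s → ∃[ r ] (val r ℚ.* s ≡ 1ℚ) × (r ≡ 𝟎 [ 1 ])
      invert   (mkℚ (+ zero)  d c) p∤n p∣d = contradiction (p ℕ.∣0) p∤n
      invert s@(mkℚ (+ suc n) d c) p∤n p∣d = ((ℚ.1/ s) ⟨ p∤n ⟩) , ℚ.*-inverseˡ s , numerator∣ p∣d
      invert s@(mkℚ -[1+ n ]  d c) p∤n p∣d = ((ℚ.1/ s) ⟨ p∤n ⟩) , ℚ.*-inverseˡ s , numerator∣ p∣d

  -- If `s` were not integral, its inverse `r` would be integral and divisible by `p`; dividing the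
  -- equation by `s²` gives `1 = r (r v - a)`, which is then divisible by `p`.
  monic-root-integral : ∀ (a v : ℤ₍ₚ₎) {s} → s ℚ.* s ℚ.+ val a ℚ.* s ≡ val v → IsIntegral p s
  monic-root-integral a v {s} eq p∣↧s with small-inverse s p∣↧s
  ... | r , rs≡1 , r≡0 = 𝟏≢0 ([]-trans (≡⇒≡[] {b = r ⊠ (r ⊠ v ⊞ ⊟ a)} one)
        ([]-trans (⊠-cong r≡0 []-refl) (≡⇒≡[] (ℚ.*-zeroˡ (val (r ⊠ v ⊞ ⊟ a))))))
    where
    open ≡-Reasoning
    lem : ∀ r s a → r ℚ.* (r ℚ.* (s ℚ.* s ℚ.+ a ℚ.* s) ℚ.+ ℚ.- a) ≡
                    (r ℚ.* s) ℚ.* (r ℚ.* s) ℚ.+ r ℚ.* a ℚ.* (r ℚ.* s) ℚ.+ ℚ.- (r ℚ.* a)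
    lem = solve-∀ ℚ-ring
    lem′ : ∀ t → 1ℚ ≡ 1ℚ ℚ.* 1ℚ ℚ.+ t ℚ.* 1ℚ ℚ.+ ℚ.- t
    lem′ = solve-∀ ℚ-ring
    one : 1ℚ ≡ val (r ⊠ (r ⊠ v ⊞ ⊟ a))
    one = begin
      1ℚ ≡⟨ lem′ (val r ℚ.* val a) ⟩
      1ℚ ℚ.* 1ℚ ℚ.+ val r ℚ.* val a ℚ.* 1ℚ ℚ.+ ℚ.- (val r ℚ.* val a)
        ≡⟨ cong (λ t → t ℚ.* t ℚ.+ val r ℚ.* val a ℚ.* t ℚ.+ ℚ.- (val r ℚ.* val a)) rs≡1 ⟨
      (val r ℚ.* s) ℚ.* (val r ℚ.* s) ℚ.+ val r ℚ.* val a ℚ.* (val r ℚ.* s) ℚ.+ ℚ.- (val r ℚ.* val a)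
        ≡⟨ lem (val r) s (val a) ⟨
      val r ℚ.* (val r ℚ.* (s ℚ.* s ℚ.+ val a ℚ.* s) ℚ.+ ℚ.- val a)
        ≡⟨ cong (λ t → val r ℚ.* (val r ℚ.* t ℚ.+ ℚ.- val a)) eq ⟩
      val (r ⊠ (r ⊠ v ⊞ ⊟ a)) ∎

  module _ (E : WeierstrassCurve ℚ) where
    private module E = WeierstrassCurve E

    add-distinct : ∀ {x y x′ y′} (d : x ≢ x′) → Overℚ.add E (affine x y) (affine x′ y′) ≡
      Overℚ.thirdPoint E ((y ℚ.- y′) ℚ.* Overℚ.recip d) x y x′
    add-distinct {x} {y} {x′} {y′} d with x ℚ.≟ x′
    ... | yes x≡x′ = contradiction x≡x′ d
    ... | no _     = refl

    -- The slope s of the line satisfies s² + a₁ s = x₃ + a₂ + x + x′, where x₃ is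
    -- the abscissa of the sum, so it is p-integral.
    ordinates-congruent : ∀ (a b x y x′ y′ : ℤ₍ₚ₎) → val a ≡ E.a₁ → val b ≡ E.a₂ → val x ≢ val x′ →
      reducePoint (Overℚ.add E (affine (val x) (val y)) (affine (val x′) (val y′))) ≢ ∞ →
      x ⊞ ⊟ x′ ≡ 𝟎 [ 1 ] → y ≡ y′ [ 1 ]
    ordinates-congruent a b x y x′ y′ refl refl d h x-x′≡0 = cong-by (quotient y-y′≡0)
        (trans (lem (val y) (val y′)) (cong (val y′ ℚ.+_) (trans (equation y-y′≡0) (ℚ.+-identityˡ _))))
      where
      lem : ∀ y z → y ≡ z ℚ.+ (y ℚ.+ ℚ.- z)
      lem = solve-∀ ℚ-ring
      r s x₃ : ℚ
      r = Overℚ.recip d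
      s = (val y ℚ.- val y′) ℚ.* r
      x₃ = s ℚ.* (s ℚ.* 1ℚ) ℚ.+ val a ℚ.* s ℚ.- val b ℚ.- val x ℚ.- val x′
      x₃-int : IsIntegral p x₃
      x₃-int = proj₁ (reducePoint-affine (λ eq → h (trans (cong reducePoint (add-distinct d)) eq)))
      r-eq : r ℚ.* (val x ℚ.- val x′) ≡ 1ℚ
      r-eq = proj₁ (proj₂ (#⇒invertible d))
        where open HeytingField ℚ.heytingField using (#⇒invertible)
      v : ℤ₍ₚ₎
      v = (x₃ ⟨ x₃-int ⟩) ⊞ (b ⊞ x ⊞ x′)
      root : s ℚ.* s ℚ.+ val a ℚ.* s ≡ val v
      root = eq s (val a) (val b) (val x) (val x′)
        where eq : ∀ s a b x z → s ℚ.* s ℚ.+ a ℚ.* s ≡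
                s ℚ.* (s ℚ.* 1ℚ) ℚ.+ a ℚ.* s ℚ.- b ℚ.- x ℚ.- z ℚ.+ (b ℚ.+ x ℚ.+ z)
              eq = solve-∀ ℚ-ring
      S : ℤ₍ₚ₎
      S = s ⟨ monic-root-integral a v {s} root ⟩
      y-y′≡0 : y ⊞ ⊟ y′ ≡ 𝟎 [ 1 ]
      y-y′≡0 = []-trans (≡⇒≡[] {b = S ⊠ (x ⊞ ⊟ x′)} (begin
          val y ℚ.- val y′                                           ≡⟨ ℚ.*-identityʳ _ ⟨
          (val y ℚ.- val y′) ℚ.* 1ℚ                                  ≡⟨ cong ((val y ℚ.- val y′) ℚ.*_) r-eq ⟨
          (val y ℚ.- val y′) ℚ.* (r ℚ.* (val x ℚ.- val x′))          ≡⟨ ℚ.*-assoc (val y ℚ.- val y′) r _ ⟨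
          (val y ℚ.- val y′) ℚ.* r ℚ.* (val x ℚ.- val x′)            ∎))
        ([]-trans (⊠-cong []-refl x-x′≡0) (≡⇒≡[] (ℚ.*-zeroʳ s)))
        where open ≡-Reasoning

-- From Somos 4 to Somos 5 for positive rational sequences.

*-pos : ∀ {r s} → 0ℚ ℚ.< r → 0ℚ ℚ.< s → 0ℚ ℚ.< r ℚ.* s
*-pos {r} {s} 0<r 0<s = subst (ℚ._< r ℚ.* s) (ℚ.*-zeroˡ s) (ℚ.*-monoˡ-<-pos s {{ℚ.positive 0<s}} 0<r)

*-nonneg : ∀ {r s} → 0ℚ ℚ.≤ r → 0ℚ ℚ.≤ s → 0ℚ ℚ.≤ r ℚ.* s
*-nonneg {r} {s} 0≤r 0≤s = subst (ℚ._≤ r ℚ.* s) (ℚ.*-zeroˡ s) (ℚ.*-monoʳ-≤-nonNeg s {{ℚ.nonNegative 0≤s}} 0≤r)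

square-nonneg : ∀ r → 0ℚ ℚ.≤ r ℚ.* r
square-nonneg r with ℚ.≤-total 0ℚ r
... | inj₁ 0≤r = *-nonneg 0≤r 0≤r
... | inj₂ r≤0 = subst (ℚ._≤ r ℚ.* r) (ℚ.*-zeroˡ r) (ℚ.*-monoʳ-≤-nonPos r {{ℚ.nonPositive r≤0}} r≤0)

module Somos₄ (y : ℕ → ℚ) (a b : ℚ)
  (somos₄ : ∀ n → y (4 ℕ.+ n) ℚ.* y n ≡ a ℚ.* (y (3 ℕ.+ n) ℚ.* y (1 ℕ.+ n)) ℚ.+ b ℚ.* (y (2 ℕ.+ n) ℚ.* y (2 ℕ.+ n))) where

  -- Only the numerator of the invariant quotient; the denominator `y (3 + n) * y (2 + n)` is
  -- multiplied out wherever it occurs.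
  somosQuotient : ℕ → ℚ
  somosQuotient n = y (5 ℕ.+ n) ℚ.* y n ℚ.+ b ℚ.* (y (4 ℕ.+ n) ℚ.* y (1 ℕ.+ n))

  -- Equality of the quotients at `1 + n` and `n`, cross-multiplied and freed of the common factor
  -- `y (3 + n)`. Somos 4 is used at `2 + n` and backwards at `n`.
  somosQuotient-step : ∀ n → somosQuotient (suc n) ℚ.* y (2 ℕ.+ n) ≡ somosQuotient n ℚ.* y (4 ℕ.+ n)
  somosQuotient-step n = begin
    (y₆ ℚ.* t₁ ℚ.+ b ℚ.* (t₅ ℚ.* t₂)) ℚ.* t₂                      ≡⟨ l₁ y₆ t₁ t₂ t₅ b ⟩
    t₁ ℚ.* (y₆ ℚ.* t₂) ℚ.+ b ℚ.* (t₅ ℚ.* t₂ ℚ.* t₂)                ≡⟨ cong (λ z → t₁ ℚ.* z ℚ.+ b ℚ.* (t₅ ℚ.* t₂ ℚ.* t₂)) (somos₄ (2 ℕ.+ n)) ⟩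
    t₁ ℚ.* (a ℚ.* (t₅ ℚ.* t₃) ℚ.+ b ℚ.* (t₄ ℚ.* t₄)) ℚ.+ b ℚ.* (t₅ ℚ.* t₂ ℚ.* t₂) ≡⟨ l₂ t₁ t₂ t₃ t₄ t₅ a b ⟩
    t₅ ℚ.* (a ℚ.* (t₃ ℚ.* t₁) ℚ.+ b ℚ.* (t₂ ℚ.* t₂)) ℚ.+ b ℚ.* (t₄ ℚ.* t₄ ℚ.* t₁) ≡⟨ cong (λ z → t₅ ℚ.* z ℚ.+ b ℚ.* (t₄ ℚ.* t₄ ℚ.* t₁)) (somos₄ n) ⟨
    t₅ ℚ.* (t₄ ℚ.* t₀) ℚ.+ b ℚ.* (t₄ ℚ.* t₄ ℚ.* t₁)                ≡⟨ l₃ t₀ t₁ t₄ t₅ b ⟩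
    (t₅ ℚ.* t₀ ℚ.+ b ℚ.* (t₄ ℚ.* t₁)) ℚ.* t₄                      ∎
    where
    open ≡-Reasoning
    t₀ t₁ t₂ t₃ t₄ t₅ y₆ : ℚ
    t₀ = y n
    t₁ = y (1 ℕ.+ n)
    t₂ = y (2 ℕ.+ n)
    t₃ = y (3 ℕ.+ n)
    t₄ = y (4 ℕ.+ n)
    t₅ = y (5 ℕ.+ n)
    y₆ = y (6 ℕ.+ n)
    l₁ : ∀ s t u v b → (s ℚ.* t ℚ.+ b ℚ.* (v ℚ.* u)) ℚ.* u ≡ t ℚ.* (s ℚ.* u) ℚ.+ b ℚ.* (v ℚ.* u ℚ.* u)
    l₁ = solve-∀ ℚ-ring
    l₂ : ∀ t u v w x a b → t ℚ.* (a ℚ.* (x ℚ.* v) ℚ.+ b ℚ.* (w ℚ.* w)) ℚ.+ b ℚ.* (x ℚ.* u ℚ.* u) ≡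
                           x ℚ.* (a ℚ.* (v ℚ.* t) ℚ.+ b ℚ.* (u ℚ.* u)) ℚ.+ b ℚ.* (w ℚ.* w ℚ.* t)
    l₂ = solve-∀ ℚ-ring
    l₃ : ∀ s t w x b → x ℚ.* (w ℚ.* s) ℚ.+ b ℚ.* (w ℚ.* w ℚ.* t) ≡ (x ℚ.* s ℚ.+ b ℚ.* (w ℚ.* t)) ℚ.* w
    l₃ = solve-∀ ℚ-ring

  -- Nonvanishing allows cancellation in the step; the two normalisations make the denominator equal
  -- to one at the start.
  somosQuotient-constant : (∀ n → y (2 ℕ.+ n) ≢ 0ℚ) → y 2 ≡ 1ℚ → y 3 ≡ 1ℚ →
    ∀ n → somosQuotient n ≡ somosQuotient 0 ℚ.* (y (3 ℕ.+ n) ℚ.* y (2 ℕ.+ n))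
  somosQuotient-constant y≢0 y₂≡1 y₃≡1 zero =
    trans (lem (somosQuotient 0)) (cong₂ (λ s t → somosQuotient 0 ℚ.* (s ℚ.* t)) (sym y₃≡1) (sym y₂≡1))
    where lem : ∀ d → d ≡ d ℚ.* (1ℚ ℚ.* 1ℚ)
          lem = solve-∀ ℚ-ring
  somosQuotient-constant y≢0 y₂≡1 y₃≡1 (suc n) = *-cancelʳ (y≢0 n)
    (trans (somosQuotient-step n)
      (trans (cong (ℚ._* y (4 ℕ.+ n)) (somosQuotient-constant y≢0 y₂≡1 y₃≡1 n))
        (lem (somosQuotient 0) (y (2 ℕ.+ n)) (y (3 ℕ.+ n)) (y (4 ℕ.+ n)))))
    where
    lem : ∀ d s t u → d ℚ.* (t ℚ.* s) ℚ.* u ≡ d ℚ.* (u ℚ.* t) ℚ.* s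
    lem = solve-∀ ℚ-ring
    *-cancelʳ : ∀ {r s t} → t ≢ 0ℚ → r ℚ.* t ≡ s ℚ.* t → r ≡ s
    *-cancelʳ {r} {s} {t} t≢0 eq = trans (expand r) (trans (cong (ℚ._* ℚ.1/ t) eq) (sym (expand s)))
      where
      instance _ = ℚ.≢-nonZero t≢0
      expand : ∀ r → r ≡ r ℚ.* t ℚ.* ℚ.1/ t
      expand r = sym (trans (ℚ.*-assoc r t (ℚ.1/ t)) (trans (cong (r ℚ.*_) (ℚ.*-inverseʳ t)) (ℚ.*-identityʳ r)))

  module _ (0≤a : 0ℚ ℚ.≤ a) (0<b : 0ℚ ℚ.< b) where
    positive-step : ∀ n → 0ℚ ℚ.< y n → 0ℚ ℚ.< y (1 ℕ.+ n) → 0ℚ ℚ.< y (2 ℕ.+ n) → 0ℚ ℚ.< y (3 ℕ.+ n) →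
                    0ℚ ℚ.< y (4 ℕ.+ n)
    positive-step n 0<y₀ 0<y₁ 0<y₂ 0<y₃ = ℚ.*-cancelʳ-<-nonNeg (y n) {{ℚ.pos⇒nonNeg (y n) {{ℚ.positive 0<y₀}}}}
      (subst₂ ℚ._<_ (sym (ℚ.*-zeroˡ (y n))) (sym (somos₄ n))
        (ℚ.+-mono-≤-< (*-nonneg 0≤a (ℚ.<⇒≤ (*-pos 0<y₃ 0<y₁))) (*-pos 0<b (*-pos 0<y₂ 0<y₂))))

    -- Counting starts at index 1 because the sign of `y 0`, in the application the value of `Ψ₋₂`,
    -- is not controlled.
    positive : 0ℚ ℚ.< y 1 → 0ℚ ℚ.< y 2 → 0ℚ ℚ.< y 3 → 0ℚ ℚ.< y 4 → ∀ n → 0ℚ ℚ.< y (1 ℕ.+ n)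
    positive 0<y₁ 0<y₂ 0<y₃ 0<y₄ n = proj₁ (window n)
      where
      window : ∀ n → 0ℚ ℚ.< y (1 ℕ.+ n) × 0ℚ ℚ.< y (2 ℕ.+ n) × 0ℚ ℚ.< y (3 ℕ.+ n) × 0ℚ ℚ.< y (4 ℕ.+ n)
      window zero    = 0<y₁ , 0<y₂ , 0<y₃ , 0<y₄
      window (suc n) with window n
      ... | h₁ , h₂ , h₃ , h₄ = h₂ , h₃ , h₄ , positive-step (suc n) h₁ h₂ h₃ h₄

-- Rational specialisations of the translated division polynomials.

module TranslatedDivision (𝚿 : TranslatedDivisionPolynomials) where
  open TranslatedDivisionPolynomials 𝚿

  idx : ℕ → ℤ
  idx n = + n ℤ.- + 2

  -- The sequence starts at Ψ₋₂.
  Ψ′ : ℕ → Expr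
  Ψ′ n = Ψ (idx n)

  -- These are the conditions under which `eval-cong` carries relations of the universal ring to ℚ;
  -- the perturbed pairs of points satisfy them as well.
  record IsCurveValuation (ρ : Generator → ℚ) : Set where
    open ℚ-Eval
    field
      on-curve₁ : eval ρ (weierstrassˡ x₁ y₁) ≡ eval ρ (weierstrassʳ x₁ y₁)
      on-curve₂ : eval ρ (weierstrassˡ x₂ y₂) ≡ eval ρ (weierstrassʳ x₂ y₂)
      δ-inverse : ρ δ ℚ.* (ρ x₁ ℚ.- ρ x₂) ≡ 1ℚ

    respects : ∀ {s t} → s ≋ t → eval ρ s ≡ eval ρ t
    respects = eval-cong ρ on-curve₁ on-curve₂ δ-inverse

    y : ℕ → ℚ
    y n = eval ρ (Ψ′ n)

    y₁≡ : y 1 ≡ ρ x₁ ℚ.- ρ x₂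
    y₁≡ = respects Ψ₋₁
    y₂≡1 : y 2 ≡ 1ℚ
    y₂≡1 = respects Ψ₀
    y₃≡1 : y 3 ≡ 1ℚ
    y₃≡1 = respects Ψ₁

    coefficient : ℚ
    coefficient = eval ρ Universal.β₁ ℚ.* eval ρ Universal.β₁

    somos₄ : ∀ n → y (4 ℕ.+ n) ℚ.* y n ≡ coefficient ℚ.* (y (3 ℕ.+ n) ℚ.* y (1 ℕ.+ n))
               ℚ.+ ℚ.- eval ρ Universal.β₂ ℚ.* (y (2 ℕ.+ n) ℚ.* y (2 ℕ.+ n))
    somos₄ n = begin
      y (4 ℕ.+ n) ℚ.* y n
        ≡⟨ cong₂ (λ i j → eval ρ (Ψ i) ℚ.* eval ρ (Ψ j)) (i₄ (+ n)) (i₀ (+ n)) ⟨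
      eval ρ (Ψ (m ℤ.+ + 2)) ℚ.* eval ρ (Ψ (m ℤ.- + 2))
        ≡⟨ respects (somos m) ⟩
      b₁ ℚ.* (b₁ ℚ.* 1ℚ) ℚ.* (eval ρ (Ψ (m ℤ.+ + 1)) ℚ.* eval ρ (Ψ (m ℤ.- + 1)))
        ℚ.- eval ρ Universal.β₂ ℚ.* (y (2 ℕ.+ n) ℚ.* (y (2 ℕ.+ n) ℚ.* 1ℚ))
        ≡⟨ cong₂ (λ i j → b₁ ℚ.* (b₁ ℚ.* 1ℚ) ℚ.* (eval ρ (Ψ i) ℚ.* eval ρ (Ψ j))
               ℚ.- eval ρ Universal.β₂ ℚ.* (y (2 ℕ.+ n) ℚ.* (y (2 ℕ.+ n) ℚ.* 1ℚ))) (i₃ (+ n)) (i₁ (+ n)) ⟩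
      b₁ ℚ.* (b₁ ℚ.* 1ℚ) ℚ.* (y (3 ℕ.+ n) ℚ.* y (1 ℕ.+ n))
        ℚ.- eval ρ Universal.β₂ ℚ.* (y (2 ℕ.+ n) ℚ.* (y (2 ℕ.+ n) ℚ.* 1ℚ))
        ≡⟨ lem b₁ (y (3 ℕ.+ n) ℚ.* y (1 ℕ.+ n)) (eval ρ Universal.β₂) (y (2 ℕ.+ n)) ⟩
      coefficient ℚ.* (y (3 ℕ.+ n) ℚ.* y (1 ℕ.+ n))
        ℚ.+ ℚ.- eval ρ Universal.β₂ ℚ.* (y (2 ℕ.+ n) ℚ.* y (2 ℕ.+ n)) ∎
      where
      open ≡-Reasoning
      m : ℤ
      m = idx (2 ℕ.+ n)
      b₁ : ℚ
      b₁ = eval ρ Universal.β₁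
      i₄ : ∀ n → + 2 ℤ.+ n ℤ.- + 2 ℤ.+ + 2 ≡ + 4 ℤ.+ n ℤ.- + 2
      i₄ = ℤ-Solver.solve-∀
      i₀ : ∀ n → + 2 ℤ.+ n ℤ.- + 2 ℤ.- + 2 ≡ n ℤ.- + 2
      i₀ = ℤ-Solver.solve-∀
      i₃ : ∀ n → + 2 ℤ.+ n ℤ.- + 2 ℤ.+ + 1 ≡ + 3 ℤ.+ n ℤ.- + 2
      i₃ = ℤ-Solver.solve-∀
      i₁ : ∀ n → + 2 ℤ.+ n ℤ.- + 2 ℤ.- + 1 ≡ + 1 ℤ.+ n ℤ.- + 2
      i₁ = ℤ-Solver.solve-∀
      lem : ∀ b s c t → b ℚ.* (b ℚ.* 1ℚ) ℚ.* s ℚ.- c ℚ.* (t ℚ.* (t ℚ.* 1ℚ)) ≡ b ℚ.* b ℚ.* s ℚ.+ ℚ.- c ℚ.* (t ℚ.* t)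
      lem = solve-∀ ℚ-ring

  -- That is, Ψ₃ Ψ₋₂ - β₂ Ψ₂ Ψ₋₁.
  lastCoefficient : Expr
  lastCoefficient = Ψ′ 5 ⊗ Ψ′ 0 ⊕ ⊝ Universal.β₂ ⊗ (Ψ′ 4 ⊗ Ψ′ 1)

  -- Kept as an expression so that `evaluate-cong` can compare its values at p-adically close
  -- valuations.
  somos₅Defect : ℕ → Expr
  somos₅Defect n = Ψ′ (5 ℕ.+ n) ⊗ Ψ′ n ⊕ ⊝ Universal.β₂ ⊗ (Ψ′ (4 ℕ.+ n) ⊗ Ψ′ (1 ℕ.+ n))
    ⊕ ⊝ (lastCoefficient ⊗ (Ψ′ (3 ℕ.+ n) ⊗ Ψ′ (2 ℕ.+ n)))

  module _ {ρ} (V : IsCurveValuation ρ) where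
    open IsCurveValuation V
    open Somos₄ y coefficient (ℚ.- ℚ-Eval.eval ρ Universal.β₂) somos₄

    -- The Somos 4 coefficients are a square and the positive number `- β₂`, so positivity of four
    -- consecutive values spreads to all later ones and the quotients may be compared.
    somos₅-of-positive : 0ℚ ℚ.< y 1 → 0ℚ ℚ.< y 4 → 0ℚ ℚ.< ℚ.- ℚ-Eval.eval ρ Universal.β₂ →
      ∀ n → ℚ-Eval.eval ρ (somos₅Defect n) ≡ 0ℚ
    somos₅-of-positive 0<y₁ 0<y₄ 0<b n =
      trans (cong (ℚ._+ ℚ.- e) (somosQuotient-constant nonzero y₂≡1 y₃≡1 n)) (ℚ.+-inverseʳ e)
      where
      e : ℚ
      e = ℚ-Eval.eval ρ (lastCoefficient ⊗ (Ψ′ (3 ℕ.+ n) ⊗ Ψ′ (2 ℕ.+ n)))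
      0<1 : 0ℚ ℚ.< 1ℚ
      0<1 = ℚ.positive⁻¹ 1ℚ
      nonzero : ∀ n → y (2 ℕ.+ n) ≢ 0ℚ
      nonzero n = ℚ.<⇒≢ (positive (square-nonneg (ℚ-Eval.eval ρ Universal.β₁)) 0<b 0<y₁
        (subst (0ℚ ℚ.<_) (sym y₂≡1) 0<1) (subst (0ℚ ℚ.<_) (sym y₃≡1) 0<1) 0<y₄ (suc n)) ∘ sym

-- Archimedean bounds.

<-natural : ∀ r {m} → suc ∣ ↥ r ∣ ℕ.≤ m → r ℚ.< ι (+ m)
<-natural r@(mkℚ n d c) {m} n<m = ℚ.*<* (begin-strict
  n ℤ.* 1ℤ           ≡⟨ ℤ.*-identityʳ n ⟩
  n                  ≤⟨ n≤∣n∣ n ⟩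
  + ∣ n ∣            <⟨ ℤ.+<+ (ℕ.<-≤-trans n<m (ℕ.m≤m*n m (suc d))) ⟩
  + (m ℕ.* suc d)    ≡⟨ ℤ.pos-* m (suc d) ⟩
  + m ℤ.* + suc d    ∎)
  where
  open ℤ.≤-Reasoning
  n≤∣n∣ : ∀ n → n ℤ.≤ + ∣ n ∣
  n≤∣n∣ (+ n)    = ℤ.≤-refl
  n≤∣n∣ -[1+ n ] = ℤ.-≤+

0<shift : ∀ {r t} → ℚ.- r ℚ.< t → 0ℚ ℚ.< r ℚ.+ t
0<shift {r} {t} h = subst (ℚ._< r ℚ.+ t) (ℚ.+-inverseʳ r) (ℚ.+-mono-≤-< (ℚ.≤-refl {r}) h)

-- For large `t` each factor and summand of `(t - 1) (B + A t) + (B + C + A t)` is positive.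
quadratic-positive : ∀ A A⁻¹ B C → 0ℚ ℚ.< A → A ℚ.* A⁻¹ ≡ 1ℚ →
  ∃[ r ] ∀ t → r ℚ.< t → 0ℚ ℚ.< A ℚ.* (t ℚ.* t) ℚ.+ B ℚ.* t ℚ.+ C
quadratic-positive A A⁻¹ B C 0<A AA⁻¹≡1 = 1ℚ ℚ.⊔ (s ℚ.⊔ s′) , bound
  where
  s s′ : ℚ
  s  = A⁻¹ ℚ.* ℚ.- B
  s′ = A⁻¹ ℚ.* ℚ.- (B ℚ.+ C)
  scale : ∀ b t → A⁻¹ ℚ.* ℚ.- b ℚ.< t → 0ℚ ℚ.< b ℚ.+ A ℚ.* t
  scale b t h = 0<shift (subst (ℚ._< A ℚ.* t) eq (ℚ.*-monoʳ-<-pos A {{ℚ.positive 0<A}} h))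
    where eq : A ℚ.* (A⁻¹ ℚ.* ℚ.- b) ≡ ℚ.- b
          eq = trans (sym (ℚ.*-assoc A A⁻¹ (ℚ.- b))) (trans (cong (ℚ._* ℚ.- b) AA⁻¹≡1) (ℚ.*-identityˡ (ℚ.- b)))
  bound : ∀ t → 1ℚ ℚ.⊔ (s ℚ.⊔ s′) ℚ.< t → 0ℚ ℚ.< A ℚ.* (t ℚ.* t) ℚ.+ B ℚ.* t ℚ.+ C
  bound t r<t = subst (0ℚ ℚ.<_) (lem A B C t)
    (ℚ.+-mono-≤-< (*-nonneg (ℚ.<⇒≤ 0<t-1) (ℚ.<⇒≤ (scale B t s<t))) (scale (B ℚ.+ C) t s′<t))
    where
    1<t : 1ℚ ℚ.< t
    1<t = ℚ.≤-<-trans (ℚ.p≤p⊔q 1ℚ (s ℚ.⊔ s′)) r<t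
    s<t : s ℚ.< t
    s<t = ℚ.≤-<-trans (ℚ.≤-trans (ℚ.p≤p⊔q s s′) (ℚ.p≤q⊔p 1ℚ (s ℚ.⊔ s′))) r<t
    s′<t : s′ ℚ.< t
    s′<t = ℚ.≤-<-trans (ℚ.≤-trans (ℚ.p≤q⊔p s s′) (ℚ.p≤q⊔p 1ℚ (s ℚ.⊔ s′))) r<t
    0<t-1 : 0ℚ ℚ.< ℚ.- 1ℚ ℚ.+ t
    0<t-1 = 0<shift {ℚ.- 1ℚ} 1<t
    lem : ∀ A B C t → (ℚ.- 1ℚ ℚ.+ t) ℚ.* (B ℚ.+ A ℚ.* t) ℚ.+ (B ℚ.+ C ℚ.+ A ℚ.* t) ≡
                      A ℚ.* (t ℚ.* t) ℚ.+ B ℚ.* t ℚ.+ C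
    lem = solve-∀ ℚ-ring

-- Perturbing a pair of points p-adically.

-- The solution a₄, a₆ of the two Weierstrass equations.

cubicPart : (x y : Generator) → Expr
cubicPart x y = weierstrassˡ x y ⊕ ⊝ (gen x ⊗ gen x ⊗ gen x) ⊕ ⊝ (gen a₂ ⊗ (gen x ⊗ gen x))

linear constant : Expr
linear   = (cubicPart x₁ y₁ ⊕ ⊝ cubicPart x₂ y₂) ⊗ gen δ
constant = cubicPart x₁ y₁ ⊕ ⊝ (linear ⊗ gen x₁)

-- `Ψ₂` without its summand `a₂`; multiples and powers are spelled as they unfold, so that
-- evaluation agrees with that of `Ψ₂` by computation up to bracketing.
Ψ₂-remainder : Expr
Ψ₂-remainder = gen x₁ ⊕ (gen x₁ ⊕ 𝟘) ⊕ gen x₂ ⊕ ⊝ (Universal.slope ⊗ (Universal.slope ⊗ 𝟙))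
  ⊕ ⊝ (gen a₁ ⊗ Universal.slope)

module Perturbation {p : ℕ} (p-prime : Prime p) (𝚿 : TranslatedDivisionPolynomials) where
  open Localisation p-prime
  open Reduction p-prime
  open TranslatedDivision 𝚿
  open TranslatedDivisionPolynomials 𝚿 using (Ψ₂)

  multiple-above : ∀ k r → ∃[ h ] r ℚ.< P k ℚ.* ι (+ h)
  multiple-above k r = h , subst (r ℚ.<_)
      (trans (cong ι (ℤ.pos-* (p ℕ.^ k) h)) (ι-* (+ (p ℕ.^ k)) (+ h)))
      (<-natural r (ℕ.m≤n*m h (p ℕ.^ k) {{ℕ.m^n≢0 p k {{prime⇒nonZero p-prime}}}}))
    where h = suc ∣ ↥ r ∣

  -- The values of `a₄` and `a₆` are solved for anew, so that both points stay on the curve however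
  -- the other values are moved.
  complete : (Generator → ℤ₍ₚ₎) → Generator → ℤ₍ₚ₎
  complete ρ a₄ = evaluate ρ linear
  complete ρ a₆ = evaluate ρ constant
  complete ρ g  = ρ g

  complete-on-curve : ∀ ρ → val (ρ δ) ℚ.* (val (ρ x₁) ℚ.- val (ρ x₂)) ≡ 1ℚ → IsCurveValuation (val ∘ complete ρ)
  complete-on-curve ρ δ-inverse = record
    { on-curve₁ = first A₁ A₂ A₃ X Y (val (evaluate ρ linear))
    -- The first equation holds by the choice of `a₆`; the second holds up to the term
    -- `(g₁ - g₂) (1 - δ (x₁ - x₂))`, which vanishes.
    ; on-curve₂ = trans (sym (trans (cong (λ z → base ℚ.+ (g₁ ℚ.+ ℚ.- g₂) ℚ.* (1ℚ ℚ.+ ℚ.- z)) δ-inverse) (second′ A₁ A₂ A₃ X Y Z W)))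
                        (second A₂ X Z (val (ρ δ)) g₁ g₂)
    ; δ-inverse = δ-inverse
    }
    where
    A₁ A₂ A₃ X Y Z W g₁ g₂ base : ℚ
    A₁ = val (ρ a₁)
    A₂ = val (ρ a₂)
    A₃ = val (ρ a₃)
    X = val (ρ x₁)
    Y = val (ρ y₁)
    Z = val (ρ x₂)
    W = val (ρ y₂)
    g₁ = val (evaluate ρ (cubicPart x₁ y₁))
    g₂ = val (evaluate ρ (cubicPart x₂ y₂))
    base = Z ℚ.* Z ℚ.* Z ℚ.+ A₂ ℚ.* (Z ℚ.* Z) ℚ.+ g₂
    first : ∀ a b c x y e → y ℚ.* y ℚ.+ a ℚ.* x ℚ.* y ℚ.+ c ℚ.* y ≡
      x ℚ.* x ℚ.* x ℚ.+ b ℚ.* (x ℚ.* x) ℚ.+ e ℚ.* x ℚ.+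
      (y ℚ.* y ℚ.+ a ℚ.* x ℚ.* y ℚ.+ c ℚ.* y ℚ.+ ℚ.- (x ℚ.* x ℚ.* x) ℚ.+ ℚ.- (b ℚ.* (x ℚ.* x)) ℚ.+ ℚ.- (e ℚ.* x))
    first = solve-∀ ℚ-ring
    second : ∀ b x z d g h → z ℚ.* z ℚ.* z ℚ.+ b ℚ.* (z ℚ.* z) ℚ.+ h ℚ.+ (g ℚ.+ ℚ.- h) ℚ.* (1ℚ ℚ.+ ℚ.- (d ℚ.* (x ℚ.+ ℚ.- z))) ≡
      z ℚ.* z ℚ.* z ℚ.+ b ℚ.* (z ℚ.* z) ℚ.+ (g ℚ.+ ℚ.- h) ℚ.* d ℚ.* z ℚ.+ (g ℚ.+ ℚ.- ((g ℚ.+ ℚ.- h) ℚ.* d ℚ.* x))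
    second = solve-∀ ℚ-ring
    second′ : ∀ a b c x y z w →
      z ℚ.* z ℚ.* z ℚ.+ b ℚ.* (z ℚ.* z) ℚ.+
        (w ℚ.* w ℚ.+ a ℚ.* z ℚ.* w ℚ.+ c ℚ.* w ℚ.+ ℚ.- (z ℚ.* z ℚ.* z) ℚ.+ ℚ.- (b ℚ.* (z ℚ.* z))) ℚ.+
        (y ℚ.* y ℚ.+ a ℚ.* x ℚ.* y ℚ.+ c ℚ.* y ℚ.+ ℚ.- (x ℚ.* x ℚ.* x) ℚ.+ ℚ.- (b ℚ.* (x ℚ.* x))
         ℚ.+ ℚ.- (w ℚ.* w ℚ.+ a ℚ.* z ℚ.* w ℚ.+ c ℚ.* w ℚ.+ ℚ.- (z ℚ.* z ℚ.* z) ℚ.+ ℚ.- (b ℚ.* (z ℚ.* z))))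
        ℚ.* (1ℚ ℚ.+ ℚ.- 1ℚ) ≡
      w ℚ.* w ℚ.+ a ℚ.* z ℚ.* w ℚ.+ c ℚ.* w
    second′ = solve-∀ ℚ-ring

  module _ {ρ : Generator → ℤ₍ₚ₎} (V : IsCurveValuation (val ∘ ρ)) where
    open IsCurveValuation V

    private
      cubic-value : ∀ {l a b c x} → l ≡ x ℚ.* x ℚ.* x ℚ.+ a ℚ.* (x ℚ.* x) ℚ.+ b ℚ.* x ℚ.+ c →
        l ℚ.+ ℚ.- (x ℚ.* x ℚ.* x) ℚ.+ ℚ.- (a ℚ.* (x ℚ.* x)) ≡ b ℚ.* x ℚ.+ c
      cubic-value {l} {a} {b} {c} {x} refl = lem a b c x
        where lem : ∀ a b c x → x ℚ.* x ℚ.* x ℚ.+ a ℚ.* (x ℚ.* x) ℚ.+ b ℚ.* x ℚ.+ c ℚ.+ ℚ.- (x ℚ.* x ℚ.* x) ℚ.+ ℚ.- (a ℚ.* (x ℚ.* x)) ≡ b ℚ.* x ℚ.+ c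
              lem = solve-∀ ℚ-ring

      A₄ A₆ X Z : ℚ
      A₄ = val (ρ a₄)
      A₆ = val (ρ a₆)
      X = val (ρ x₁)
      Z = val (ρ x₂)

      g₁ : val (evaluate ρ (cubicPart x₁ y₁)) ≡ A₄ ℚ.* X ℚ.+ A₆
      g₁ = cubic-value {a = val (ρ a₂)} {A₄} {A₆} {X} on-curve₁
      g₂ : val (evaluate ρ (cubicPart x₂ y₂)) ≡ A₄ ℚ.* Z ℚ.+ A₆
      g₂ = cubic-value {a = val (ρ a₂)} {A₄} {A₆} {Z} on-curve₂

    linear-value : val (evaluate ρ linear) ≡ A₄
    linear-value = trans (cong₂ (λ g h → (g ℚ.+ ℚ.- h) ℚ.* val (ρ δ)) g₁ g₂)
      (trans (lem A₄ A₆ X Z (val (ρ δ))) (trans (cong (A₄ ℚ.*_) δ-inverse) (ℚ.*-identityʳ A₄)))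
      where lem : ∀ a b x z d → (a ℚ.* x ℚ.+ b ℚ.+ ℚ.- (a ℚ.* z ℚ.+ b)) ℚ.* d ≡ a ℚ.* (d ℚ.* (x ℚ.+ ℚ.- z))
            lem = solve-∀ ℚ-ring

    constant-value : val (evaluate ρ constant) ≡ A₆
    constant-value = trans (cong₂ (λ g l → g ℚ.+ ℚ.- (l ℚ.* X)) g₁ linear-value) (lem A₄ A₆ X)
      where lem : ∀ a b x → a ℚ.* x ℚ.+ b ℚ.+ ℚ.- (a ℚ.* x) ≡ b
            lem = solve-∀ ℚ-ring

    -- Completing `ρ` itself recovers its own `a₄` and `a₆`, so completing a nearby valuation stays
    -- nearby.
    complete-cong : ∀ {ρ′ k} → (∀ g → ρ′ g ≡ ρ g [ k ]) → ∀ g → complete ρ′ g ≡ ρ g [ k ]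
    complete-cong h a₄ = []-trans (evaluate-cong h linear) (≡⇒≡[] linear-value)
    complete-cong h a₆ = []-trans (evaluate-cong h constant) (≡⇒≡[] constant-value)
    complete-cong h a₁ = h a₁
    complete-cong h a₂ = h a₂
    complete-cong h a₃ = h a₃
    complete-cong h x₁ = h x₁
    complete-cong h y₁ = h y₁
    complete-cong h x₂ = h x₂
    complete-cong h y₂ = h y₂
    complete-cong h δ  = h δ

    module _ (u δ′ : ℤ₍ₚ₎) (δ′-inverse : val δ′ ℚ.* (val (ρ x₁) ℚ.- (val (ρ x₂) ℚ.+ ℚ.- val u)) ≡ 1ℚ) where

      -- Moving `x₂` makes `Ψ₋₁ = x₁ - x₂` positive. The shift `t` of `a₂` enters `Ψ₂` with
      -- coefficient one and `- β₂` quadratically with leading coefficient `(x₁ - x₂)²`, so a large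
      -- `t` makes both positive.
      shifted : ℤ₍ₚ₎ → Generator → ℤ₍ₚ₎
      shifted t a₂ = ρ a₂ ⊞ t
      shifted t x₂ = ρ x₂ ⊞ ⊟ u
      shifted t δ  = δ′
      shifted t g  = ρ g

      V′ : ∀ t → IsCurveValuation (val ∘ complete (shifted t))
      V′ t = complete-on-curve (shifted t) δ′-inverse

      private
        c′ : ℚ
        c′ = val (ρ x₁) ℚ.- (val (ρ x₂) ℚ.+ ℚ.- val u)
        value : ℤ₍ₚ₎ → Expr → ℚ
        value t = ℚ-Eval.eval (val ∘ complete (shifted t))
        X₀ b : ℚ
        X₀ = value 𝟎 tangentNumerator
        b  = value 𝟎 Universal.β₁

      -- Adding `t` to `a₂` lowers the solution `a₄` by `t (x₁ + x₂)`, with the shifted `x₂`. With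
      -- the change `2 t x₁` of the term `2 a₂ x₁` this leaves `t (x₁ - x₂)`.
      tangentNumerator-shift : ∀ t → value t tangentNumerator ≡ X₀ ℚ.+ c′ ℚ.* val t
      tangentNumerator-shift t = trans
        (cong₂ (λ g h → T ℚ.+ ((A₂ ℚ.+ val t) ℚ.* X ℚ.+ ((A₂ ℚ.+ val t) ℚ.* X ℚ.+ 0ℚ)) ℚ.+ (g ℚ.+ ℚ.- h) ℚ.* val δ′ ℚ.+ ℚ.- (A₁ ℚ.* Y))
          (cubic A₂ X (value t (weierstrassˡ x₁ y₁)) (val t)) (cubic A₂ Z′ (value t (weierstrassˡ x₂ y₂)) (val t)))
        (trans (lem T A₂ X Z′ (val δ′) (val (evaluate (shifted 𝟎) (cubicPart x₁ y₁))) (val (evaluate (shifted 𝟎) (cubicPart x₂ y₂))) (val t) (ℚ.- (A₁ ℚ.* Y)))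
          (trans (cong (λ k → X₀ ℚ.+ ((X ℚ.+ X) ℚ.+ ℚ.- ((X ℚ.+ Z′) ℚ.* k)) ℚ.* val t) δ′-inverse) (lem′ X₀ X Z′ (val t))))
        where
        T A₁ A₂ Y Z′ : ℚ
        T = value 𝟎 ((gen x₁ ⊗ (gen x₁ ⊗ 𝟙)) ⊕ (gen x₁ ⊗ (gen x₁ ⊗ 𝟙) ⊕ (gen x₁ ⊗ (gen x₁ ⊗ 𝟙) ⊕ 𝟘)))
        A₁ = val (ρ a₁)
        A₂ = val (ρ a₂)
        Y = val (ρ y₁)
        Z′ = Z ℚ.+ ℚ.- val u
        cubic : ∀ a x l t → l ℚ.+ ℚ.- (x ℚ.* x ℚ.* x) ℚ.+ ℚ.- ((a ℚ.+ t) ℚ.* (x ℚ.* x)) ≡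
          l ℚ.+ ℚ.- (x ℚ.* x ℚ.* x) ℚ.+ ℚ.- ((a ℚ.+ 0ℚ) ℚ.* (x ℚ.* x)) ℚ.+ ℚ.- (t ℚ.* (x ℚ.* x))
        cubic = solve-∀ ℚ-ring
        lem : ∀ s a x z d g h t r →
          s ℚ.+ ((a ℚ.+ t) ℚ.* x ℚ.+ ((a ℚ.+ t) ℚ.* x ℚ.+ 0ℚ)) ℚ.+
            (g ℚ.+ ℚ.- (t ℚ.* (x ℚ.* x)) ℚ.+ ℚ.- (h ℚ.+ ℚ.- (t ℚ.* (z ℚ.* z)))) ℚ.* d ℚ.+ r ≡
          s ℚ.+ ((a ℚ.+ 0ℚ) ℚ.* x ℚ.+ ((a ℚ.+ 0ℚ) ℚ.* x ℚ.+ 0ℚ)) ℚ.+ (g ℚ.+ ℚ.- h) ℚ.* d ℚ.+ r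
            ℚ.+ ((x ℚ.+ x) ℚ.+ ℚ.- ((x ℚ.+ z) ℚ.* (d ℚ.* (x ℚ.+ ℚ.- z)))) ℚ.* t
        lem = solve-∀ ℚ-ring
        lem′ : ∀ s x z t → s ℚ.+ ((x ℚ.+ x) ℚ.+ ℚ.- ((x ℚ.+ z) ℚ.* 1ℚ)) ℚ.* t ≡ s ℚ.+ (x ℚ.+ ℚ.- z) ℚ.* t
        lem′ = solve-∀ ℚ-ring

      -- In `duplicationForm` the multiple of the curve defect vanishes and `β₁` does not depend on
      -- `t`, so the change comes from `a₂` and the tangent numerator.
      β₂-shift : ∀ t → ℚ.- value t Universal.β₂ ≡
        c′ ℚ.* c′ ℚ.* (val t ℚ.* val t)
        ℚ.+ ((X₀ ℚ.+ X₀) ℚ.* c′ ℚ.+ val (ρ a₁) ℚ.* b ℚ.* c′ ℚ.- b ℚ.* b) ℚ.* val t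
        ℚ.+ (X₀ ℚ.* X₀ ℚ.+ val (ρ a₁) ℚ.* b ℚ.* X₀ ℚ.- b ℚ.* b ℚ.* (value 𝟎 three ℚ.* X ℚ.+ val (ρ a₂)))
      β₂-shift t = trans (cong ℚ.-_ (trans (duplication-ℚ (val ∘ complete (shifted t)))
          (cong₂ (λ x d → b ℚ.* b ℚ.* (value 𝟎 three ℚ.* X ℚ.+ (val (ρ a₂) ℚ.+ val t)) ℚ.+ ℚ.- (x ℚ.* x) ℚ.+ ℚ.- (val (ρ a₁) ℚ.* x ℚ.* b)
                           ℚ.+ ℚ.- (value t (twelve ⊗ gen x₁ ⊕ Weierstrass.b₂ universalRing universalCurve) ℚ.* d))
            (tangentNumerator-shift t) defect≡0)))
        (lem b (value 𝟎 three ℚ.* X) (val (ρ a₂)) (val t) X₀ c′ (val (ρ a₁))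
          (value t (twelve ⊗ gen x₁ ⊕ Weierstrass.b₂ universalRing universalCurve)))
        where
        defect≡0 : value t curveDefect ≡ 0ℚ
        defect≡0 = trans (cong (ℚ._+ ℚ.- value t (weierstrassʳ x₁ y₁)) (IsCurveValuation.on-curve₁ (V′ t)))
                     (ℚ.+-inverseʳ (value t (weierstrassʳ x₁ y₁)))
        lem : ∀ b w a t s c e κ →
          ℚ.- (b ℚ.* b ℚ.* (w ℚ.+ (a ℚ.+ t)) ℚ.+ ℚ.- ((s ℚ.+ c ℚ.* t) ℚ.* (s ℚ.+ c ℚ.* t)) ℚ.+ ℚ.- (e ℚ.* (s ℚ.+ c ℚ.* t) ℚ.* b) ℚ.+ ℚ.- (κ ℚ.* 0ℚ)) ≡
          c ℚ.* c ℚ.* (t ℚ.* t) ℚ.+ ((s ℚ.+ s) ℚ.* c ℚ.+ e ℚ.* b ℚ.* c ℚ.- b ℚ.* b) ℚ.* t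
          ℚ.+ (s ℚ.* s ℚ.+ e ℚ.* b ℚ.* s ℚ.- b ℚ.* b ℚ.* (w ℚ.+ a))
        lem = solve-∀ ℚ-ring

      Ψ₂-shift : ∀ t → value t (Ψ′ 4) ≡ value 𝟎 Ψ₂-remainder ℚ.+ val (ρ a₂) ℚ.+ val t
      Ψ₂-shift t = trans (IsCurveValuation.respects (V′ t) Ψ₂)
        (sym (ℚ.+-assoc (value 𝟎 Ψ₂-remainder) (val (ρ a₂)) (val t)))

      somos₅-of-large-shift : 0ℚ ℚ.< c′ → ∃[ r ] ∀ t → r ℚ.< val t →
        ∀ n → value t (somos₅Defect n) ≡ 0ℚ
      somos₅-of-large-shift 0<c′ = r ℚ.⊔ ℚ.- κ , λ t r<t → somos₅-of-positive (V′ t)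
            (subst (0ℚ ℚ.<_) (sym (IsCurveValuation.y₁≡ (V′ t))) 0<c′)
            (subst (0ℚ ℚ.<_) (sym (Ψ₂-shift t)) (0<shift (ℚ.≤-<-trans (ℚ.p≤q⊔p r (ℚ.- κ)) r<t)))
            (subst (0ℚ ℚ.<_) (sym (β₂-shift t)) (proj₂ β₂-bound (val t) (ℚ.≤-<-trans (ℚ.p≤p⊔q r (ℚ.- κ)) r<t)))
        where
        lem : ∀ c d → c ℚ.* c ℚ.* (d ℚ.* d) ≡ d ℚ.* c ℚ.* (d ℚ.* c)
        lem = solve-∀ ℚ-ring
        κ B C r : ℚ
        κ = value 𝟎 Ψ₂-remainder ℚ.+ val (ρ a₂)
        B = (X₀ ℚ.+ X₀) ℚ.* c′ ℚ.+ val (ρ a₁) ℚ.* b ℚ.* c′ ℚ.- b ℚ.* b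
        C = X₀ ℚ.* X₀ ℚ.+ val (ρ a₁) ℚ.* b ℚ.* X₀ ℚ.- b ℚ.* b ℚ.* (value 𝟎 three ℚ.* X ℚ.+ val (ρ a₂))
        β₂-bound : ∃[ r ] ∀ t → r ℚ.< t → 0ℚ ℚ.< c′ ℚ.* c′ ℚ.* (t ℚ.* t) ℚ.+ B ℚ.* t ℚ.+ C
        β₂-bound = quadratic-positive (c′ ℚ.* c′) (val δ′ ℚ.* val δ′) B C
          (*-pos 0<c′ 0<c′) (trans (lem c′ (val δ′)) (cong₂ ℚ._*_ δ′-inverse δ′-inverse))
        r = proj₁ β₂-bound

    -- Moving x₂ and a₂ by large multiples of pᵏ⁺¹ makes all the Ψₙ positive.
    somos₅-mod : (ρ x₁ ⊞ ⊟ ρ x₂) ≢0 → ∀ k n → evaluate ρ (somos₅Defect n) ≡ 𝟎 [ suc k ]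
    somos₅-mod c≢0 k n = []-trans ([]-sym (evaluate-cong (complete-cong shifted≡) (somos₅Defect n)))
        (≡⇒≡[] (trans (val-evaluate (complete (shifted u δ′ δ′-inverse t)) (somos₅Defect n)) (proj₂ large t r<t n)))
      where
      h : ℕ
      h = proj₁ (multiple-above (suc k) (ℚ.- (X ℚ.- Z)))
      π u : ℤ₍ₚ₎
      π = int (+ (p ℕ.^ suc k))
      u = π ⊠ int (+ h)
      π≡0 : ∀ z → π ⊠ int z ≡ 𝟎 [ suc k ]
      π≡0 z = cong-by (int z) (sym (ℚ.+-identityˡ (P (suc k) ℚ.* ι z)))
      x₂≡ : ρ x₂ ⊞ ⊟ u ≡ ρ x₂ [ suc k ]
      x₂≡ = []-trans (⊞-cong []-refl (⊟-cong (π≡0 (+ h)))) (≡⇒≡[] (ℚ.+-identityʳ Z))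
      c′ : ℤ₍ₚ₎
      c′ = ρ x₁ ⊞ ⊟ (ρ x₂ ⊞ ⊟ u)
      c′≡c : c′ ≡ ρ x₁ ⊞ ⊟ ρ x₂ [ suc k ]
      c′≡c = ⊞-cong []-refl (⊟-cong x₂≡)
      c′≢0 : c′ ≢0
      c′≢0 eq = c≢0 ([]-trans ([]-sym ([]-weaken 1 {k} c′≡c)) eq)
      0<c′ : 0ℚ ℚ.< val c′
      0<c′ = subst (0ℚ ℚ.<_) (lem X Z (val u)) (0<shift {X ℚ.- Z} (proj₂ (multiple-above (suc k) (ℚ.- (X ℚ.- Z)))))
        where lem : ∀ x z u → x ℚ.+ ℚ.- z ℚ.+ u ≡ x ℚ.+ ℚ.- (z ℚ.+ ℚ.- u)
              lem = solve-∀ ℚ-ring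
      δ′ : ℤ₍ₚ₎
      δ′ = proj₁ (unit-inverse c′ c′≢0)
      δ′-inverse : val δ′ ℚ.* val c′ ≡ 1ℚ
      δ′-inverse = proj₂ (unit-inverse c′ c′≢0)
      δ≡ : δ′ ≡ ρ δ [ suc k ]
      -- Inverses of congruent units are congruent.
      δ≡ = ⊠-cancelʳ c′≢0 ([]-trans (≡⇒≡[] {b = ρ δ ⊠ (ρ x₁ ⊞ ⊟ ρ x₂)} (trans δ′-inverse (sym δ-inverse)))
             (⊠-cong []-refl ([]-sym c′≡c)))
      -- The bound for `t` depends on `u`, hence `x₂` is moved before `a₂`.
      large : ∃[ r ] ∀ t → r ℚ.< val t → ∀ n →
        ℚ-Eval.eval (val ∘ complete (shifted u δ′ δ′-inverse t)) (somos₅Defect n) ≡ 0ℚ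
      large = somos₅-of-large-shift u δ′ δ′-inverse 0<c′
      t : ℤ₍ₚ₎
      t = π ⊠ int (+ proj₁ (multiple-above (suc k) (proj₁ large)))
      r<t : proj₁ large ℚ.< val t
      r<t = proj₂ (multiple-above (suc k) (proj₁ large))
      shifted≡ : ∀ g → shifted u δ′ δ′-inverse t g ≡ ρ g [ suc k ]
      shifted≡ a₂ = []-trans (⊞-cong []-refl (π≡0 _)) (≡⇒≡[] (ℚ.+-identityʳ (val (ρ a₂))))
      shifted≡ x₂ = x₂≡
      shifted≡ δ  = δ≡
      shifted≡ a₁ = []-refl
      shifted≡ a₃ = []-refl
      shifted≡ a₄ = []-refl
      shifted≡ a₆ = []-refl
      shifted≡ x₁ = []-refl
      shifted≡ y₁ = []-refl
      shifted≡ y₂ = []-refl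

    ≡0-of-all-powers : ∀ {a} → (∀ k → a ≡ 𝟎 [ suc k ]) → val a ≡ 0ℚ
    ≡0-of-all-powers {a} h with ↥ val a ℤ.≟ 0ℤ
    ... | yes n≡0 = ℚ.↥p≡0⇒p≡0 (val a) n≡0
    -- With the absolute value of the numerator as exponent, the power of `p` already exceeds the
    -- nonzero numerator it should divide.
    ... | no n≢0  = contradiction (ℕ.∣⇒≤ {{ℕ.≢-nonZero (n≢0 ∘ ℤ.∣i∣≡0⇒i≡0)}} (∣numerator (h ∣ ↥ val a ∣)))
      (ℕ.<⇒≱ (ℕ.<-trans (ℕ.n<1+n _) (n<m^n p (suc ∣ ↥ val a ∣) (ℕ.nonTrivial⇒n>1 p {{prime⇒nonTrivial p-prime}}))))

    somos₅-relation : (ρ x₁ ⊞ ⊟ ρ x₂) ≢0 → ∀ n → val (evaluate ρ (somos₅Defect n)) ≡ 0ℚ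
    somos₅-relation c≢0 n = ≡0-of-all-powers {evaluate ρ (somos₅Defect n)} (λ k → somos₅-mod c≢0 k n)

-- From pairs of points to integral Somos sequences.

eval-≗ : ∀ {ρ ρ′ : Generator → ℚ} → (∀ g → ρ g ≡ ρ′ g) → ∀ e → ℚ-Eval.eval ρ e ≡ ℚ-Eval.eval ρ′ e
eval-≗ h (gen g) = h g
eval-≗ h 𝟘       = refl
eval-≗ h 𝟙       = refl
eval-≗ h (s ⊕ t) = cong₂ ℚ._+_ (eval-≗ h s) (eval-≗ h t)
eval-≗ h (s ⊗ t) = cong₂ ℚ._*_ (eval-≗ h s) (eval-≗ h t)
eval-≗ h (⊝ s)   = cong ℚ.-_ (eval-≗ h s)

LimitExists-≗ : ∀ {p v w} → (∀ i → v i ≡ w i) → LimitExistsInℤₚ p v → LimitExistsInℤₚ p w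
LimitExists-≗ {p} h (a , converges) = a , λ k → proj₁ (converges k) , λ i I≤i →
  subst (λ r → + k ≤ord[ p ] (r ℚ.- (ℤₚ.residue a k ℚ./ 1))) (h i) (proj₂ (converges k) i I≤i)

module Pairs {p : ℕ} (p-prime : Prime p) (𝚿 : TranslatedDivisionPolynomials) where
  open Localisation p-prime
  open Dynamics p-prime
  open Reduction p-prime
  open Slopes p-prime
  open TranslatedDivision 𝚿
  open TranslatedDivisionPolynomials 𝚿 using (Ψ)
  open Perturbation p-prime 𝚿
  open Mod p-prime
  open ResidueField p-prime using (_≈ₚ_)

  -- If `p` divides the denominator, then either it also divides the numerator, against lowest
  -- terms, or the order is negative.
  0≤ord⇒integral : ∀ {r} → 0ℤ ≤ord[ p ] r → IsIntegral p r
  0≤ord⇒integral (inj₁ refl) = p∤1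
  0≤ord⇒integral {r} (inj₂ (v , (e , zero , _ , (_ , p∤↧r) , _) , 0≤v)) p∣↧r =
    p∤↧r (subst (ℕ._∣ ↧ₙ r) (sym (ℕ.^-identityʳ p)) p∣↧r)
  0≤ord⇒integral {r} (inj₂ (v , (zero , suc f , _ , _ , refl) , 0≤v)) p∣↧r = contradiction 0≤v λ ()
  0≤ord⇒integral {mkℚ n d c} (inj₂ (v , (suc e , suc f , (pᵉ∣n , _) , _ , _) , 0≤v)) p∣↧r =
    p∤1 (ℕ.∣-reflexive (Coprimality.recompute c (ℕ.∣-trans (ℕ.m∣m*n (p ℕ.^ e)) pᵉ∣n , p∣↧r)))

  module _ {ρ : Generator → ℤ₍ₚ₎} (V : IsCurveValuation (val ∘ ρ))
           (c≢0 : (ρ x₁ ⊞ ⊟ ρ x₂) ≢0) (β₂≢0 : evaluate ρ Universal.β₂ ≢0) where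
    open IsCurveValuation V using (y; y₂≡1; somos₄)

    private
      x : ℕ → ℤ₍ₚ₎
      x n = evaluate ρ (Ψ′ n)
      B₁ B₂ : ℤ₍ₚ₎
      B₁ = evaluate ρ Universal.β₁ ⊠ evaluate ρ Universal.β₁
      B₂ = evaluate ρ Universal.β₂
      v : ∀ n → val (x n) ≡ y n
      v n = val-evaluate ρ (Ψ′ n)

      relation₄ : ∀ n → val (x (4 ℕ.+ n) ⊠ x n) ≡
        val (bilinear B₁ (⊟ B₂) (x (3 ℕ.+ n)) (x (1 ℕ.+ n)) (x (2 ℕ.+ n)) (x (2 ℕ.+ n)))
      relation₄ n = trans (cong₂ ℚ._*_ (v (4 ℕ.+ n)) (v n)) (trans (somos₄ n)
        (cong₂ ℚ._+_ (cong ((val B₁) ℚ.*_) (cong₂ ℚ._*_ (sym (v (3 ℕ.+ n))) (sym (v (1 ℕ.+ n)))))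
                     (cong (ℚ.- (val B₂) ℚ.*_) (cong₂ ℚ._*_ (sym (v (2 ℕ.+ n))) (sym (v (2 ℕ.+ n)))))))

      relation₅ : ∀ n → val (x (5 ℕ.+ n) ⊠ x n) ≡
        val (bilinear B₂ (evaluate ρ lastCoefficient) (x (4 ℕ.+ n)) (x (1 ℕ.+ n)) (x (3 ℕ.+ n)) (x (2 ℕ.+ n)))
      relation₅ n = trans (lem (val (x (5 ℕ.+ n) ⊠ x n)) (val B₂) (val (x (4 ℕ.+ n) ⊠ x (1 ℕ.+ n)))
                             (val (evaluate ρ lastCoefficient)) (val (x (3 ℕ.+ n) ⊠ x (2 ℕ.+ n))))
          (trans (cong (λ z → z ℚ.+ r) (somos₅-relation V c≢0 n)) (ℚ.+-identityˡ r))
        where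
        r : ℚ
        r = val (bilinear B₂ (evaluate ρ lastCoefficient) (x (4 ℕ.+ n)) (x (1 ℕ.+ n)) (x (3 ℕ.+ n)) (x (2 ℕ.+ n)))
        lem : ∀ s b t d u → s ≡ s ℚ.+ ℚ.- b ℚ.* t ℚ.+ ℚ.- (d ℚ.* u) ℚ.+ (b ℚ.* t ℚ.+ d ℚ.* u)
        lem = solve-∀ ℚ-ring

      -- Descent: if two neighbours vanish modulo `p`, Somos 4 makes `β₂` times the square of the
      -- preceding term vanish, and `β₂` is a unit. The descent ends at `Ψ₀ = 1`.
      not-both-zero : ∀ n → x (2 ℕ.+ n) ≡ 𝟎 [ 1 ] → ¬ x (3 ℕ.+ n) ≡ 𝟎 [ 1 ]
      not-both-zero zero    h₂ _  = 𝟏≢0 ([]-trans (≡⇒≡[] (sym (trans (v 2) y₂≡1))) h₂)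
      not-both-zero (suc n) h₃ h₄ = not-both-zero n h₂ h₃
        where
        lem : ∀ b t r → t ℚ.* b ≡ r ℚ.+ ℚ.- (r ℚ.+ ℚ.- b ℚ.* t)
        lem = solve-∀ ℚ-ring
        first : ℤ₍ₚ₎
        first = B₁ ⊠ (x (3 ℕ.+ n) ⊠ x (1 ℕ.+ n))
        zero₁ : ∀ z → 𝟎 ⊠ z ≡ 𝟎 [ 1 ]
        zero₁ z = ≡⇒≡[] (ℚ.*-zeroˡ (val z))
        square≡0 : x (2 ℕ.+ n) ⊠ x (2 ℕ.+ n) ⊠ B₂ ≡ 𝟎 [ 1 ]
        square≡0 = []-trans
          (≡⇒≡[] {b = first ⊞ ⊟ (x (4 ℕ.+ n) ⊠ x n)}
            (trans (lem (val B₂) (val (x (2 ℕ.+ n) ⊠ x (2 ℕ.+ n))) (val first))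
              (cong (λ z → val first ℚ.+ ℚ.- z) (sym (relation₄ n)))))
          ([]-trans (⊞-cong
            ([]-trans (⊠-cong ([]-refl {B₁}) ([]-trans (⊠-cong h₃ []-refl) (zero₁ (x (1 ℕ.+ n))))) (≡⇒≡[] {B₁ ⊠ 𝟎} (ℚ.*-zeroʳ (val B₁))))
            (⊟-cong ([]-trans (⊠-cong h₄ []-refl) (zero₁ (x n)))))
            (≡⇒≡[] {𝟎 ⊞ ⊟ 𝟎} refl))
        h₂ : x (2 ℕ.+ n) ≡ 𝟎 [ 1 ]
        h₂ with x (2 ℕ.+ n) ≡0?
        ... | yes h = h
        ... | no x≢0 = ≡0-product (≡0-product square≡0 β₂≢0) x≢0

    -- The offset 2 makes the sequence start at `Ψ₀`, from where on `not-both-zero` applies.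
    isSomos : IsSomos (λ n → evaluate ρ (Ψ′ (n ℕ.+ 2))) (evaluate ρ Universal.β₁ ⊠ evaluate ρ Universal.β₁)
      (⊟ evaluate ρ Universal.β₂) (evaluate ρ Universal.β₂) (evaluate ρ lastCoefficient)
    isSomos = record
      { somos₄ = λ n → relation₄ (n ℕ.+ 2)
      ; somos₅ = λ n → relation₅ (n ℕ.+ 2)
      ; units  = units
      }
      where
      units : ∀ n → x (n ℕ.+ 2) ≢0 ⊎ x (1 ℕ.+ (n ℕ.+ 2)) ≢0
      units n with x (n ℕ.+ 2) ≡0?
      ... | no x≢0 = inj₁ x≢0
      ... | yes h  = inj₂ (subst (λ k → x k ≢0) (cong suc (ℕ.+-comm 2 n))
                       (not-both-zero n (subst (λ k → x k ≡ 𝟎 [ 1 ]) (ℕ.+-comm n 2) h)))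

  module _ {E : WeierstrassCurve ℚ} (E-integral : IntegralCurve p E) where
    private
      module E = WeierstrassCurve E
      module E-int = IntegralCurve E-integral
      Ẽ : WeierstrassCurve ℤ
      Ẽ = reduceCurve E-integral

    coefficients : (X Y Z W D : ℤ₍ₚ₎) → Generator → ℤ₍ₚ₎
    coefficients X Y Z W D a₁ = E.a₁ ⟨ E-int.a₁-integral ⟩
    coefficients X Y Z W D a₂ = E.a₂ ⟨ E-int.a₂-integral ⟩
    coefficients X Y Z W D a₃ = E.a₃ ⟨ E-int.a₃-integral ⟩
    coefficients X Y Z W D a₄ = E.a₄ ⟨ E-int.a₄-integral ⟩
    coefficients X Y Z W D a₆ = E.a₆ ⟨ E-int.a₆-integral ⟩
    coefficients X Y Z W D x₁ = X
    coefficients X Y Z W D y₁ = Y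
    coefficients X Y Z W D x₂ = Z
    coefficients X Y Z W D y₂ = W
    coefficients X Y Z W D δ  = D

    module _ {X Y : ℤ₍ₚ₎} {x y : ℤ} (x≡X : int x ≡ X [ 1 ]) (y≡Y : int y ≡ Y [ 1 ]) where
      coefficients-mod-p : ∀ g → int (valuation₁ Ẽ x y g) ≡ coefficients X Y 𝟎 𝟎 𝟎 g [ 1 ]
      coefficients-mod-p a₁ = reduce-≡ _ E-int.a₁-integral
      coefficients-mod-p a₂ = reduce-≡ _ E-int.a₂-integral
      coefficients-mod-p a₃ = reduce-≡ _ E-int.a₃-integral
      coefficients-mod-p a₄ = reduce-≡ _ E-int.a₄-integral
      coefficients-mod-p a₆ = reduce-≡ _ E-int.a₆-integral
      coefficients-mod-p x₁ = x≡X
      coefficients-mod-p y₁ = y≡Y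
      coefficients-mod-p x₂ = []-refl
      coefficients-mod-p y₂ = []-refl
      coefficients-mod-p δ  = []-refl

      module _ (on-curve : OnCurve Ẽ x y) {k} (order : HasOrder Ẽ (affine x y) k) (3<k : 3 ℕ.< k) where
        private
          β₁≉0 : ¬ β₁ Ẽ x y ≈ₚ 0ℤ
          β₁≉0 h = proj₂ (proj₂ order) 2 (ℕ.s≤s ℕ.z≤n) (ℕ.<-trans (ℕ.n<1+n 2) 3<k) (β₁≈0⇒2P≡∞ Ẽ x y h)

        β₁-unit : evaluate (coefficients X Y 𝟎 𝟎 𝟎) Universal.β₁ ≢0
        β₁-unit = ≢0-mod-p coefficients-mod-p Universal.β₁ β₁≉0

        β₂-unit : evaluate (coefficients X Y 𝟎 𝟎 𝟎) Universal.β₂ ≢0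
        β₂-unit = ≢0-mod-p coefficients-mod-p Universal.β₂ λ β₂≈0 →
          proj₂ (proj₂ order) 3 (ℕ.s≤s ℕ.z≤n) 3<k (β₂≈0⇒3P≡∞ Ẽ x y on-curve
            (λ y≈ → β₁≉0 (subst (+ p ℤ.∣_) (trans (y-negY≡β₁ Ẽ x y) (sym (ℤ.+-identityʳ (β₁ Ẽ x y)))) y≈)) β₂≈0)

    -- If X ≡ Z then both P₂ + P₁ and P₂ - P₁ have integral slopes, so the
    -- ordinate of P₂ is congruent to those of P₁ and - P₁, and 2 P₁ reduces to ∞.
    abscissae-distinct : ∀ {X Y Z W : ℤ₍ₚ₎} → val Z ≢ val X →
      evaluate (coefficients X Y 𝟎 𝟎 𝟎) Universal.β₁ ≢0 →
      reducePoint (Overℚ.add E (affine (val Z) (val W)) (affine (val X) (val Y))) ≢ ∞ →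
      reducePoint (Overℚ.sub E (affine (val Z) (val W)) (affine (val X) (val Y))) ≢ ∞ →
      (X ⊞ ⊟ Z) ≢0
    abscissae-distinct {X} {Y} {Z} {W} Z≢X β₁≢0 add≢∞ sub≢∞ X≡Z = β₁≢0 ([]-trans
        (≡⇒≡[] {b = Y ⊞ ⊟ Y⁻} (lem (val Y) (E.a₁) (val X) E.a₃))
        ([]-trans (⊞-cong ([]-trans ([]-sym W≡Y) W≡Y⁻) ([]-refl {⊟ Y⁻})) (≡⇒≡[] (ℚ.+-inverseʳ (val Y⁻)))))
      where
      A₁ A₂ Y⁻ : ℤ₍ₚ₎
      A₁ = E.a₁ ⟨ E-int.a₁-integral ⟩
      A₂ = E.a₂ ⟨ E-int.a₂-integral ⟩
      Y⁻ = ⊟ Y ⊞ ⊟ (A₁ ⊠ X) ⊞ ⊟ (E.a₃ ⟨ E-int.a₃-integral ⟩)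
      Z≡X : Z ⊞ ⊟ X ≡ 𝟎 [ 1 ]
      Z≡X = []-trans (≡⇒≡[] {b = ⊟ (X ⊞ ⊟ Z)} (eq (val X) (val Z))) ([]-trans (⊟-cong X≡Z) (≡⇒≡[] refl))
        where eq : ∀ x z → z ℚ.+ ℚ.- x ≡ ℚ.- (x ℚ.+ ℚ.- z)
              eq = solve-∀ ℚ-ring
      W≡Y : W ≡ Y [ 1 ]
      W≡Y = ordinates-congruent E A₁ A₂ Z W X Y refl refl Z≢X add≢∞ Z≡X
      W≡Y⁻ : W ≡ Y⁻ [ 1 ]
      W≡Y⁻ = ordinates-congruent E A₁ A₂ Z W X Y⁻ refl refl Z≢X sub≢∞ Z≡X
      lem : ∀ y a x c → (y ℚ.+ (y ℚ.+ 0ℚ)) ℚ.+ a ℚ.* x ℚ.+ c ≡ y ℚ.+ ℚ.- (ℚ.- y ℚ.+ ℚ.- (a ℚ.* x) ℚ.+ ℚ.- c)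
      lem = solve-∀ ℚ-ring

    somos-of-pair : ∀ {R₁ R₂} (adm : Overℚ.Admissible E R₁ R₂) →
      Nonsingular Ẽ (reducePoint R₁) → reducePoint R₁ ≢ ∞ → reducePoint R₂ ≢ ∞ →
      reducePoint (Overℚ.add E R₂ R₁) ≢ ∞ → reducePoint (Overℚ.sub E R₂ R₁) ≢ ∞ →
      ∃[ k ] HasOrder Ẽ (reducePoint R₁) k × 3 ℕ.< k →
      ∃[ x ] (∃[ a ] ∃[ b ] ∃[ c ] ∃[ d ] IsSomos x a b c d) ×
             (∀ n → val (x n) ≡ Overℚ.specialise E adm (Ψ (+ n)))
    somos-of-pair adm@(Specialisation.admissible {X₀} {Y₀} {Z₀} {W₀} on₁ on₂ X≢Z) ns R₁≢∞ R₂≢∞ add≢∞ sub≢∞ (k , order , 3<k) =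
      (λ n → evaluate ρ (Ψ′ (n ℕ.+ 2))) , (_ , _ , _ , _ , isSomos V c≢0 β₂≢0) , λ n →
        trans (val-evaluate ρ (Ψ′ (n ℕ.+ 2)))
          (trans (eval-≗ val-ρ (Ψ′ (n ℕ.+ 2))) (cong (Overℚ.specialise E adm ∘ Ψ) (index n)))
      where
      r₁ = reducePoint-affine R₁≢∞
      r₂ = reducePoint-affine R₂≢∞
      X Y Z W : ℤ₍ₚ₎
      X = X₀ ⟨ proj₁ r₁ ⟩
      Y = Y₀ ⟨ proj₁ (proj₂ r₁) ⟩
      Z = Z₀ ⟨ proj₁ r₂ ⟩
      W = W₀ ⟨ proj₁ (proj₂ r₂) ⟩
      x y : ℤ
      x = reduce X₀ (proj₁ r₁)
      y = reduce Y₀ (proj₁ (proj₂ r₁))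
      on-curve : OnCurve Ẽ x y
      on-curve = proj₁ (subst (Nonsingular Ẽ) (proj₂ (proj₂ r₁)) ns)
      order′ : HasOrder Ẽ (affine x y) k
      order′ = subst (λ P → HasOrder Ẽ P k) (proj₂ (proj₂ r₁)) order
      x≡X : int x ≡ X [ 1 ]
      x≡X = reduce-≡ X (proj₁ r₁)
      y≡Y : int y ≡ Y [ 1 ]
      y≡Y = reduce-≡ Y (proj₁ (proj₂ r₁))
      c≢0 : (X ⊞ ⊟ Z) ≢0
      c≢0 = abscissae-distinct {X} {Y} {Z} {W} (X≢Z ∘ sym) (β₁-unit {X} {Y} x≡X y≡Y on-curve order′ 3<k) add≢∞ sub≢∞
      D : ℚ
      D = Overℚ.recip X≢Z
      D-inverse : D ℚ.* (X₀ ℚ.- Z₀) ≡ 1ℚ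
      D-inverse = proj₁ (proj₂ (#⇒invertible X≢Z))
        where open HeytingField ℚ.heytingField using (#⇒invertible)
      -- By uniqueness of inverses the rational reciprocal is the integral inverse of the unit
      -- `X - Z`; this makes `δ` integral.
      D≡ : ∃[ u ] val u ≡ D
      D≡ = u , (begin
          val u                                ≡⟨ ℚ.*-identityʳ (val u) ⟨
          val u ℚ.* 1ℚ                         ≡⟨ cong (val u ℚ.*_) D-inverse ⟨
          val u ℚ.* (D ℚ.* (X₀ ℚ.- Z₀))        ≡⟨ lem (val u) D (X₀ ℚ.- Z₀) ⟩
          val u ℚ.* (X₀ ℚ.- Z₀) ℚ.* D          ≡⟨ cong (ℚ._* D) (proj₂ (unit-inverse (X ⊞ ⊟ Z) c≢0)) ⟩
          1ℚ ℚ.* D                             ≡⟨ ℚ.*-identityˡ D ⟩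
          D                                    ∎)
        where
        open ≡-Reasoning
        u : ℤ₍ₚ₎
        u = proj₁ (unit-inverse (X ⊞ ⊟ Z) c≢0)
        lem : ∀ u d c → u ℚ.* (d ℚ.* c) ≡ u ℚ.* c ℚ.* d
        lem = solve-∀ ℚ-ring
      ρ : Generator → ℤ₍ₚ₎
      ρ = coefficients X Y Z W (proj₁ D≡)
      val-ρ : ∀ g → val (ρ g) ≡ Overℚ.valuation E adm g
      val-ρ a₁ = refl
      val-ρ a₂ = refl
      val-ρ a₃ = refl
      val-ρ a₄ = refl
      val-ρ a₆ = refl
      val-ρ x₁ = refl
      val-ρ y₁ = refl
      val-ρ x₂ = refl
      val-ρ y₂ = refl
      val-ρ δ  = proj₂ D≡
      V : IsCurveValuation (val ∘ ρ)
      V = record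
        { on-curve₁ = weierstrass X₀ Y₀ on₁
        ; on-curve₂ = weierstrass Z₀ W₀ on₂
        ; δ-inverse = trans (cong (ℚ._* (X₀ ℚ.- Z₀)) (proj₂ D≡)) D-inverse
        }
        where
        l : ∀ a c x y → y ℚ.* y ℚ.+ a ℚ.* x ℚ.* y ℚ.+ c ℚ.* y ≡ y ℚ.* (y ℚ.* 1ℚ) ℚ.+ a ℚ.* x ℚ.* y ℚ.+ c ℚ.* y
        l = solve-∀ ℚ-ring
        r : ∀ b d e x → x ℚ.* (x ℚ.* (x ℚ.* 1ℚ)) ℚ.+ b ℚ.* (x ℚ.* (x ℚ.* 1ℚ)) ℚ.+ d ℚ.* x ℚ.+ e ≡
                        x ℚ.* x ℚ.* x ℚ.+ b ℚ.* (x ℚ.* x) ℚ.+ d ℚ.* x ℚ.+ e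
        r = solve-∀ ℚ-ring
        weierstrass : ∀ x y → Overℚ.OnCurve E x y →
          y ℚ.* y ℚ.+ E.a₁ ℚ.* x ℚ.* y ℚ.+ E.a₃ ℚ.* y ≡ x ℚ.* x ℚ.* x ℚ.+ E.a₂ ℚ.* (x ℚ.* x) ℚ.+ E.a₄ ℚ.* x ℚ.+ E.a₆
        weierstrass x y on = trans (l E.a₁ E.a₃ x y) (trans on (r E.a₂ E.a₄ E.a₆ x))
      β₂≢0 : evaluate ρ Universal.β₂ ≢0
      -- `β₂` mentions the first point only, so zeros for the second point and `δ` give the same
      -- value by computation.
      β₂≢0 = β₂-unit {X} {Y} x≡X y≡Y on-curve order′ 3<k
      index : ∀ n → idx (n ℕ.+ 2) ≡ + n
      index n = trans (cong (λ k → + k ℤ.- + 2) (ℕ.+-comm n 2)) (lem (+ n))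
        where lem : ∀ z → + 2 ℤ.+ z ℤ.- + 2 ≡ z
              lem = ℤ-Solver.solve-∀

-- Convergence along the even and the odd index terms.

theorem1p5 : (W : ℕ → ℚ) → IsSomos5 W → (W₀W₁≢0 : W 0 ℚ.* W 1 ≢ 0ℚ) →
    (𝚿 : TranslatedDivisionPolynomials) →
    (E : WeierstrassCurve ℚ) → Overℚ.Δ E ≢ 0ℚ →
    (P₁ P₂ Q₁ Q₂ : Point ℚ) → Somos5.IsAssociated W W₀W₁≢0 𝚿 E P₁ P₂ Q₁ Q₂ →
    (p : ℕ) (p-prime : Prime p) → p ≢ 2 → (E-integral : IntegralCurve p E) →
    let open Mod p-prime
        Ẽ = reduceCurve E-integral
    in
    Nonsingular Ẽ (reducePoint P₁) → Nonsingular Ẽ (reducePoint P₂) →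
    Nonsingular Ẽ (reducePoint Q₁) → Nonsingular Ẽ (reducePoint Q₂) →
    reducePoint P₁ ≢ ∞ → reducePoint P₂ ≢ ∞ →
    reducePoint (Overℚ.add E P₂ P₁) ≢ ∞ → reducePoint (Overℚ.sub E P₂ P₁) ≢ ∞ →
    reducePoint Q₁ ≢ ∞ → reducePoint Q₂ ≢ ∞ →
    reducePoint (Overℚ.add E Q₂ Q₁) ≢ ∞ → reducePoint (Overℚ.sub E Q₂ Q₁) ≢ ∞ →
    (∃[ k ] HasOrder Ẽ (reducePoint P₁) k × 3 < k) →
    (∃[ k ] HasOrder Ẽ (reducePoint Q₁) k × 3 < k) →
    0ℤ ≤ord[ p ] Somos5.α W W₀W₁≢0 → 0ℤ ≤ord[ p ] Somos5.γ W W₀W₁≢0 →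
    0ℤ ≤ord[ p ] W 0 → 0ℤ ≤ord[ p ] W 1 →
    ∃[ N ] 1 ≤ N ×
      (∀ m → 1 ≤ m →
         LimitExistsInℤₚ p (λ i → W (2 * m * (p ^ N) ^ i)) ×
         LimitExistsInℤₚ p (λ i → W (2 * m * (p ^ N) ^ i + 1)))
theorem1p5 W _ W₀W₁≢0 𝚿 E _ P₁ P₂ Q₁ Q₂ assoc p p-prime _ E-integral
  P₁-ns _ Q₁-ns _ P₁≢∞ P₂≢∞ P₂+P₁≢∞ P₂-P₁≢∞ Q₁≢∞ Q₂≢∞ Q₂+Q₁≢∞ Q₂-Q₁≢∞ P₁-order Q₁-order
  0≤ord-α 0≤ord-γ 0≤ord-W₀ 0≤ord-W₁ =
  proj₁ limits , proj₁ (proj₂ limits) , λ m 1≤m →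
    LimitExists-≗ (λ i → cong W (sym (ℕ.*-assoc 2 m (q ^ i))))
      (subsequence-limit (2 *_)
        (somos-of-pair E-integral P-admissible P₁-ns P₁≢∞ P₂≢∞ P₂+P₁≢∞ P₂-P₁≢∞ P₁-order)
        (0≤ord⇒integral 0≤ord-α) (0≤ord⇒integral 0≤ord-W₀) even-terms m 1≤m) ,
    LimitExists-≗ (λ i → cong (λ n → W (n + 1)) (sym (ℕ.*-assoc 2 m (q ^ i))))
      (subsequence-limit (λ n → 2 * n + 1)
        (somos-of-pair E-integral Q-admissible Q₁-ns Q₁≢∞ Q₂≢∞ Q₂+Q₁≢∞ Q₂-Q₁≢∞ Q₁-order)
        (0≤ord⇒integral 0≤ord-γ) (0≤ord⇒integral 0≤ord-W₁) odd-terms m 1≤m)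
  where
  open Localisation p-prime
  open Dynamics p-prime using (IsSomos)
  open Limits p-prime
  open Pairs p-prime 𝚿
  open Somos5 W W₀W₁≢0
  open IsAssociated assoc

  -- Fixed before either pair of points enters, so that both subsequences share `q`.
  limits = limit-along-powers

  q : ℕ
  q = p ^ proj₁ limits

  -- Even and odd terms differ only in `index`, the scaling factors and the pair of points. The
  -- closed formulas start at `n = 1`, which `m * q ^ i` always reaches.
  subsequence-limit : ∀ (index : ℕ → ℕ) {a b : ℚ} {ψ : ℕ → ℚ} →
    ∃[ x ] (∃[ c₁ ] ∃[ c₂ ] ∃[ c₃ ] ∃[ c₄ ] IsSomos x c₁ c₂ c₃ c₄) × (∀ n → val (x n) ≡ ψ n) →
    IsIntegral p a → IsIntegral p b → (∀ n → 1 ≤ n → W (index n) ≡ a ^ℚ n ℚ.* b ℚ.* ψ n) →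
    ∀ m → 1 ≤ m → LimitExistsInℤₚ p (λ i → W (index (m * q ^ i)))
  subsequence-limit index {a} {b} {ψ} (x , (_ , _ , _ , _ , S) , x≡ψ) a-int b-int W≡ m 1≤m =
    LimitExists-≗ (λ i → sym (terms (m * q ^ i) (1≤mqⁱ i))) (proj₂ (proj₂ limits) A (b ⟨ b-int ⟩) S m 1≤m)
    where
    A : ℤ₍ₚ₎
    A = a ⟨ a-int ⟩
    1≤mqⁱ : ∀ i → 1 ≤ m * q ^ i
    1≤mqⁱ i = ℕ.*-mono-≤ 1≤m (ℕ.m^n>0 q {{ℕ.m^n≢0 p (proj₁ limits) {{prime⇒nonZero p-prime}}}} i)
    terms : ∀ n → 1 ≤ n → W (index n) ≡ val (pow A n) ℚ.* b ℚ.* val (x n)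
    terms n 1≤n = trans (W≡ n 1≤n)
      (cong₂ (λ s t → s ℚ.* b ℚ.* t) (sym (val-pow A n)) (sym (x≡ψ n)))
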